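{- Let $q$ be a prime power and $\mathbb{A}=\mathbb{F}_q[t]$. The natural density of Chen pairs $(g,g)$, that is, the limit $$\rho=\lim_{m\to\infty}\frac{\#\{g\in\mathbb{A}:\ 1\le\deg g\le m,\ (g,g)\text{ is a Chen pair}\}}{\#\{g\in\mathbb{A}:\ 1\le\deg g\le m\}},$$ exists and is given by $\rho=\frac{49}{72}$ if $q=2$, and $\rho=\frac{q-1}{q}$ if $q>2$.
   Context: $\mathbb{F}_q$ is the finite field with $q$ elements and $\mathbb{A}=\mathbb{F}_q[t]$. For a non-constant $f\in\mathbb{A}$, $\mathbb{A}_f=\mathbb{A}/f\mathbb{A}$ is the residue class ring modulo $f$, and $\mathcal{A}_f=\{h\in\mathbb{A}:\deg h<\deg f\}\cup\{0\}$, a complete set of representatives of the residue classes modulo $f$; for $h\in\mathcal{A}_f$, $\bar h$ denotes the residue class of $h$ modulo $f$. Let $f,g\in\mathbb{A}$ be non-constant. A function $\sigma:\mathbb{A}_f\to\mathbb{A}_g$ is a polynomial function if there is $F\in\mathbb{A}[x]$ such that $\sigma(\bar h)=F(h)\bmod g$ for all $h\in\mathcal{A}_f$. A function $\sigma:\mathbb{A}_f\to\mathbb{A}_g$ is called congruence preserving if for all $h_1,h_2\in\mathcal{A}_f$ and every $h\in\mathbb{A}$ dividing $g$, $h_1\equiv h_2\pmod h$ implies $\sigma(\bar h_1)\equiv\sigma(\bar h_2)\pmod h$ (here $h_1,h_2$ are regarded as elements of $\mathbb{A}$, and reduction modulo $h$ of elements of $\mathbb{A}_g$ is well defined since $h\mid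 g$). $(f,g)$ is a Chen pair if every congruence preserving function from $\mathbb{A}_f$ to $\mathbb{A}_g$ is a polynomial function. -}

module Defs where

open import Level using (Level; _⊔_)
open import Algebra.Bundles using (CommutativeRing)
open import Algebra.Bundles.Raw using (RawRing)
import Algebra.Definitions as AlgebraDefinitions
import Algebra.Definitions.RawMagma as RawMagmaDefinitions
open import Data.Fin.Base using (Fin)
open import Data.Integer.Base using (+_)
open import Data.List.Base using (List; []; _∷_; foldr; map)
open import Data.Nat.Base as ℕ using (ℕ; zero; suc; NonZero)
open import Data.Nat.Primality using (Prime)
open import Data.Product.Base using (Σ; Σ-syntax; ∃; ∃-syntax; ∃₂; _×_; proj₁)
open import Data.Rational.Base as ℚ using (ℚ; 0ℚ)
open import Data.Sum.Base using (_⊎_)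
open import Function.Bundles using (Inverse)
open import Function.Definitions using (Congruent)
open import Relation.Binary.Bundles using (Setoid)
import Relation.Binary.Construct.On as On
open import Relation.Binary.PropositionalEquality using (_≡_; setoid)
open import Relation.Nullary.Negation.Core using (¬_)
open import Relation.Unary using (Pred)

private
  variable
    a c p ℓ : Level

PrimePower : ℕ → Set
PrimePower q = ∃₂ λ p k → Prime p × 1 ℕ.≤ k × q ≡ p ℕ.^ k

HasCardinality : Setoid a ℓ → ℕ → Set (a ⊔ ℓ)
HasCardinality S n = Inverse S (setoid (Fin n))

Subsetoid : (S : Setoid a ℓ) → Pred (Setoid.Carrier S) p → Setoid (a ⊔ p) ℓ
Subsetoid S P = On.setoid {B = Σ (Setoid.Carrier S) P} S proj₁

-- The quotients x m / y m converge to r; y m need only be nonzero for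
-- all sufficiently large m.
RatioTendsTo : (x y : ℕ → ℕ) → ℚ → Set
RatioTendsTo x y r =
  ∀ (ε : ℚ) → 0ℚ ℚ.< ε →
  ∃[ N ] ∀ m → N ℕ.≤ m →
  Σ[ y≢0 ∈ NonZero (y m) ]
  ℚ.∣ (+ x m ℚ./ y m) {{y≢0}} ℚ.- r ∣ ℚ.< ε

IsField : CommutativeRing c ℓ → Set (c ⊔ ℓ)
IsField R = ¬ (1# ≈ 0#) × (∀ x → ¬ (x ≈ 0#) → Invertible 1# _*_ x)
  where
  open CommutativeRing R
  open AlgebraDefinitions _≈_ using (Invertible)

-- A polynomial is the list of its coefficients, constant term first.
-- Trailing zeros are allowed, so polynomials are compared coefficientwise.
module Polynomial (R : RawRing c ℓ) where

  open RawRing R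

  Poly : Set c
  Poly = List Carrier

  coeff : Poly → ℕ → Carrier
  coeff []      _       = 0#
  coeff (x ∷ _) zero    = x
  coeff (_ ∷ f) (suc i) = coeff f i

  infix  4 _≈ₚ_
  infixl 6 _+ₚ_
  infixl 7 _*ₚ_

  _≈ₚ_ : Poly → Poly → Set ℓ
  f ≈ₚ g = ∀ i → coeff f i ≈ coeff g i

  _+ₚ_ : Poly → Poly → Poly
  []      +ₚ g       = g
  (x ∷ f) +ₚ []      = x ∷ f
  (x ∷ f) +ₚ (y ∷ g) = x + y ∷ f +ₚ g

  _*ₚ_ : Poly → Poly → Poly
  []      *ₚ g = []
  (x ∷ f) *ₚ g = map (x *_) g +ₚ (0# ∷ f *ₚ g)

  polyRawRing : RawRing c ℓ
  polyRawRing = record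
    { Carrier = Poly
    ; _≈_     = _≈ₚ_
    ; _+_     = _+ₚ_
    ; _*_     = _*ₚ_
    ; -_      = map -_
    ; 0#      = []
    ; 1#      = 1# ∷ []
    }

  eval : Poly → Carrier → Carrier
  eval f x = foldr (λ a b → a + x * b) 0# f

  -- The zero polynomial has no degree.
  HasDegree : Poly → ℕ → Set ℓ
  HasDegree f n = ¬ (coeff f n ≈ 0#) × (∀ i → n ℕ.< i → coeff f i ≈ 0#)

module ChenPairs (K : CommutativeRing c ℓ) where

  open CommutativeRing K using (rawRing; refl; sym; trans)
  open Polynomial rawRing public using (Poly; HasDegree; polyRawRing)
  open RawRing polyRawRing
  open RawMagmaDefinitions *-rawMagma using (_∣_)
  private module 𝔸[x] = Polynomial polyRawRing

  polySetoid : Setoid c ℓ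
  polySetoid = record
    { Carrier       = Poly
    ; _≈_           = _≈_
    ; isEquivalence = record
      { refl  = λ _ → refl
      ; sym   = λ f≈g i → sym (f≈g i)
      ; trans = λ f≈g g≈h i → trans (f≈g i) (g≈h i)
      }
    }

  infix 4 _≡_[mod_]

  _≡_[mod_] : Poly → Poly → Poly → Set (c ⊔ ℓ)
  x ≡ y [mod f ] = f ∣ x + - y

  𝒜 : Poly → Pred Poly ℓ
  𝒜 f h = (∃₂ λ m n → HasDegree h m × HasDegree f n × m ℕ.< n) ⊎ h ≈ 0#

  -- The residue class ring modulo f is Poly with congruence modulo f as its
  -- equality, so a function between residue class rings is a map on Poly
  -- that respects the two congruences.
  IsResidueMap : (f g : Poly) → (Poly → Poly) → Set (c ⊔ ℓ)
  IsResidueMap f g = Congruent (_≡_[mod f ]) (_≡_[mod g ])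

  IsPolynomialFunction : (f g : Poly) → (Poly → Poly) → Set (c ⊔ ℓ)
  IsPolynomialFunction f g σ =
    ∃[ F ] ∀ h → 𝒜 f h → σ h ≡ 𝔸[x].eval F h [mod g ]

  IsCongruencePreserving : (f g : Poly) → (Poly → Poly) → Set (c ⊔ ℓ)
  IsCongruencePreserving f g σ =
    ∀ h₁ h₂ → 𝒜 f h₁ → 𝒜 f h₂ → ∀ h → h ∣ g →
    h₁ ≡ h₂ [mod h ] → σ h₁ ≡ σ h₂ [mod h ]

  ChenPair : Poly → Poly → Set (c ⊔ ℓ)
  ChenPair f g =
    ∀ σ → IsResidueMap f g σ →
    IsCongruencePreserving f g σ → IsPolynomialFunction f g σ

  DegreeFrom1To : ℕ → Pred Poly ℓ
  DegreeFrom1To m g = ∃[ n ] HasDegree g n × 1 ℕ.≤ n × n ℕ.≤ m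

  -- Both sets are finite when K is a finite field; their cardinalities are
  -- asserted to exist because stating them as functions of m would require
  -- deciding P.
  HasNaturalDensity : Pred Poly p → ℚ → Set (c ⊔ ℓ ⊔ p)
  HasNaturalDensity P ρ =
    ∃₂ λ (count total : ℕ → ℕ) →
      (∀ m → HasCardinality
               (Subsetoid polySetoid λ g → DegreeFrom1To m g × P g) (count m)) ×
      (∀ m → HasCardinality
               (Subsetoid polySetoid (DegreeFrom1To m)) (total m)) ×
      RatioTendsTo count total ρ

{-# OPTIONS --safe #-}

-- By the Chinese remainder theorem, (g , g) is a Chen pair iff (Pᵉ , Pᵉ) is one for every exact
-- prime power factor Pᵉ of g.  Lagrange interpolation settles e = 1, and a cubic settles e = 2
-- when A / P has two elements.  In all other cases there is a congruence preserving map, supported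
-- on the multiples of Pᵉ, that no polynomial F induces, as u v ∣ F (u + v) - F u - F v + F 0.
-- Hence the Chen moduli are the squarefree g if q > 2, and if q = 2 the products tⁱ (t + 1)ʲ f
-- with i, j ≤ 2 and f squarefree and prime to t (t + 1).
--
-- Squarefree polynomials are counted exactly: writing g ≠ 0 uniquely as s h² with s squarefree
-- and h monic, (g , c) ↦ s (c + t h)² is a bijection from pairs with deg g < n and c a scalar to
-- the non-squarefree polynomials of degree < n + 2.  For q = 2, removing the factors t and t + 1
-- and restoring them with exponents up to 2 multiplies the leading coefficient 1/2 of the count
-- by (2/3)² and then by (7/4)², giving 49/72 with a quadratic error.

module Submission where

open import Defs
open import Algebra.Bundles using (CommutativeRing)
open import Algebra.Bundles.Raw using (RawRing)
import Algebra.Definitions.RawMagma as RawMagmaDefinitions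
open import Algebra.Structures using (IsCommutativeRing)
open import Data.Empty using (⊥; ⊥-elim)
open import Data.Fin.Base as Fin using (Fin; zero; suc)
import Data.Fin.Permutation as Permutation
import Data.Fin.Properties as Fin
open import Data.Integer.Base as ℤ using (ℤ; +_; -[1+_])
import Data.Integer.Properties as ℤ
import Data.Integer.Solver as ℤSolver
open import Data.List.Base using ([]; _∷_; map)
open import Data.Maybe.Base using (Maybe; just; nothing)
open import Data.Nat.Base as ℕ using (ℕ; zero; suc; _≤_; _<_; _∸_; z≤n; s≤s; z<s; >-nonZero)
import Data.Nat.Properties as ℕ
open import Data.Nat.Properties using (<-trans)
import Data.Nat.Solver as ℕSolver
open import Data.Product.Base using (Σ; ∃; ∃₂; _×_; _,_; proj₁; proj₂)
open import Data.Product.Function.NonDependent.Setoid using (_×-inverse_)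
import Data.Product.Relation.Binary.Pointwise.NonDependent as ×
open import Data.Rational.Base as ℚ using (ℚ; mkℚ; toℚᵘ; _/_)
import Data.Rational.Properties as ℚ
open import Data.Rational.Unnormalised.Base as ℚᵘ using (mkℚᵘ; *<*)
import Data.Rational.Unnormalised.Properties as ℚᵘ
open import Data.Sum.Base as Sum using (_⊎_; inj₁; inj₂; [_,_]′)
open import Data.Sum.Function.Setoid using (_⊎-inverse_)
import Data.Sum.Relation.Binary.Pointwise as ⊎
open import Data.Unit.Polymorphic.Base using (⊤; tt)
open import Function.Base using (_∘_; id)
open import Function.Bundles using (Inverse)
import Function.Construct.Composition as Compose
import Function.Construct.Symmetry as Symmetry
open import Function.Definitions using (Congruent; Injective)
open import Level using (Level; _⊔_)
open import Relation.Binary.Bundles using (Setoid)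
open import Relation.Binary.PropositionalEquality as ≡ using (_≡_; _≢_)
open import Relation.Nullary using (¬_; Dec; yes; no; ¬?)
import Relation.Nullary.Decidable as Dec
open import Relation.Nullary.Decidable using (_×-dec_)
open import Relation.Unary using (Pred; _∪_; _∩_)

-- The obstruction needs u and v such that u, v and u + v are nonzero modulo Pᵉ while u v is zero.
-- For u = Pᵉ⁻¹ and v = b u, with e ≥ 2, this asks that b and 1 + b both be units of A / P; such a b
-- exists unless A / P has two elements. In that case u = Pᵉ⁻² and v = Pᵉ⁻¹ serve instead, but only
-- from e = 3 on. This is why q = 2 is special, and why only its two linear primes are.
--
-- The factors 2/3 and 7/4 come from the generating series of the counts. Removing a linear prime
-- divides the series by 1 + z, restoring it with exponents up to 2 multiplies by 1 + z + z², and
-- the growth rate 2ⁿ corresponds to z = 1/2. The divisor 1 + z vanishes at z = -1, on the unit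
-- circle, so each division costs one power of n in the error and not an exponential.
--
-- The Chen property quantifies over all maps and cannot be tested by search. Cardinalities are
-- explicit bijections, so it has to be replaced by predicates that bounded search decides; the
-- converse half of the classification is therefore a disjunction: a good factorisation or a
-- refutation.

-- Divisibility, congruences and congruence preserving maps over a commutative ring.

module RingFacts {c ℓ} (R : CommutativeRing c ℓ) where

  open CommutativeRing R hiding (zero)
  open RawMagmaDefinitions *-rawMagma public using (_∣_; _∣ʳ_; _,_)
  open Polynomial rawRing using (Poly; eval) renaming (_+ₚ_ to _⊕_; _*ₚ_ to _⊛_)

  -- Integer coefficients let normal forms cancel constants and signs by a decidable test, although
  -- equality in `R` need not be decidable.
  module IntegerSolver where
    open import Algebra.Properties.Ring ring
      using (-‿distribˡ-*; -‿distribʳ-*)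
    open import Algebra.Properties.AbelianGroup +-abelianGroup
      using () renaming (⁻¹-∙-comm to -‿+-comm; ⁻¹-involutive to -‿involutive; ε⁻¹≈ε to -0≈0)
    open import Algebra.Properties.Semiring.Mult.TCOptimised semiring
      using (×-homo-+; ×1-homo-*) renaming (_×_ to _·_)
    open import Algebra.Solver.Ring.AlmostCommutativeRing
      using (_-Raw-AlmostCommutative⟶_; fromCommutativeRing)
    open import Relation.Binary.Reasoning.Setoid setoid

    fromℤ : ℤ → Carrier
    fromℤ (+ n)    = n · 1#
    fromℤ -[1+ n ] = - (suc n · 1#)

    suc-· : ∀ n → suc n · 1# ≈ 1# + n · 1#
    suc-· n = ×-homo-+ 1# 1 n

    fromℤ-⊖ : ∀ m n → fromℤ (m ℤ.⊖ n) ≈ m · 1# + - (n · 1#)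
    fromℤ-⊖ m       zero    = sym (trans (+-congˡ -0≈0) (+-identityʳ _))
    fromℤ-⊖ zero    (suc n) = sym (+-identityˡ _)
    fromℤ-⊖ (suc m) (suc n) = begin
      fromℤ (suc m ℤ.⊖ suc n)                      ≡⟨ ≡.cong fromℤ (ℤ.[1+m]⊖[1+n]≡m⊖n m n) ⟩
      fromℤ (m ℤ.⊖ n)                              ≈⟨ fromℤ-⊖ m n ⟩
      m · 1# + - (n · 1#)                          ≈⟨ +-congʳ (+-identityʳ _) ⟨
      m · 1# + 0# + - (n · 1#)                     ≈⟨ +-congʳ (+-congˡ (-‿inverseʳ 1#)) ⟨
      m · 1# + (1# + - 1#) + - (n · 1#)            ≈⟨ +-congʳ (+-assoc _ _ _) ⟨
      m · 1# + 1# + - 1# + - (n · 1#)              ≈⟨ +-assoc _ _ _ ⟩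
      m · 1# + 1# + (- 1# + - (n · 1#))            ≈⟨ +-cong (trans (+-comm _ _) (sym (suc-· m)))
                                                        (trans (-‿+-comm _ _) (-‿cong (sym (suc-· n)))) ⟩
      suc m · 1# + - (suc n · 1#)                  ∎

    +-homo : ∀ i j → fromℤ (i ℤ.+ j) ≈ fromℤ i + fromℤ j
    +-homo (+ m)    (+ n)    = ×-homo-+ 1# m n
    +-homo (+ m)    -[1+ n ] = fromℤ-⊖ m (suc n)
    +-homo -[1+ m ] (+ n)    = trans (fromℤ-⊖ n (suc m)) (+-comm _ _)
    +-homo -[1+ m ] -[1+ n ] = begin
      - (suc (suc (m ℕ.+ n)) · 1#)         ≡⟨ ≡.cong (λ k → - (suc k · 1#)) (ℕ.+-suc m n) ⟨
      - ((suc m ℕ.+ suc n) · 1#)           ≈⟨ -‿cong (×-homo-+ 1# (suc m) (suc n)) ⟩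
      - (suc m · 1# + suc n · 1#)          ≈⟨ -‿+-comm _ _ ⟨
      - (suc m · 1#) + - (suc n · 1#)      ∎

    neg-homo : ∀ i → fromℤ (ℤ.- i) ≈ - fromℤ i
    neg-homo (+ zero)  = sym -0≈0
    neg-homo (+ suc n) = refl
    neg-homo -[1+ n ]  = sym (-‿involutive _)

    ⁺*⁺ : ∀ m n → fromℤ (+ m ℤ.* + n) ≈ m · 1# * n · 1#
    ⁺*⁺ m n = trans (reflexive (≡.cong fromℤ (≡.sym (ℤ.pos-* m n)))) (×1-homo-* m n)

    *-homo : ∀ i j → fromℤ (i ℤ.* j) ≈ fromℤ i * fromℤ j
    *-homo (+ m)    (+ n)    = ⁺*⁺ m n
    *-homo (+ m)    -[1+ n ] = begin
      fromℤ (+ m ℤ.* ℤ.- + suc n)      ≡⟨ ≡.cong fromℤ (ℤ.neg-distribʳ-* (+ m) (+ suc n)) ⟨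
      fromℤ (ℤ.- (+ m ℤ.* + suc n))    ≈⟨ neg-homo (+ m ℤ.* + suc n) ⟩
      - fromℤ (+ m ℤ.* + suc n)        ≈⟨ -‿cong (⁺*⁺ m (suc n)) ⟩
      - (m · 1# * suc n · 1#)          ≈⟨ -‿distribʳ-* _ _ ⟩
      m · 1# * - (suc n · 1#)          ∎
    *-homo -[1+ m ] (+ n)    = begin
      fromℤ ((ℤ.- + suc m) ℤ.* + n)    ≡⟨ ≡.cong fromℤ (ℤ.neg-distribˡ-* (+ suc m) (+ n)) ⟨
      fromℤ (ℤ.- (+ suc m ℤ.* + n))    ≈⟨ neg-homo (+ suc m ℤ.* + n) ⟩
      - fromℤ (+ suc m ℤ.* + n)        ≈⟨ -‿cong (⁺*⁺ (suc m) n) ⟩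
      - (suc m · 1# * n · 1#)          ≈⟨ -‿distribˡ-* _ _ ⟩
      - (suc m · 1#) * n · 1#          ∎
    *-homo -[1+ m ] -[1+ n ] = begin
      (suc m ℕ.* suc n) · 1#           ≈⟨ ×1-homo-* (suc m) (suc n) ⟩
      suc m · 1# * suc n · 1#          ≈⟨ -‿involutive _ ⟨
      - - (suc m · 1# * suc n · 1#)    ≈⟨ -‿cong (-‿distribʳ-* _ _) ⟩
      - (suc m · 1# * - (suc n · 1#))  ≈⟨ -‿distribˡ-* _ _ ⟩
      - (suc m · 1#) * - (suc n · 1#)  ∎

    homomorphism : ℤ.+-*-rawRing -Raw-AlmostCommutative⟶ fromCommutativeRing R
    homomorphism = record
      { ⟦_⟧    = fromℤ
      ; +-homo = +-homo
      ; *-homo = *-homo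
      ; -‿homo = neg-homo
      ; 0-homo = refl
      ; 1-homo = refl
      }

    fromℤ≟ : ∀ i j → Maybe (fromℤ i ≈ fromℤ j)
    fromℤ≟ i j with i ℤ.≟ j
    ... | yes i≡j = just (reflexive (≡.cong fromℤ i≡j))
    ... | no _    = nothing

    open import Algebra.Solver.Ring ℤ.+-*-rawRing (fromCommutativeRing R) homomorphism fromℤ≟
      public using (solve; _:=_; _:+_; _:*_; _:-_; :-_; con)

  open IntegerSolver public using (solve; _:=_; _:+_; _:*_; _:-_; :-_; con)

  infix 4 _≡_[mod_]
  _≡_[mod_] : Carrier → Carrier → Carrier → Set (c ⊔ ℓ)
  x ≡ y [mod f ] = f ∣ x + - y

  private variable
    a b d f g x y z w : Carrier

  ∣-refl : f ∣ f
  ∣-refl = 1# , *-identityˡ _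

  ∣-trans : f ∣ g → g ∣ x → f ∣ x
  ∣-trans (q , qf≈g) (r , rg≈x) = r * q , trans (*-assoc _ _ _) (trans (*-congˡ qf≈g) rg≈x)

  ∣-resp : f ≈ g → x ≈ y → f ∣ x → g ∣ y
  ∣-resp f≈g x≈y (q , qf≈x) = q , trans (*-congˡ (sym f≈g)) (trans qf≈x x≈y)

  ∣0 : f ∣ 0#
  ∣0 = 0# , zeroˡ _

  ∣*ˡ : ∀ x → f ∣ y → f ∣ x * y
  ∣*ˡ x (q , e) = x * q , trans (*-assoc _ _ _) (*-congˡ e)

  ∣*ʳ : ∀ y → f ∣ x → f ∣ x * y
  ∣*ʳ y p = ∣-resp refl (*-comm _ _) (∣*ˡ y p)

  ∣-* : f ∣ x → g ∣ y → f * g ∣ x * y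
  ∣-* {f} {x} {g} {y} (q , e) (r , e′) = q * r ,
    trans (solve 4 (λ q r f g → q :* r :* (f :* g) := q :* f :* (r :* g)) refl q r f g) (*-cong e e′)

  ∣+ : f ∣ x → f ∣ y → f ∣ x + y
  ∣+ (q , e) (r , e′) = q + r , trans (distribʳ _ _ _) (+-cong e e′)

  ∣- : f ∣ x → f ∣ - x
  ∣- {f} (q , e) = - q ,
    trans (solve 2 (λ q f → :- q :* f := :- (q :* f)) refl q f) (-‿cong e)

  mod-reflexive : x ≈ y → x ≡ y [mod f ]
  mod-reflexive x≈y = ∣-resp refl (sym (trans (+-congʳ x≈y) (-‿inverseʳ _))) ∣0

  mod-refl : x ≡ x [mod f ]
  mod-refl = mod-reflexive refl

  mod-sym : x ≡ y [mod f ] → y ≡ x [mod f ]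
  mod-sym {x} {y} p =
    ∣-resp refl (solve 2 (λ x y → :- (x :- y) := y :- x) refl x y) (∣- p)

  mod-trans : x ≡ y [mod f ] → y ≡ z [mod f ] → x ≡ z [mod f ]
  mod-trans {x} {y} {f} {z} p q =
    ∣-resp refl (solve 3 (λ x y z → (x :- y) :+ (y :- z) := x :- z) refl x y z) (∣+ p q)

  mod-+ : x ≡ y [mod f ] → z ≡ w [mod f ] → x + z ≡ y + w [mod f ]
  mod-+ {x} {y} {f} {z} {w} p q =
    ∣-resp refl (solve 4 (λ x y z w → (x :- y) :+ (z :- w) := (x :+ z) :- (y :+ w)) refl x y z w) (∣+ p q)

  mod-* : x ≡ y [mod f ] → z ≡ w [mod f ] → x * z ≡ y * w [mod f ]
  mod-* {x} {y} {f} {z} {w} p q =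
    ∣-resp refl (solve 4 (λ x y z w → z :* (x :- y) :+ y :* (z :- w) := x :* z :- y :* w) refl x y z w)
      (∣+ (∣*ˡ z p) (∣*ˡ y q))

  mod-∣ : d ∣ f → x ≡ y [mod f ] → x ≡ y [mod d ]
  mod-∣ = ∣-trans

  mod-resp : x ≈ y → z ≈ w → x ≡ z [mod f ] → y ≡ w [mod f ]
  mod-resp p q = ∣-resp refl (+-cong p (-‿cong q))

  mod0⇒∣ : x ≡ 0# [mod f ] → f ∣ x
  mod0⇒∣ {x} = ∣-resp refl (solve 1 (λ x → x :- con ℤ.0ℤ := x) refl x)

  mod-∣-resp : d ∣ f → x ≡ y [mod f ] → d ∣ x → d ∣ y
  mod-∣-resp {d} {f} {x} {y} d∣f p d∣x =
    ∣-resp refl (solve 2 (λ x y → x :+ :- (x :- y) := y) refl x y) (∣+ d∣x (∣- (mod-∣ d∣f p)))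

  Comaximal : Carrier → Carrier → Set (c ⊔ ℓ)
  Comaximal a b = ∃₂ λ u v → u * a + v * b ≈ 1#

  comaximal-sym : Comaximal a b → Comaximal b a
  comaximal-sym (u , v , e) = v , u , trans (+-comm _ _) e

  comaximal-1 : Comaximal a 1#
  comaximal-1 {a} = 0# , 1# , solve 1 (λ a → con ℤ.0ℤ :* a :+ con ℤ.1ℤ :* con ℤ.1ℤ := con ℤ.1ℤ) refl a

  comaximal-* : Comaximal a b → Comaximal a d → Comaximal a (b * d)
  comaximal-* {a} {b} {d} (u , v , e) (u′ , v′ , e′) =
    u * u′ * a + u * v′ * d + v * b * u′ , v * v′ ,
    trans (solve 7 (λ a b d u v u′ v′ →
             (u :* u′ :* a :+ u :* v′ :* d :+ v :* b :* u′) :* a :+ v :* v′ :* (b :* d)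
             := (u :* a :+ v :* b) :* (u′ :* a :+ v′ :* d)) refl a b d u v u′ v′)
      (trans (*-cong e e′) (*-identityˡ _))

  comaximal-resp : a ≡ b [mod d ] → Comaximal a d → Comaximal b d
  comaximal-resp {a} {b} {d} (k , q) (u , v , e) = u , v + u * k ,
    trans (solve 5 (λ u v k b d → u :* b :+ (v :+ u :* k) :* d := (u :* b :+ u :* (k :* d)) :+ v :* d) refl u v k b d)
    (trans (+-congʳ (+-congˡ (*-congˡ q)))
    (trans (solve 5 (λ u v a b d → u :* b :+ u :* (a :- b) :+ v :* d := u :* a :+ v :* d) refl u v a b d) e))

  comaximal-∣* : Comaximal a b → a ∣ b * x → a ∣ x
  comaximal-∣* {a} {b} {x} (u , v , e) p =
    ∣-resp refl (trans (solve 5 (λ a b x u v → x :* u :* a :+ v :* (b :* x) :=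
          (u :* a :+ v :* b) :* x) refl a b x u v)
      (trans (*-congʳ e) (*-identityˡ x)))
      (∣+ (∣*ˡ (x * u) ∣-refl) (∣*ˡ v p))

  comaximal-*∣ : Comaximal a b → a ∣ x → b ∣ x → a * b ∣ x
  comaximal-*∣ {a} {b} {x} (u , v , e) a∣x b∣x =
    ∣-resp refl (trans (solve 5 (λ a b x u v → u :* (a :* x) :+ v :* (x :* b) :=
          (u :* a :+ v :* b) :* x) refl a b x u v)
      (trans (*-congʳ e) (*-identityˡ x)))
      (∣+ (∣*ˡ u (∣-* ∣-refl b∣x)) (∣*ˡ v (∣-* a∣x ∣-refl)))

  eval-⊕ : ∀ F G x → eval (F ⊕ G) x ≈ eval F x + eval G x
  eval-⊕ []      G       x = sym (+-identityˡ _)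
  eval-⊕ (a ∷ F) []      x = sym (+-identityʳ _)
  eval-⊕ (a ∷ F) (b ∷ G) x = trans (+-congˡ (*-congˡ (eval-⊕ F G x)))
    (solve 5 (λ a b x u v → a :+ b :+ x :* (u :+ v) := (a :+ x :* u) :+ (b :+ x :* v)) refl a b x (eval F x)
          (eval G x))

  eval-scale : ∀ a F x → eval (map (a *_) F) x ≈ a * eval F x
  eval-scale a []      x = sym (zeroʳ a)
  eval-scale a (b ∷ F) x = trans (+-congˡ (*-congˡ (eval-scale a F x)))
    (solve 4 (λ a b x u → a :* b :+ x :* (a :* u) := a :* (b :+ x :* u)) refl a b x (eval F x))

  eval-⊛ : ∀ F G x → eval (F ⊛ G) x ≈ eval F x * eval G x
  eval-⊛ []      G x = sym (zeroˡ _)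
  eval-⊛ (a ∷ F) G x = trans (eval-⊕ (map (a *_) G) (0# ∷ F ⊛ G) x)
    (trans (+-cong (eval-scale a G x) (+-congˡ (*-congˡ (eval-⊛ F G x))))
    (solve 4 (λ a x u v → a :* v :+ (con ℤ.0ℤ :+ x :* (u :* v)) := (a :+ x :* u) :* v) refl a x (eval F x)
          (eval G x)))

  eval-mod : ∀ F → x ≡ y [mod f ] → eval F x ≡ eval F y [mod f ]
  eval-mod []      p = mod-refl
  eval-mod (a ∷ F) p = mod-+ mod-refl (mod-* p (eval-mod F p))

  -- For a + x F the second difference is u (F (u + v) - F u) + v (F (u + v) - F v). The brackets
  -- are first differences of F, divisible by v and by u, so no induction hypothesis enters.
  second-difference : ∀ F u v →
    u * v ∣ eval F (u + v) + - eval F u + - eval F v + eval F 0#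
  second-difference []      u v = ∣-resp refl (solve 0
        (con ℤ.0ℤ := con ℤ.0ℤ :- con ℤ.0ℤ :- con ℤ.0ℤ :+ con ℤ.0ℤ) refl) ∣0
  second-difference (a ∷ F) u v =
    ∣-resp refl
      (solve 7 (λ a u v s p q z → u :* (s :- p) :+ (s :- q) :* v :=
         a :+ (u :+ v) :* s :- (a :+ u :* p) :- (a :+ v :* q) :+ (a :+ con ℤ.0ℤ :* z))
         refl a u v (eval F (u + v)) (eval F u) (eval F v) (eval F 0#))
      (∣+ (∣-* (∣-refl {u}) (eval-mod F (1# , solve 2 (λ u v → con ℤ.1ℤ :* v := u :+ v :- u) refl u v)))
          (∣-* (eval-mod F (1# , solve 2 (λ u v → con ℤ.1ℤ :* u := u :+ v :- v) refl u v)) (∣-refl {v})))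

  -- Arguments range over the whole ring and not over representatives; taking `h` to be `g` shows
  -- that such a map respects congruence modulo `g`.
  Preserving : Carrier → (Carrier → Carrier) → Set (c ⊔ ℓ)
  Preserving g σ = ∀ h → h ∣ g → ∀ x y → x ≡ y [mod h ] → σ x ≡ σ y [mod h ]

  PolynomialModulo : Carrier → (Carrier → Carrier) → Set (c ⊔ ℓ)
  PolynomialModulo g σ = ∃ λ F → ∀ x → σ x ≡ eval F x [mod g ]

  Chen : Carrier → Set (c ⊔ ℓ)
  Chen g = ∀ σ → Preserving g σ → PolynomialModulo g σ

  chen-resp : f ≈ g → Chen f → Chen g
  chen-resp f≈g chen σ σ-pres
    with F , eq ← chen σ (λ h h∣f → σ-pres h (∣-resp refl f≈g h∣f))
    = F , λ x → ∣-resp f≈g refl (eq x)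

  chen-1 : g ∣ 1# → Chen g
  chen-1 g∣1 σ _ = [] , λ x → ∣-resp refl (*-identityʳ _) (∣*ˡ _ g∣1)

  -- Divisors of `a` and of `b` divide `a * b`, so the map is preserving for each factor. The two
  -- interpolants are glued by idempotents: `v * b` is 1 modulo `a` and 0 modulo `b`, and `u * a`
  -- the reverse.
  chen-* : Comaximal a b → Chen a → Chen b → Chen (a * b)
  chen-* {a} {b} co@(u , v , e) chen-a chen-b σ σ-pres
    with F , σ≡F ← chen-a σ (λ h h∣a → σ-pres h (∣*ʳ b h∣a))
    with G , σ≡G ← chen-b σ (λ h h∣b → σ-pres h (∣*ˡ a h∣b))
    = H , λ x → comaximal-*∣ co
        (mod-trans (σ≡F x) (mod-sym (mod-trans (mod-reflexive (eval-H x)) (H≡F x))))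
        (mod-trans (σ≡G x) (mod-sym (mod-trans (mod-reflexive (eval-H x)) (H≡G x))))
    where
    H = map (v * b *_) F ⊕ map (u * a *_) G
    eval-H : ∀ x → eval H x ≈ v * b * eval F x + u * a * eval G x
    eval-H x = trans (eval-⊕ (map (v * b *_) F) _ x) (+-cong (eval-scale (v * b) F x) (eval-scale (u * a) G x))
    H≡F : ∀ x → v * b * eval F x + u * a * eval G x ≡ eval F x [mod a ]
    H≡F x = u * (eval G x - eval F x) ,
      trans (solve 6 (λ a b u v f g → u :* (g :- f) :* a := v :* b :* f :+ u :* a :* g :- (u :* a :+ v :* b) :* f)
              refl a b u v (eval F x) (eval G x))
            (+-congˡ (-‿cong (trans (*-congʳ e) (*-identityˡ _))))
    H≡G : ∀ x → v * b * eval F x + u * a * eval G x ≡ eval G x [mod b ]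
    H≡G x = v * (eval F x - eval G x) ,
      trans (solve 6 (λ a b u v f g → v :* (f :- g) :* b := v :* b :* f :+ u :* a :* g :- (u :* a :+ v :* b) :* g)
              refl a b u v (eval F x) (eval G x))
            (+-congˡ (-‿cong (trans (*-congʳ e) (*-identityˡ _))))

  -- Newton's scheme, one node at a time. `W` is the product of the x - rᵢ over the nodes so far, so
  -- adding a multiple of it disturbs no earlier value. Its comaximality with `f` is carried along
  -- because the next correction divides by its value at the new node.
  newton : ∀ {f n} (r : Fin n → Carrier) (σ : Carrier → Carrier) →
    (∀ i j → ¬ (i ≡ j) → Comaximal (r i + - r j) f) →
    ∃₂ λ F W → (∀ i → σ (r i) ≡ eval F (r i) [mod f ]) ×
      (∀ i → eval W (r i) ≈ 0#) ×
      (∀ x → (∀ i → Comaximal (x + - r i) f) → Comaximal (eval W x) f)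
  newton {f} {zero} r σ sep = [] , 1# ∷ [] , (λ ()) , (λ ()) , λ x _ →
    1# , 0# , solve 2 (λ x f → con ℤ.1ℤ :* (con ℤ.1ℤ :+ x :* con ℤ.0ℤ) :+ con ℤ.0ℤ :* f := con ℤ.1ℤ) refl x f
  newton {f} {suc n} r σ sep
    with F , W , σ≡F , W≈0 , W-comax ← newton (λ i → r (suc i)) σ (λ i j i≢j → sep (suc i) (suc j)
          (λ { ≡.refl → i≢j ≡.refl }))
    with u , v , e ← W-comax (r zero) (λ i → sep zero (suc i) λ ())
    = G , W′ , σ≡G , W′≈0 , W′-comax
    where
    r₀ = r zero
    -- `u` is the inverse of `eval W r₀` modulo `f`.
    k = (σ r₀ - eval F r₀) * u
    G = F ⊕ map (k *_) W
    eval-G : ∀ x → eval G x ≈ eval F x + k * eval W x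
    eval-G x = trans (eval-⊕ F _ x) (+-congˡ (eval-scale k W x))
    W′ = (- r₀ ∷ 1# ∷ []) ⊛ W
    eval-W′ : ∀ x → eval W′ x ≈ (x - r₀) * eval W x
    eval-W′ x = trans (eval-⊛ (- r₀ ∷ 1# ∷ []) W x) (*-congʳ
      (solve 2 (λ x r → :- r :+ x :* (con ℤ.1ℤ :+ x :* con ℤ.0ℤ) := x :- r) refl x r₀))
    σ≡G : ∀ i → σ (r i) ≡ eval G (r i) [mod f ]
    σ≡G zero = mod-sym (mod-trans (mod-reflexive (eval-G r₀)) (- ((σ r₀ - eval F r₀) * v) ,
      trans (solve 6 (λ s t u v w f → :- ((s :- t) :* v) :* f := (s :- t) :* u :* w :+ (s :- t) :* (:-
            (u :* w :+ v :* f)))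
              refl (σ r₀) (eval F r₀) u v (eval W r₀) f)
      (trans (+-congˡ (*-congˡ (-‿cong e)))
      (solve 5 (λ s t u v w → (s :- t) :* u :* w :+ (s :- t) :* (:- con ℤ.1ℤ) := t :+ (s :- t) :* u :* w :- s)
              refl (σ r₀) (eval F r₀) u v (eval W r₀)))))
    σ≡G (suc i) = mod-trans (σ≡F i) (mod-reflexive
      (sym (trans (eval-G _) (trans (+-congˡ (trans (*-congˡ (W≈0 i)) (zeroʳ k))) (+-identityʳ _)))))
    W′≈0 : ∀ i → eval W′ (r i) ≈ 0#
    W′≈0 zero    = trans (eval-W′ r₀) (trans (*-congʳ (-‿inverseʳ r₀)) (zeroˡ _))
    W′≈0 (suc i) = trans (eval-W′ _) (trans (*-congˡ (W≈0 i)) (zeroʳ _))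
    W′-comax : ∀ x → (∀ i → Comaximal (x + - r i) f) → Comaximal (eval W′ x) f
    W′-comax x co = comaximal-resp (mod-reflexive (sym (eval-W′ x)))
      (comaximal-sym (comaximal-* (comaximal-sym (co zero)) (comaximal-sym (W-comax x (λ i → co (suc i))))))

  interpolate : ∀ {n} (r : Fin n → Carrier) (σ : Carrier → Carrier) →
    (∀ i j → ¬ (i ≡ j) → Comaximal (r i + - r j) f) →
    ∃ λ F → ∀ i → σ (r i) ≡ eval F (r i) [mod f ]
  interpolate r σ sep with F , _ , eq , _ ← newton r σ sep = F , eq

  -- The residues modulo p² are 0, p, 1 and 1 + p; they are interpolated by a cubic.
  chen-square : ∀ p → (∀ x → x ≡ 0# [mod p ] ⊎ x ≡ 1# [mod p ]) → Chen (p * p)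
  chen-square p residues σ σ-pres = F , σ≡F
    where
    p∣p² : p ∣ p * p
    p∣p² = p , refl
    step : ∀ x → p ∣ σ (x + p) + - σ x
    step x = σ-pres p p∣p² (x + p) x (1# , solve 2 (λ x p → con ℤ.1ℤ :* p := x :+ p :- x) refl x p)
    A = σ 0#
    B = σ 1# - σ 0#
    s = _∣ʳ_.quotient (step 0#)
    t = _∣ʳ_.quotient (step 1#)
    -- Modulo p² the term x (x - 1) (C + D x) contributes - C p at x = p and (C + D) p at x = 1 + p.
    -- So the slopes at 0 and 1 are B - C and B + C + D, which have to equal the divided differences
    -- `s` and `t`.
    C = B - s
    D = t - B - C
    F = A ∷ (B - C) ∷ (C - D) ∷ D ∷ []
    cubic : ∀ x → eval F x ≈ A + B * x + x * (x - 1#) * (C + D * x)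
    cubic x = solve 5 (λ a b c d x →
      a :+ x :* ((b :- c) :+ x :* ((c :- d) :+ x :* (d :+ x :* con ℤ.0ℤ)))
      := a :+ b :* x :+ x :* (x :- con ℤ.1ℤ) :* (c :+ d :* x)) refl A B C D x
    value : ∀ x {k} → k * p ≈ σ (x + p) + - σ x → σ (x + p) ≈ σ x + k * p
    value x {k} e = trans (solve 2 (λ y z → y := z :+ (y :- z)) refl (σ (x + p)) (σ x)) (+-congˡ (sym e))
    hit : ∀ y → σ y ≡ A + B * y + y * (y - 1#) * (C + D * y) [mod p * p ] →
      ∀ x → x ≡ y [mod p * p ] → σ x ≡ eval F x [mod p * p ]
    hit y e x x≡y = mod-trans (σ-pres (p * p) ∣-refl x y x≡y)
      (mod-trans e (mod-trans (mod-reflexive (sym (cubic y))) (eval-mod F (mod-sym x≡y))))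
    at-0 : σ 0# ≡ A + B * 0# + 0# * (0# - 1#) * (C + D * 0#) [mod p * p ]
    at-0 = mod-reflexive (solve 4 (λ a b c d →
      a := a :+ b :* con ℤ.0ℤ :+ con ℤ.0ℤ :* (con ℤ.0ℤ :- con ℤ.1ℤ) :* (c :+ d :* con ℤ.0ℤ)) refl A B C D)
    at-1 : σ 1# ≡ A + B * 1# + 1# * (1# - 1#) * (C + D * 1#) [mod p * p ]
    at-1 = mod-reflexive (solve 4 (λ a b c d →
      b := a :+ (b :- a) :* con ℤ.1ℤ :+ con ℤ.1ℤ :* (con ℤ.1ℤ :- con ℤ.1ℤ) :* (c :+ d :* con ℤ.1ℤ)) refl A (σ 1#) C D)
    at-p : σ (0# + p) ≡ A + B * (0# + p) + (0# + p) * (0# + p - 1#) * (C + D * (0# + p)) [mod p * p ]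
    at-p = mod-resp (sym (value 0# (_∣ʳ_.equality (step 0#)))) refl
      (- (B - s) + D - D * p ,
       solve 5 (λ a b s d p → (:- (b :- s) :+ d :- d :* p) :* (p :* p) :=
         a :+ s :* p :- (a :+ b :* (con ℤ.0ℤ :+ p) :+ (con ℤ.0ℤ :+ p) :* (con ℤ.0ℤ :+ p :- con ℤ.1ℤ) :*
               ((b :- s) :+ d :* (con ℤ.0ℤ :+ p))))
         refl A B s D p)
    at-1+p : σ (1# + p) ≡ A + B * (1# + p) + (1# + p) * (1# + p - 1#) * (C + D * (1# + p)) [mod p * p ]
    at-1+p = mod-resp (sym (value 1# (_∣ʳ_.equality (step 1#)))) refl
      (- (C + D) - D - D * p ,
       solve 5 (λ a o c t p → let b = o :- a; d = t :- b :- c in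
         (:- (c :+ d) :- d :- d :* p) :* (p :* p) :=
         o :+ t :* p :- (a :+ b :* (con ℤ.1ℤ :+ p) :+ (con ℤ.1ℤ :+ p) :* (con ℤ.1ℤ :+ p :- con ℤ.1ℤ) :*
               (c :+ d :* (con ℤ.1ℤ :+ p))))
         refl A (σ 1#) C t p)
    -- `residues` is used a second time, on the quotient by `p`, to find the second digit of `x`.
    lift : ∀ y x {k} → k * p ≈ x + - y → k ≡ 0# [mod p ] ⊎ k ≡ 1# [mod p ] →
      x ≡ y [mod p * p ] ⊎ x ≡ y + p [mod p * p ]
    lift y x {k} e (inj₁ (j , q)) = inj₁ (j ,
      trans (sym (*-assoc _ _ _)) (trans (*-congʳ q)
      (trans (solve 2 (λ k p → (k :- con ℤ.0ℤ) :* p := k :* p) refl k p) e)))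
    lift y x {k} e (inj₂ (j , q)) = inj₂ (j ,
      trans (sym (*-assoc _ _ _)) (trans (*-congʳ q)
      (trans (solve 2 (λ k p → (k :- con ℤ.1ℤ) :* p := k :* p :- p) refl k p)
      (trans (+-congʳ e) (solve 3 (λ x y p → x :- y :- p := x :- (y :+ p)) refl x y p)))))
    σ≡F : ∀ x → σ x ≡ eval F x [mod p * p ]
    σ≡F x =
      [ (λ (k , e) → [ hit 0# at-0 x , hit (0# + p) at-p x ]′ (lift 0# x e (residues k)))
      , (λ (k , e) → [ hit 1# at-1 x , hit (1# + p) at-1+p x ]′ (lift 1# x e (residues k)))
      ]′ (residues x)

-- The ring of polynomials over a commutative ring.

module PolynomialRing {c ℓ} (K : CommutativeRing c ℓ) where
  private module K = CommutativeRing K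
  open K using (0#; 1#; _≈_) renaming (Carrier to C)
  open Polynomial K.rawRing using (Poly; coeff; _≈ₚ_; _+ₚ_; _*ₚ_)
  open RingFacts.IntegerSolver K

  infix 8 -ₚ_
  -ₚ_ : Poly → Poly
  -ₚ_ = map (K.-_)

  infixr 7 _·ₚ_
  _·ₚ_ : C → Poly → Poly
  a ·ₚ f = map (a K.*_) f

  private variable
    a b : C
    f f′ g g′ h : Poly

  coeff-+ : ∀ f g i → coeff (f +ₚ g) i ≈ coeff f i K.+ coeff g i
  coeff-+ []      g       i       = K.sym (K.+-identityˡ _)
  coeff-+ (a ∷ f) []      i       = K.sym (K.+-identityʳ _)
  coeff-+ (a ∷ f) (b ∷ g) zero    = K.refl
  coeff-+ (a ∷ f) (b ∷ g) (suc i) = coeff-+ f g i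

  coeff-neg : ∀ f i → coeff (-ₚ f) i ≈ K.- coeff f i
  coeff-neg []      i       = solve 0 (con ℤ.0ℤ := :- con ℤ.0ℤ) K.refl
  coeff-neg (a ∷ f) zero    = K.refl
  coeff-neg (a ∷ f) (suc i) = coeff-neg f i

  coeff-· : ∀ a f i → coeff (a ·ₚ f) i ≈ a K.* coeff f i
  coeff-· a []      i       = K.sym (K.zeroʳ a)
  coeff-· a (b ∷ f) zero    = K.refl
  coeff-· a (b ∷ f) (suc i) = coeff-· a f i

  -- Agda can infer f and g from a proof of f ≋ g, but not from one of f ≈ₚ g, which unfolds.
  infix 4 _≋_
  record _≋_ (f g : Poly) : Set ℓ where
    constructor coeffwise
    field at : f ≈ₚ g
  open _≋_ public

  ≋-refl : f ≋ f
  ≋-refl = coeffwise λ i → K.refl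

  ≋-sym : f ≋ g → g ≋ f
  ≋-sym p = coeffwise λ i → K.sym (at p i)

  ≋-trans : f ≋ g → g ≋ h → f ≋ h
  ≋-trans p q = coeffwise λ i → K.trans (at p i) (at q i)

  ∷-cong : a ≈ b → f ≋ g → (a ∷ f) ≋ (b ∷ g)
  ∷-cong p q = coeffwise λ { zero → p ; (suc i) → at q i }

  0∷0 : (0# ∷ []) ≋ []
  0∷0 = coeffwise λ { zero → K.refl ; (suc i) → K.refl }

  +-cong : f ≋ f′ → g ≋ g′ → f +ₚ g ≋ f′ +ₚ g′
  +-cong {f} {f′} {g} {g′} p q = coeffwise λ i →
    K.trans (coeff-+ f g i) (K.trans (K.+-cong (at p i) (at q i)) (K.sym (coeff-+ f′ g′ i)))

  +-comm : ∀ f g → f +ₚ g ≋ g +ₚ f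
  +-comm f g = coeffwise λ i → K.trans (coeff-+ f g i) (K.trans (K.+-comm _ _) (K.sym (coeff-+ g f i)))

  +-assoc : ∀ f g h → f +ₚ g +ₚ h ≋ f +ₚ (g +ₚ h)
  +-assoc f g h = coeffwise λ i →
    K.trans (coeff-+ (f +ₚ g) h i) (K.trans (K.+-congʳ (coeff-+ f g i))
    (K.trans (K.+-assoc _ _ _)
    (K.sym (K.trans (coeff-+ f (g +ₚ h) i) (K.+-congˡ (coeff-+ g h i))))))

  +-identityʳ : ∀ f → f +ₚ [] ≋ f
  +-identityʳ f = coeffwise λ i → K.trans (coeff-+ f [] i) (K.+-identityʳ _)

  ·-cong : a ≈ b → f ≋ g → a ·ₚ f ≋ b ·ₚ g
  ·-cong {a} {b} {f} {g} p q = coeffwise λ i →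
    K.trans (coeff-· a f i) (K.trans (K.*-cong p (at q i)) (K.sym (coeff-· b g i)))

  ·-distribˡ : ∀ a f g → a ·ₚ (f +ₚ g) ≋ a ·ₚ f +ₚ a ·ₚ g
  ·-distribˡ a f g = coeffwise λ i →
    K.trans (coeff-· a (f +ₚ g) i) (K.trans (K.*-congˡ (coeff-+ f g i))
    (K.trans (K.distribˡ _ _ _)
    (K.sym (K.trans (coeff-+ (a ·ₚ f) (a ·ₚ g) i) (K.+-cong (coeff-· a f i) (coeff-· a g i))))))

  ·-distribʳ : ∀ a b f → (a K.+ b) ·ₚ f ≋ a ·ₚ f +ₚ b ·ₚ f
  ·-distribʳ a b f = coeffwise λ i →
    K.trans (coeff-· (a K.+ b) f i) (K.trans (K.distribʳ _ _ _)
    (K.sym (K.trans (coeff-+ (a ·ₚ f) (b ·ₚ f) i) (K.+-cong (coeff-· a f i) (coeff-· b f i)))))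

  ·-assoc : ∀ a b f → (a K.* b) ·ₚ f ≋ a ·ₚ b ·ₚ f
  ·-assoc a b f = coeffwise λ i →
    K.trans (coeff-· (a K.* b) f i) (K.trans (K.*-assoc _ _ _)
    (K.sym (K.trans (coeff-· a (b ·ₚ f) i) (K.*-congˡ (coeff-· b f i)))))

  ·-zero : ∀ f → 0# ·ₚ f ≋ []
  ·-zero f = coeffwise λ i → K.trans (coeff-· 0# f i) (K.zeroˡ _)

  ·-one : ∀ f → 1# ·ₚ f ≋ f
  ·-one f = coeffwise λ i → K.trans (coeff-· 1# f i) (K.*-identityˡ _)

  ·-0∷ : ∀ a f → a ·ₚ (0# ∷ f) ≋ 0# ∷ a ·ₚ f
  ·-0∷ a f = ∷-cong (K.zeroʳ a) ≋-refl

  0∷-+ : ∀ f g → 0# ∷ (f +ₚ g) ≋ (0# ∷ f) +ₚ (0# ∷ g)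
  0∷-+ f g = ∷-cong (K.sym (K.+-identityˡ 0#)) ≋-refl

  +-interchange : ∀ f g h k → (f +ₚ g) +ₚ (h +ₚ k) ≋ (f +ₚ h) +ₚ (g +ₚ k)
  +-interchange f g h k = coeffwise λ i →
    K.trans (coeff-+ (f +ₚ g) _ i) (K.trans (K.+-cong (coeff-+ f g i) (coeff-+ h k i))
    (K.trans (solve 4 (λ f g h k → (f :+ g) :+ (h :+ k) := (f :+ h) :+ (g :+ k)) K.refl _ _ _ _)
    (K.sym (K.trans (coeff-+ (f +ₚ h) _ i) (K.+-cong (coeff-+ f h i) (coeff-+ g k i))))))

  +-rotate : ∀ f g h → f +ₚ (g +ₚ h) ≋ g +ₚ (f +ₚ h)
  +-rotate f g h = ≋-trans (≋-sym (+-assoc f g h))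
    (≋-trans (+-cong (+-comm f g) (≋-refl {h})) (+-assoc g f h))

  *-zeroʳ : ∀ f → f *ₚ [] ≋ []
  *-zeroʳ []      = ≋-refl
  *-zeroʳ (a ∷ f) = ≋-trans (∷-cong K.refl (*-zeroʳ f)) 0∷0

  *-congˡ : ∀ f → g ≋ g′ → f *ₚ g ≋ f *ₚ g′
  *-congˡ []      p = ≋-refl
  *-congˡ {g} {g′} (a ∷ f) p = +-cong {a ·ₚ g} {a ·ₚ g′} (·-cong K.refl p) (∷-cong K.refl (*-congˡ f p))

  -- Multiplication recurses on its left factor; this mirror image of the defining equation is what
  -- lets commutativity be proved by induction.
  *-∷ : ∀ f b g → f *ₚ (b ∷ g) ≋ b ·ₚ f +ₚ (0# ∷ f *ₚ g)
  *-∷ []      b g = ≋-sym 0∷0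
  *-∷ (a ∷ f) b g = ∷-cong (K.+-congʳ (K.*-comm a b))
    (≋-trans (+-cong (≋-refl {a ·ₚ g}) (*-∷ f b g)) (+-rotate (a ·ₚ g) (b ·ₚ f) _))

  *-comm : ∀ f g → f *ₚ g ≋ g *ₚ f
  *-comm []      g = ≋-sym (*-zeroʳ g)
  *-comm (a ∷ f) g = ≋-trans (+-cong (≋-refl {a ·ₚ g}) (∷-cong K.refl (*-comm f g)))
    (≋-sym (*-∷ g a f))

  *-cong : f ≋ f′ → g ≋ g′ → f *ₚ g ≋ f′ *ₚ g′
  *-cong {f} {f′} {g} {g′} p q = ≋-trans (*-congˡ f q)
    (≋-trans (*-comm f g′) (≋-trans (*-congˡ g′ p) (*-comm g′ f′)))

  *-distribʳ : ∀ h f g → (f +ₚ g) *ₚ h ≋ f *ₚ h +ₚ g *ₚ h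
  *-distribʳ h []      g       = ≋-refl
  *-distribʳ h (a ∷ f) []      = ≋-sym (+-identityʳ _)
  *-distribʳ h (a ∷ f) (b ∷ g) = ≋-trans
    (+-cong (·-distribʳ a b h) (≋-trans (∷-cong K.refl (*-distribʳ h f g)) (0∷-+ (f *ₚ h) (g *ₚ h))))
    (+-interchange (a ·ₚ h) (b ·ₚ h) _ _)

  ·-*-assoc : ∀ a f g → (a ·ₚ f) *ₚ g ≋ a ·ₚ (f *ₚ g)
  ·-*-assoc a []      g = ≋-refl
  ·-*-assoc a (b ∷ f) g = ≋-trans
    (+-cong (·-assoc a b g) (≋-trans (∷-cong K.refl (·-*-assoc a f g)) (≋-sym (·-0∷ a (f *ₚ g)))))
    (≋-sym (·-distribˡ a (b ·ₚ g) _))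

  0∷-* : ∀ f g → (0# ∷ f) *ₚ g ≋ 0# ∷ f *ₚ g
  0∷-* f g = +-cong {g′ = 0# ∷ f *ₚ g} (·-zero g) ≋-refl

  *-assoc : ∀ f g h → f *ₚ g *ₚ h ≋ f *ₚ (g *ₚ h)
  *-assoc []      g h = ≋-refl
  *-assoc (a ∷ f) g h = ≋-trans (*-distribʳ h (a ·ₚ g) (0# ∷ f *ₚ g))
    (+-cong (·-*-assoc a g h) (≋-trans (0∷-* (f *ₚ g) h) (∷-cong K.refl (*-assoc f g h))))

  *-const : ∀ a f → (a ∷ []) *ₚ f ≋ a ·ₚ f
  *-const a f = ≋-trans (+-cong (≋-refl {a ·ₚ f}) 0∷0) (+-identityʳ _)

  *-identityˡ : ∀ f → (1# ∷ []) *ₚ f ≋ f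
  *-identityˡ f = ≋-trans (*-const 1# f) (·-one f)

  -‿inverseʳ : ∀ f → f +ₚ -ₚ f ≋ []
  -‿inverseʳ f = coeffwise λ i → K.trans (coeff-+ f (-ₚ f) i)
    (K.trans (K.+-congˡ (coeff-neg f i)) (K.-‿inverseʳ _))

  -‿cong : f ≋ g → -ₚ f ≋ -ₚ g
  -‿cong {f} {g} p = coeffwise λ i → K.trans (coeff-neg f i) (K.trans (K.-‿cong (at p i)) (K.sym (coeff-neg g i)))

  -- The operations are made opaque so that Agda can infer their arguments.
  opaque
    infixl 6 _⊞_
    infixl 7 _⊠_ _⊡_
    _⊞_ _⊠_ : Poly → Poly → Poly
    _⊞_ = _+ₚ_
    _⊠_ = _*ₚ_

    ⊟_ : Poly → Poly
    ⊟_ = -ₚ_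

    _⊡_ : C → Poly → Poly
    _⊡_ = _·ₚ_

    polynomial-isCommutativeRing : IsCommutativeRing _≋_ _⊞_ _⊠_ ⊟_ [] (1# ∷ [])
    polynomial-isCommutativeRing = record
      { isRing = record
        { +-isAbelianGroup = record
          { isGroup = record
            { isMonoid = record
              { isSemigroup = record
                { isMagma = record
                  { isEquivalence = record { refl = ≋-refl ; sym = ≋-sym ; trans = ≋-trans }
                  ; ∙-cong = +-cong }
                ; assoc = +-assoc }
              ; identity = (λ _ → ≋-refl) , +-identityʳ }
            ; inverse = (λ f → ≋-trans (+-comm (-ₚ f) f) (-‿inverseʳ f)) , -‿inverseʳ
            ; ⁻¹-cong = -‿cong }
          ; comm = +-comm }
        ; *-cong = *-cong
        ; *-assoc = *-assoc
        ; *-identity = *-identityˡ , λ f → ≋-trans (*-comm f (1# ∷ [])) (*-identityˡ f)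
        ; distrib = (λ f g h → ≋-trans (*-comm f (g +ₚ h)) (≋-trans (*-distribʳ f g h) (+-cong (*-comm g f)
              (*-comm h f))))
                  , *-distribʳ
        }
      ; *-comm = *-comm
      }

    coeff-⊞ : ∀ f g i → coeff (f ⊞ g) i ≈ coeff f i K.+ coeff g i
    coeff-⊞ = coeff-+

    coeff-⊟ : ∀ f i → coeff (⊟ f) i ≈ K.- coeff f i
    coeff-⊟ = coeff-neg

    coeff-⊡ : ∀ a f i → coeff (a ⊡ f) i ≈ a K.* coeff f i
    coeff-⊡ = coeff-·

    []-⊠ : ∀ g → [] ⊠ g ≋ []
    []-⊠ g = ≋-refl

    ∷-⊠ : ∀ a f g → (a ∷ f) ⊠ g ≋ a ⊡ g ⊞ (0# ∷ f ⊠ g)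
    ∷-⊠ a f g = ≋-refl

    0∷-⊠ : ∀ f g → (0# ∷ f) ⊠ g ≋ 0# ∷ f ⊠ g
    0∷-⊠ = 0∷-*

    const-⊠ : ∀ a f → (a ∷ []) ⊠ f ≋ a ⊡ f
    const-⊠ = *-const

    const-⊠-const : ∀ a b → (a ∷ []) ⊠ (b ∷ []) ≋ (a K.* b) ∷ []
    const-⊠-const a b = *-const a (b ∷ [])

    ∷-⊞ : ∀ a b f g → (a ∷ f) ⊞ (b ∷ g) ≋ (a K.+ b) ∷ f ⊞ g
    ∷-⊞ a b f g = ≋-refl

  polynomialRing : CommutativeRing c ℓ
  polynomialRing = record { isCommutativeRing = polynomial-isCommutativeRing }

-- Degrees, division with remainder and Bézout identities over a field.

module FieldPolynomials {c ℓ} (K : CommutativeRing c ℓ) (isField : IsField K)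
  (_≟_ : ∀ x y → Dec (CommutativeRing._≈_ K x y)) where

  private module K = CommutativeRing K
  open K using () renaming (Carrier to C)
  open Polynomial K.rawRing public using (Poly; coeff)
  module PR = PolynomialRing K
  open PR public using (_≋_; coeffwise; at; ∷-cong; 0∷0; _⊡_; polynomialRing)
  module 𝔸 = CommutativeRing polynomialRing
  open 𝔸 public using (_≈_; _+_; _*_; -_; _-_; 0#; 1#; refl; sym; trans; +-congˡ; +-congʳ; *-congˡ; *-congʳ; +-cong; *-cong; *-assoc; *-comm)
  open RingFacts polynomialRing public

  -- A strict degree bound that, unlike `Degree`, admits 0. It is therefore closed under addition,
  -- and `Below 1` singles out the constants.
  record Below (n : ℕ) (f : Poly) : Set ℓ where
    constructor below
    field vanish : ∀ i → n ≤ i → coeff f i K.≈ K.0#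
  open Below public

  Degree : Poly → ℕ → Set ℓ
  Degree f n = ¬ (coeff f n K.≈ K.0#) × Below (suc n) f

  private variable
    m n : ℕ
    a b d f g h : Poly

  below-resp : f ≈ g → Below n f → Below n g
  below-resp f≈g p = below λ i n≤i → K.trans (K.sym (at f≈g i)) (vanish p i n≤i)

  below-mono : m ≤ n → Below m f → Below n f
  below-mono m≤n p = below λ i n≤i → vanish p i (ℕ.≤-trans m≤n n≤i)

  below-0 : Below n 0#
  below-0 = below λ _ _ → K.refl

  below-+ : Below n f → Below n g → Below n (f + g)
  below-+ {f = f} {g} p q = below λ i n≤i →
    K.trans (PR.coeff-⊞ f g i) (K.trans (K.+-cong (vanish p i n≤i) (vanish q i n≤i)) (K.+-identityˡ _))

  below-neg : Below n f → Below n (- f)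
  below-neg {f = f} p = below λ i n≤i →
    K.trans (PR.coeff-⊟ f i) (K.trans (K.-‿cong (vanish p i n≤i))
      (K.trans (K.sym (K.+-identityˡ _)) (K.-‿inverseʳ _)))

  below-· : ∀ x → Below n f → Below n (x ⊡ f)
  below-· {f = f} x p = below λ i n≤i →
    K.trans (PR.coeff-⊡ x f i) (K.trans (K.*-congˡ (vanish p i n≤i)) (K.zeroʳ x))

  below-zero : Below 0 f → f ≈ 0#
  below-zero p = coeffwise λ i → vanish p i z≤n

  below-∷ : ∀ {x} → Below n f → Below (suc n) (x ∷ f)
  below-∷ p = below λ { (suc i) (s≤s n≤i) → vanish p i n≤i }

  below-tail : ∀ {x} → Below (suc n) (x ∷ f) → Below n f
  below-tail p = below λ i n≤i → vanish p (suc i) (s≤s n≤i)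

  below-1 : Below 1 1#
  below-1 = below-∷ below-0

  constant : Below 1 f → f ≈ coeff f 0 ∷ []
  constant {[]}    p = sym 0∷0
  constant {x ∷ f} p = ∷-cong K.refl (below-zero (below-tail p))

  below-≤ : ∀ {n} → Below n f → ¬ (coeff f m K.≈ K.0#) → m < n
  below-≤ {m = m} {n} p f≉0 = ℕ.≰⇒> λ n≤m → f≉0 (vanish p m n≤m)

  degree? : ∀ f → f ≈ 0# ⊎ ∃ (Degree f)
  degree? []      = inj₁ refl
  degree? (x ∷ f) with degree? f | x ≟ K.0#
  ... | inj₂ (n , fₙ≉0 , p) | _       = inj₂ (suc n , fₙ≉0 , below-∷ p)
  ... | inj₁ f≈0 | yes x≈0 = inj₁ (trans (∷-cong x≈0 f≈0) 0∷0)
  ... | inj₁ f≈0 | no x≉0  = inj₂ (0 , x≉0 , below-∷ (below-resp (sym f≈0) below-0))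

  degree≉0 : Degree f n → ¬ f ≈ 0#
  degree≉0 {n = n} (fₙ≉0 , _) f≈0 = fₙ≉0 (at f≈0 n)

  degree-resp : f ≈ g → Degree f n → Degree g n
  degree-resp {n = n} f≈g (fₙ≉0 , p) = (λ gₙ≈0 → fₙ≉0 (K.trans (at f≈g n) gₙ≈0)) , below-resp f≈g p

  degree-unique : Degree f m → Degree f n → m ≡ n
  degree-unique (p , p′) (r , r′) =
    ℕ.≤-antisym (ℕ.≤-pred (below-≤ r′ p)) (ℕ.≤-pred (below-≤ p′ r))

  zero? : ∀ f → Dec (f ≈ 0#)
  zero? f = [ yes , (λ (_ , deg) → no (degree≉0 deg)) ]′ (degree? f)

  infix 4 _≈?_ _∣?_

  _≈?_ : ∀ f g → Dec (f ≈ g)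
  f ≈? g = Dec.map′ x-y≈0⇒x≈y (λ f≈g → trans (+-congʳ f≈g) (𝔸.-‿inverseʳ g)) (zero? (f - g))
    where
    x-y≈0⇒x≈y : f - g ≈ 0# → f ≈ g
    x-y≈0⇒x≈y e = trans (solve 2 (λ f g → f := (f :- g) :+ g) refl f g) (trans (+-congʳ e) (𝔸.+-identityˡ g))

  below? : ∀ n f → Dec (Below n f)
  below? n f = [ (λ f≈0 → yes (below-resp (sym f≈0) below-0)) , by-degree ]′ (degree? f)
    where
    by-degree : ∃ (Degree f) → Dec (Below n f)
    by-degree (m , fₘ≉0 , p) = Dec.map′ (λ m<n → below-mono m<n p) (λ q → below-≤ q fₘ≉0) (m ℕ.<? n)

  -- Degree bounds replace degrees here: the two top coefficients may vanish, so the induction runs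
  -- over any list, trailing zeros included.
  leading : ∀ m n f g → Below (suc m) f → Below (suc n) g →
    coeff (f * g) (m ℕ.+ n) K.≈ coeff f m K.* coeff g n × Below (suc (m ℕ.+ n)) (f * g)
  leading m n [] g p q = K.trans (at (PR.[]-⊠ g) (m ℕ.+ n)) (K.sym (K.zeroˡ _)) , below-resp (sym (PR.[]-⊠ g)) below-0
  leading zero n (x ∷ f) g p q =
    K.trans (at xf*g≈x·g n) (PR.coeff-⊡ x g n) , below-resp (sym xf*g≈x·g) (below-· x q)
    where
    xf*g≈x·g : (x ∷ f) * g ≈ x ⊡ g
    xf*g≈x·g = trans (*-congʳ {g} (constant {x ∷ f} p)) (PR.const-⊠ x g)
  leading (suc m) n (x ∷ f) g p q
    with fₘgₙ , r ← leading m n f g (below-tail p) q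
    = K.trans (at (PR.∷-⊠ x f g) (suc (m ℕ.+ n))) (K.trans (PR.coeff-⊞ (x ⊡ g) (K.0# ∷ f * g) (suc (m ℕ.+ n)))
        (K.trans (K.+-cong (vanish (below-· x q) _ (s≤s (ℕ.m≤n+m n m))) fₘgₙ) (K.+-identityˡ _)))
    , below-resp (sym (PR.∷-⊠ x f g)) (below-+ (below-mono (s≤s (ℕ.≤-trans (ℕ.m≤n+m n m) (ℕ.n≤1+n _)))
          (below-· x q)) (below-∷ r))

  K-integral : ∀ {x y} → ¬ (x K.≈ K.0#) → x K.* y K.≈ K.0# → y K.≈ K.0#
  K-integral {x} {y} x≉0 xy≈0 with x⁻¹ , x⁻¹x≈1 , _ ← proj₂ isField x x≉0 =
    K.trans (K.sym (K.trans (K.*-congʳ x⁻¹x≈1) (K.*-identityˡ y)))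
    (K.trans (K.*-assoc x⁻¹ x y) (K.trans (K.*-congˡ xy≈0) (K.zeroʳ x⁻¹)))

  degree-* : Degree f m → Degree g n → Degree (f * g) (m ℕ.+ n)
  degree-* {f} {m} {g} {n} (fₘ≉0 , p) (gₙ≉0 , q) with e , r ← leading m n f g p q =
    (λ z → gₙ≉0 (K-integral fₘ≉0 (K.trans (K.sym e) z))) , r

  integral : f * g ≈ 0# → f ≈ 0# ⊎ g ≈ 0#
  integral {f} {g} fg≈0 with degree? f | degree? g
  ... | inj₁ f≈0     | _            = inj₁ f≈0
  ... | _            | inj₁ g≈0     = inj₂ g≈0
  ... | inj₂ (_ , p) | inj₂ (_ , q) = ⊥-elim (degree≉0 (degree-* p q) fg≈0)

  *-≉0 : ¬ f ≈ 0# → ¬ g ≈ 0# → ¬ f * g ≈ 0#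
  *-≉0 f≉0 g≉0 fg≈0 = [ f≉0 , g≉0 ]′ (integral fg≈0)

  *-cancelʳ : ¬ h ≈ 0# → f * h ≈ g * h → f ≈ g
  *-cancelʳ {h} {f} {g} h≉0 e =
    [ (λ f-g≈0 → trans (solve 2 (λ f g → f := (f :- g) :+ g) refl f g) (trans (+-congʳ f-g≈0) (𝔸.+-identityˡ g)))
    , (λ h≈0 → ⊥-elim (h≉0 h≈0)) ]′
    (integral (trans (solve 3 (λ f g h → (f :- g) :* h := f :* h :- g :* h) refl f g h)
      (trans (+-congʳ e) (𝔸.-‿inverseʳ _))))

  ∣-cancelʳ : ¬ h ≈ 0# → f * h ∣ g * h → f ∣ g
  ∣-cancelʳ h≉0 (k , e) = k , *-cancelʳ h≉0 (trans (*-assoc _ _ _) e)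

  ≉0-resp : f ≈ g → ¬ f ≈ 0# → ¬ g ≈ 0#
  ≉0-resp f≈g f≉0 g≈0 = f≉0 (trans f≈g g≈0)

  ∣-≉0 : f ∣ g → ¬ g ≈ 0# → ¬ f ≈ 0#
  ∣-≉0 (k , e) g≉0 f≈0 = g≉0 (trans (sym e) (trans (*-congˡ f≈0) (𝔸.zeroʳ k)))

  1≉0 : ¬ 1# ≈ 0#
  1≉0 e = proj₁ isField (at e 0)

  degree-factors : a * b ≈ g → ¬ g ≈ 0# →
    ∃₂ λ m n → Degree a m × Degree b n × Degree g (m ℕ.+ n)
  degree-factors {a} {b} e g≉0 with degree? a | degree? b
  ... | inj₁ a≈0 | _ = ⊥-elim (g≉0 (trans (sym e) (trans (*-congʳ a≈0) (𝔸.zeroˡ b))))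
  ... | _ | inj₁ b≈0 = ⊥-elim (g≉0 (trans (sym e) (trans (*-congˡ b≈0) (𝔸.zeroʳ a))))
  ... | inj₂ (m , p) | inj₂ (n , q) = m , n , p , q , degree-resp e (degree-* p q)

  ∣-below : f ∣ g → ¬ g ≈ 0# → Below n g → Below n f
  ∣-below (k , e) g≉0 p with m , n , _ , (_ , r) , (gₘₙ≉0 , _) ← degree-factors e g≉0 =
    below-mono (ℕ.≤-trans (s≤s (ℕ.m≤n+m n m)) (below-≤ p gₘₙ≉0)) r

  -- Degrees add, and a nonconstant `b` uses up at least one. This is the descent behind the
  -- factorisation arguments below.
  cofactor-below : a * b ≈ g → ¬ g ≈ 0# → ¬ Below 1 b → Below (suc n) g → Below n a
  cofactor-below e g≉0 b∉1 p with m , k , (_ , r) , (_ , s) , (gₘₖ≉0 , _) ← degree-factors e g≉0 =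
    below-mono (ℕ.≤-trans (ℕ.≤-reflexive (ℕ.+-comm 1 m))
      (ℕ.≤-trans (ℕ.+-monoʳ-≤ m (ℕ.≰⇒> λ k≤0 → b∉1 (below-mono (s≤s k≤0) s)))
      (ℕ.≤-pred (below-≤ p gₘₖ≉0)))) r

  unit : Below 1 f → ¬ f ≈ 0# → f ∣ 1#
  unit {f} p f≉0 with x⁻¹ , x⁻¹x≈1 , _ ← proj₂ isField (coeff f 0) (λ f₀≈0 → f≉0 (trans (constant p) (trans
        (∷-cong f₀≈0 refl) 0∷0)))
    = x⁻¹ ∷ [] , trans (*-congˡ (constant p)) (trans (PR.const-⊠-const x⁻¹ _) (∷-cong x⁻¹x≈1 refl))

  -- Long division in Horner form: dividing the tail first leaves `x ∷ r` of degree at most `n`, and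
  -- one scalar multiple of `g` clears its coefficient at `n`.
  divMod : Degree g n → ∀ f → ∃₂ λ k r → f ≈ k * g + r × Below n r
  divMod {g} deg []  = 0# , 0# , solve 1 (λ g → con ℤ.0ℤ := con ℤ.0ℤ :* g :+ con ℤ.0ℤ) refl g , below-0
  divMod {g} {n} deg@(gₙ≉0 , p) (x ∷ f)
    with k , r , e , q ← divMod deg f
    with x⁻¹ , x⁻¹x≈1 , _ ← proj₂ isField (coeff g n) gₙ≉0
    = (K.0# ∷ k) + (y ∷ []) , (x ∷ r) - y ⊡ g , eq , below r′
    where
    y = coeff (x ∷ r) n K.* x⁻¹
    split : (x ∷ f) ≈ (K.0# ∷ k) * g + (x ∷ r)
    split = trans (∷-cong (K.sym (K.+-identityˡ x)) e) (trans (sym (PR.∷-⊞ K.0# x (k * g) r)) (+-congʳ (sym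
          (PR.0∷-⊠ k g))))
    eq : (x ∷ f) ≈ ((K.0# ∷ k) + (y ∷ [])) * g + ((x ∷ r) - y ⊡ g)
    eq = trans split (sym (trans (+-congˡ {((K.0# ∷ k) + (y ∷ [])) * g} (+-congˡ {x ∷ r} (𝔸.-‿cong (sym
          (PR.const-⊠ y g)))))
      (solve 4 (λ k y g r → (k :+ y) :* g :+ (r :- y :* g) := k :* g :+ r) refl (K.0# ∷ k) (y ∷ []) g (x ∷ r))))
    r′ : ∀ i → n ≤ i → coeff ((x ∷ r) - y ⊡ g) i K.≈ K.0#
    r′ i n≤i with ℕ.m≤n⇒m<n∨m≡n n≤i
    ... | inj₁ n<i = vanish (below-+ (below-∷ q) (below-neg (below-· y p))) i n<i
    ... | inj₂ ≡.refl =
      K.trans (PR.coeff-⊞ (x ∷ r) _ n) (K.trans (K.+-congˡ (K.trans (PR.coeff-⊟ _ n) (K.-‿cong (K.trans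
            (PR.coeff-⊡ y g n)
        (K.trans (K.*-assoc _ _ _) (K.trans (K.*-congˡ x⁻¹x≈1) (K.*-identityʳ _))))))) (K.-‿inverseʳ _))

  reduce : Degree g n → ∀ f → ∃ λ r → f ≡ r [mod g ] × Below n r
  reduce {g} deg f with k , r , e , p ← divMod deg f =
    r , (k , sym (trans (+-congʳ e) (solve 2 (λ k r → k :+ r :- r := k) refl (k * g) r))) , p

  _∣?_ : ∀ f g → Dec (f ∣ g)
  f ∣? g = [ by-zero , by-degree ]′ (degree? f)
    where
    by-zero : f ≈ 0# → Dec (f ∣ g)
    by-zero f≈0 = Dec.map′ (λ g≈0 → ∣-resp refl (sym g≈0) ∣0)
      (λ (k , e) → trans (sym e) (trans (*-congˡ f≈0) (𝔸.zeroʳ k))) (zero? g)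
    by-degree : ∃ (Degree f) → Dec (f ∣ g)
    by-degree (n , deg) with r , g≡r , p ← reduce deg g =
      Dec.map′ (λ r≈0 → mod-∣-resp ∣-refl (mod-sym g≡r) (∣-resp refl (sym r≈0) ∣0)) r≈0 (zero? r)
      where
      r≈0 : f ∣ g → r ≈ 0#
      r≈0 f∣g with zero? r
      ... | yes e = e
      ... | no r≉0 = ⊥-elim (ℕ.<-irrefl ≡.refl
              (below-≤ (∣-below (mod-∣-resp ∣-refl g≡r f∣g) r≉0 p) (proj₁ deg)))

  GCD : Poly → Poly → Set (c ⊔ ℓ)
  GCD a b = ∃ λ d → d ∣ a × d ∣ b × ∃₂ λ u v → u * a + v * b ≈ d

  bezout-below : ∀ n a b → Below n b → GCD a b
  bezout-below n a b p with degree? b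
  ... | inj₁ b≈0 = a , ∣-refl , ∣-resp refl (sym b≈0) ∣0 , 1# , 0# ,
        solve 2 (λ a b → con ℤ.1ℤ :* a :+ con ℤ.0ℤ :* b := a) refl a b
  bezout-below zero a b p | inj₂ (_ , deg) = ⊥-elim (degree≉0 deg (below-zero p))
  bezout-below (suc n) a b p | inj₂ (m , deg)
    with k , r , e , q ← divMod deg a
    with d , d∣b , d∣r , u , v , uv ← bezout-below n b r (below-mono (ℕ.≤-pred (below-≤ p (proj₁ deg))) q)
    = d , ∣-resp refl (sym e) (∣+ (∣*ˡ k d∣b) d∣r) , d∣b , v , u - v * k ,
      trans (+-congʳ {(u - v * k) * b} (*-congˡ {v} e))
      (trans (solve 5 (λ u v k b r → v :* (k :* b :+ r) :+ (u :- v :* k) :* b := u :* b :+ v :* r) refl u v k b r) uv)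

  bezout : ∀ a b → GCD a b
  bezout a b with degree? b
  ... | inj₁ b≈0         = bezout-below 0 a b (below-resp (sym b≈0) below-0)
  ... | inj₂ (n , _ , p) = bezout-below (suc n) a b p

-- Cardinalities of predicates on setoids.

module Cardinality where

  private variable
    a b ℓ ℓ′ p r : Level
    m n : ℕ

  Card : (S : Setoid a ℓ) → Pred (Setoid.Carrier S) p → ℕ → Set _
  Card S P n = HasCardinality (Subsetoid S P) n

  -- The inverse map is read off from `preimage`; injectivity of `φ` makes it independent of the
  -- proof of `Y` from which the preimage was computed.
  card-image : {S : Setoid a ℓ} {T : Setoid b ℓ′} → HasCardinality S n →
    (φ : Setoid.Carrier S → Setoid.Carrier T) →
    Congruent (Setoid._≈_ S) (Setoid._≈_ T) φ → Injective (Setoid._≈_ S) (Setoid._≈_ T) φ →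
    {Y : Pred (Setoid.Carrier T) p} →
    (∀ x → Y (φ x)) → (∀ y → Y y → ∃ λ x → Setoid._≈_ T y (φ x)) → Card T Y n
  card-image {S = S} {T} S≅n φ φ-cong φ-inj Y-φ preimage = record
    { to        = λ (y , Yy) → to (proj₁ (preimage y Yy))
    ; from      = λ i → φ (from i) , Y-φ (from i)
    ; to-cong   = λ {(y , Yy)} {(y′ , Yy′)} y≈y′ → to-cong (φ-inj
        (T.trans (T.sym (proj₂ (preimage y Yy))) (T.trans y≈y′ (proj₂ (preimage y′ Yy′)))))
    ; from-cong = λ i≡j → φ-cong (from-cong i≡j)
    ; inverse   =
        (λ {i} {(y , Yy)} y≈φi → inverseˡ (φ-inj (T.trans (T.sym (proj₂ (preimage y Yy))) y≈φi)))
      , (λ {(y , Yy)} {i} i≡ → T.trans (φ-cong (inverseʳ i≡)) (T.sym (proj₂ (preimage y Yy))))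
    }
    where
    module T = Setoid T
    open Inverse S≅n

  card-unique : {S : Setoid a ℓ} → HasCardinality S m → HasCardinality S n → m ≡ n
  card-unique S≅m S≅n = Permutation.↔⇒≡ (Compose.inverse (Symmetry.inverse S≅m) S≅n)

  module _ {S : Setoid a ℓ} where
    open Setoid S

    card-⇔ : {P : Pred Carrier p} {Q : Pred Carrier r} →
      (∀ {x} → P x → Q x) → (∀ {x} → Q x → P x) → Card S P n → Card S Q n
    card-⇔ P⊆Q Q⊆P P≅n =
      card-image P≅n proj₁ id id (λ (_ , Px) → P⊆Q Px) (λ y Qy → (y , Q⊆P Qy) , refl)

    card-∅ : {P : Pred Carrier p} → (∀ {x} → ¬ P x) → Card S P 0
    card-∅ P∅ = record
      { to        = λ (_ , Px) → ⊥-elim (P∅ Px)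
      ; from      = λ ()
      ; to-cong   = λ {(_ , Px)} _ → ⊥-elim (P∅ Px)
      ; from-cong = λ { {()} }
      ; inverse   = (λ { {()} }) , (λ {(_ , Px)} → ⊥-elim (P∅ Px))
      }

    card-singleton : {P : Pred Carrier p} (x₀ : Carrier) → P x₀ → (∀ {x} → P x → x ≈ x₀) → Card S P 1
    card-singleton x₀ Px₀ P≈x₀ = record
      { to        = λ _ → zero
      ; from      = λ _ → x₀ , Px₀
      ; to-cong   = λ _ → ≡.refl
      ; from-cong = λ _ → refl
      ; inverse   = (λ { {zero} _ → ≡.refl }) , (λ {(_ , Px)} _ → sym (P≈x₀ Px))
      }

    card-∪ : {P : Pred Carrier p} {Q : Pred Carrier r} →
      (∀ {x y} → P x → Q y → ¬ x ≈ y) → Card S P m → Card S Q n → Card S (P ∪ Q) (m ℕ.+ n)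
    card-∪ {P = P} {Q} disjoint P≅m Q≅n = card-image
      (Compose.inverse (P≅m ⊎-inverse Q≅n) (Compose.inverse (⊎.Pointwise-≡↔≡ _ _) (Symmetry.inverse Fin.+↔⊎)))
      [ proj₁ , proj₁ ]′
      (λ { (⊎.inj₁ e) → e ; (⊎.inj₂ e) → e })
      (λ { {inj₁ _} {inj₁ _} e → ⊎.inj₁ e
         ; {inj₂ _} {inj₂ _} e → ⊎.inj₂ e
         ; {inj₁ (_ , Px)} {inj₂ (_ , Qy)} e → ⊥-elim (disjoint Px Qy e)
         ; {inj₂ (_ , Qy)} {inj₁ (_ , Px)} e → ⊥-elim (disjoint Px Qy (sym e)) })
      (λ { (inj₁ (_ , Px)) → inj₁ Px ; (inj₂ (_ , Qx)) → inj₂ Qx })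
      (λ { y (inj₁ Py) → inj₁ (y , Py) , refl ; y (inj₂ Qy) → inj₂ (y , Qy) , refl })

  card-× : {S : Setoid a ℓ} {T : Setoid b ℓ′} →
    HasCardinality S m → HasCardinality T n → HasCardinality (×.×-setoid S T) (m ℕ.* n)
  card-× S≅m T≅n =
    Compose.inverse (S≅m ×-inverse T≅n) (Compose.inverse ×.Pointwise-≡↔≡ (Symmetry.inverse Fin.*↔×))

  private
    card-suc : {R : Pred (Fin (suc n)) p} → Card (≡.setoid (Fin n)) (R ∘ suc) m →
      Card (≡.setoid (Fin (suc n))) (λ j → ∃ λ i → j ≡ suc i × R j) m
    card-suc R≅m = card-image R≅m (suc ∘ proj₁) (≡.cong suc) Fin.suc-injective
      (λ (i , Ri) → i , ≡.refl , Ri) (λ { j (i , ≡.refl , Ri) → (i , Ri) , ≡.refl })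

    -- A cardinality is a bijection with some `Fin`, so the sizes of a decidable part and of its
    -- complement have to be constructed. The induction puts 0 into the part where it belongs.
    card-split-Fin : ∀ n {Q : Pred (Fin n) p} → (∀ i → Dec (Q i)) →
      ∃₂ λ k l → k ℕ.+ l ≡ n × Card (≡.setoid (Fin n)) Q k × Card (≡.setoid (Fin n)) (¬_ ∘ Q) l
    card-split-Fin zero    Q? = 0 , 0 , ≡.refl , card-∅ (λ { {()} }) , card-∅ (λ { {()} })
    card-split-Fin (suc n) {Q} Q? with card-split-Fin n (Q? ∘ suc) | Q? zero
    ... | k , l , k+l≡n , Q≅k , ¬Q≅l | yes Q0 =
      suc k , l , ≡.cong suc k+l≡n ,
      card-⇔ (λ { (inj₁ ≡.refl) → Q0 ; (inj₂ (_ , _ , Qj)) → Qj })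
        (λ { {zero} _ → inj₁ ≡.refl ; {suc i} Qi → inj₂ (i , ≡.refl , Qi) })
        (card-∪ (λ { ≡.refl (_ , ≡.refl , _) () }) (card-singleton zero ≡.refl id) (card-suc Q≅k)) ,
      card-⇔ (λ (_ , _ , ¬Qj) → ¬Qj) (λ { {zero} ¬Q0 → ⊥-elim (¬Q0 Q0) ; {suc i} ¬Qi → i , ≡.refl , ¬Qi })
        (card-suc ¬Q≅l)
    ... | k , l , k+l≡n , Q≅k , ¬Q≅l | no ¬Q0 =
      k , suc l , ≡.trans (ℕ.+-suc k l) (≡.cong suc k+l≡n) ,
      card-⇔ (λ (_ , _ , Qj) → Qj) (λ { {zero} Q0 → ⊥-elim (¬Q0 Q0) ; {suc i} Qi → i , ≡.refl , Qi })
        (card-suc Q≅k) ,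
      card-⇔ (λ { (inj₁ ≡.refl) → ¬Q0 ; (inj₂ (_ , _ , ¬Qj)) → ¬Qj })
        (λ { {zero} _ → inj₁ ≡.refl ; {suc i} ¬Qi → inj₂ (i , ≡.refl , ¬Qi) })
        (card-∪ (λ { ≡.refl (_ , ≡.refl , _) () }) (card-singleton zero ≡.refl id) (card-suc ¬Q≅l))

  module _ {S : Setoid a ℓ} where
    open Setoid S

    module _ {P : Pred Carrier p} {Q : Pred Carrier r}
      (Q? : ∀ x → Dec (Q x)) (Q-resp : ∀ {x y} → x ≈ y → Q x → Q y) where

      opaque
        card-split : Card S P n → ∃₂ λ k l → k ℕ.+ l ≡ n × Card S (P ∩ Q) k × Card S (P ∩ (¬_ ∘ Q)) l
        card-split {n} P≅n =
          let k , l , k+l≡n , Q≅k , ¬Q≅l = card-split-Fin n {Q ∘ proj₁ ∘ from} (Q? ∘ proj₁ ∘ from)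
          in k , l , k+l≡n , restrict Q-resp Q≅k , restrict (λ x≈y ¬Qx Qy → ¬Qx (Q-resp (sym x≈y) Qy)) ¬Q≅l
          where
          open Inverse P≅n
          restrict : ∀ {R : Pred Carrier r} {m} → (∀ {x y} → x ≈ y → R x → R y) →
            Card (≡.setoid (Fin n)) (R ∘ proj₁ ∘ from) m → Card S (P ∩ R) m
          restrict R-resp R≅m = card-image R≅m (proj₁ ∘ from ∘ proj₁)
            (λ i≡j → from-cong i≡j)
            (λ {(i , _)} {(j , _)} e →
              ≡.trans (≡.sym (strictlyInverseˡ i)) (≡.trans (to-cong e) (strictlyInverseˡ j)))
            (λ (i , Ri) → proj₂ (from i) , Ri)
            (λ y (Py , Ry) → (to (y , Py) , R-resp (sym (strictlyInverseʳ (y , Py))) Ry) , sym (strictlyInverseʳ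
                  (y , Py)))

      -- The source of the decision procedures for square factors and for reducibility.
      card-search : Card S P n → Dec (∃ λ x → P x × Q x)
      card-search P≅n = Dec.map′
        (λ (i , Qi) → proj₁ (from i) , proj₂ (from i) , Qi)
        (λ (x , Px , Qx) → to (x , Px) , Q-resp (sym (strictlyInverseʳ (x , Px))) Qx)
        (Fin.any? (Q? ∘ proj₁ ∘ from))
        where open Inverse P≅n

open Cardinality

-- Irreducible and squarefree polynomials, and which moduli are Chen.

module FiniteFieldPolynomials {c ℓ} (K : CommutativeRing c ℓ) (isField : IsField K)
  (q : ℕ) (K≅q : HasCardinality (CommutativeRing.setoid K) q) where

  private
    module K = CommutativeRing K
    module K≅q = Inverse K≅q

  _≟_ : ∀ x y → Dec (x K.≈ y)
  x ≟ y = Dec.map′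
    (λ e → K.trans (K.sym (K≅q.strictlyInverseʳ x)) (K.trans (K≅q.from-cong e) (K≅q.strictlyInverseʳ y)))
    K≅q.to-cong (K≅q.to x Fin.≟ K≅q.to y)

  open FieldPolynomials K isField _≟_ public

  private variable
    m n : ℕ
    a b d e f g h P : Poly

  card-below : ∀ n → Card 𝔸.setoid (Below n) (q ℕ.^ n)
  card-below zero = card-singleton [] below-0 below-zero
  card-below (suc n) = card-image (card-× K≅q (card-below n))
    (λ (x , f , _) → x ∷ f)
    (λ (x≈y , f≈g) → ∷-cong x≈y f≈g)
    (λ e → at e 0 , coeffwise (at e ∘ suc))
    (λ (_ , _ , p) → below-∷ p)
    λ { []      p → (K.0# , [] , below-0) , sym 0∷0
      ; (x ∷ f) p → (x , f , below-tail p) , refl }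

  search : ∀ {r} n {Q : Pred Poly r} → (∀ f → Dec (Q f)) → (∀ {f g} → f ≈ g → Q f → Q g) →
    Dec (∃ λ f → Below n f × Q f)
  search n Q? Q-resp = card-search Q? Q-resp (card-below n)

  below-suc-degree : ∀ g → ∃ λ n → Below (suc n) g
  below-suc-degree g = [ (λ g≈0 → 0 , below-resp (sym g≈0) below-0) , (λ (n , _ , p) → n , p) ]′ (degree? g)

  ¬below-resp : f ≈ g → ¬ Below n f → ¬ Below n g
  ¬below-resp f≈g ¬p p = ¬p (below-resp (sym f≈g) p)

  ¬below⇒≉0 : ¬ Below n f → ¬ f ≈ 0#
  ¬below⇒≉0 ¬p f≈0 = ¬p (below-resp (sym f≈0) below-0)

  SquareFree : Poly → Set (c ⊔ ℓ)
  SquareFree g = ¬ g ≈ 0# × (∀ h → h * h ∣ g → Below 1 h)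

  squareFree-∣ : f ∣ g → SquareFree g → SquareFree f
  squareFree-∣ f∣g (g≉0 , sq) = ∣-≉0 f∣g g≉0 , λ h h²∣f → sq h (∣-trans h²∣f f∣g)

  squareFree-resp : f ≈ g → SquareFree f → SquareFree g
  squareFree-resp f≈g = squareFree-∣ (∣-resp refl (sym f≈g) ∣-refl)

  square-below : ¬ g ≈ 0# → Below n g → h * h ∣ g → Below n h
  square-below {h = h} g≉0 p h²∣g = ∣-below (∣-trans (h , refl) h²∣g) g≉0 p

  -- The degree of a square factor's root is bounded by that of `g`, which leaves finitely many
  -- candidates. The negative answer keeps its witness, since the obstructions are built from it.
  squareFree? : ∀ g → ¬ g ≈ 0# → SquareFree g ⊎ ∃ λ h → ¬ Below 1 h × h * h ∣ g
  squareFree? g g≉0 with n , p ← below-suc-degree g =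
    decide (search (suc n) (λ h → ¬? (below? 1 h) ×-dec (h * h ∣? g))
      (λ f≈h (f∉1 , f²∣g) → ¬below-resp f≈h f∉1 , ∣-resp (*-cong f≈h f≈h) refl f²∣g))
    where
    decide : Dec (∃ λ h → Below (suc n) h × ¬ Below 1 h × h * h ∣ g) → _
    decide (yes (h , _ , r)) = inj₂ (h , r)
    decide (no none) = inj₁ (g≉0 , λ h h²∣g → Dec.decidable-stable (below? 1 h)
      λ h∉1 → none (h , square-below g≉0 p h²∣g , h∉1 , h²∣g))

  Irreducible : Poly → Set (c ⊔ ℓ)
  Irreducible P = ¬ Below 1 P × (∀ d e → d * e ≈ P → Below 1 d ⊎ Below 1 e)

  Factored : Poly → Set (c ⊔ ℓ)
  Factored g = ∃₂ λ d e → ¬ Below 1 d × ¬ Below 1 e × d * e ≈ g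

  irreducible? : ∀ g → ¬ Below 1 g → Irreducible g ⊎ Factored g
  irreducible? g g∉1 with n , p ← below-suc-degree g =
    decide (search (suc n) {λ d → ¬ Below 1 d × ∃ λ e → Below (suc n) e × ¬ Below 1 e × d * e ≈ g}
      (λ d → ¬? (below? 1 d) ×-dec search (suc n) (λ e → ¬? (below? 1 e) ×-dec ((d * e) ≈? g))
        (λ e≈e′ (e∉1 , de≈g) → ¬below-resp e≈e′ e∉1 , trans (*-congˡ (sym e≈e′)) de≈g))
      (λ d≈d′ (d∉1 , e , r , e∉1 , de≈g) → ¬below-resp d≈d′ d∉1 , e , r , e∉1 , trans (*-congʳ (sym d≈d′)) de≈g))
    where
    g≉0 = ¬below⇒≉0 g∉1
    decide : Dec _ → _
    decide (yes (d , _ , d∉1 , e , _ , e∉1 , de≈g)) = inj₂ (d , e , d∉1 , e∉1 , de≈g)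
    decide (no none) = inj₁ (g∉1 , split)
      where
      split : ∀ d e → d * e ≈ g → Below 1 d ⊎ Below 1 e
      split d e de≈g with below? 1 d | below? 1 e
      ... | yes r  | _      = inj₁ r
      ... | _      | yes r  = inj₂ r
      ... | no d∉1 | no e∉1 = ⊥-elim (none
        ( d , ∣-below (e , trans (*-comm e d) de≈g) g≉0 p , d∉1
        , e , ∣-below (d , de≈g) g≉0 p , e∉1 , de≈g))

  gcd-unit : ((d , _) : GCD a b) → d ∣ 1# → Comaximal a b
  gcd-unit {a} {b} (d , _ , _ , u , v , uv) (k , kd≈1) = k * u , k * v ,
    trans (solve 5 (λ k u v a b → k :* u :* a :+ k :* v :* b := k :* (u :* a :+ v :* b)) refl k u v a b)
      (trans (*-congˡ uv) kd≈1)

  irreducible-comaximal : Irreducible P → ¬ P ∣ f → Comaximal P f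
  irreducible-comaximal {P} {f} (P∉1 , irr) P∤f
    with gcd@(d , (e , ed≈P) , d∣f , _) ← bezout P f =
    [ (λ e∈1 → ⊥-elim (P∤f (∣-trans (P∣d (unit e∈1 (∣-≉0 (d , trans (*-comm d e) ed≈P) P≉0))) d∣f)))
    , (λ d∈1 → gcd-unit gcd (unit d∈1 (∣-≉0 (e , ed≈P) P≉0))) ]′ (irr e d ed≈P)
    where
    P≉0 = ¬below⇒≉0 P∉1
    P∣d : e ∣ 1# → P ∣ d
    P∣d (k , ke≈1) = k , trans (*-congˡ (sym ed≈P)) (trans (sym (*-assoc k e d))
      (trans (*-congʳ ke≈1) (𝔸.*-identityˡ d)))

  ∤-below : ¬ Below n P → Below n f → ¬ f ≈ 0# → ¬ P ∣ f
  ∤-below P∉n f∈n f≉0 P∣f = P∉n (∣-below P∣f f≉0 f∈n)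

  irreducible-∤1 : Irreducible P → ¬ P ∣ 1#
  irreducible-∤1 (P∉1 , _) = ∤-below P∉1 below-1 1≉0

  irreducible-factor : ∀ g → ¬ Below 1 g → ∃ λ P → Irreducible P × P ∣ g
  irreducible-factor g g∉1 with n , p ← below-suc-degree g = go n g g∉1 p
    where
    go : ∀ n g → ¬ Below 1 g → Below (suc n) g → ∃ λ P → Irreducible P × P ∣ g
    go zero    g g∉1 p = ⊥-elim (g∉1 p)
    go (suc n) g g∉1 p = [ (λ irr → g , irr , ∣-refl) , descend ]′ (irreducible? g g∉1)
      where
      descend : Factored g → ∃ λ P → Irreducible P × P ∣ g
      descend (d , e , d∉1 , e∉1 , de≈g)
        with P , irr , P∣d ← go n d d∉1 (cofactor-below de≈g (¬below⇒≉0 g∉1) e∉1 p)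
        = P , irr , ∣-trans P∣d (e , trans (*-comm e d) de≈g)

  -- The polynomials of degree below that of `P` represent all residues. The difference of two
  -- distinct ones is nonzero and too small to be divisible by `P`, hence a unit modulo `P`, so
  -- interpolation through all of them applies.
  chen-irreducible : Irreducible P → Chen P
  chen-irreducible {P} irr@(P∉1 , _) σ σ-pres =
    [ (λ P≈0 → ⊥-elim (¬below⇒≉0 P∉1 P≈0)) , interpolated ]′ (degree? P)
    where
    interpolated : ∃ (Degree P) → PolynomialModulo P σ
    interpolated (n , deg) = extend (interpolate (proj₁ ∘ from) σ separated)
      where
      open Inverse (card-below n)
      separated : ∀ i j → i ≢ j → Comaximal (proj₁ (from i) + - proj₁ (from j)) P
      separated i j i≢j = comaximal-sym (irreducible-comaximal irr
        (∤-below (λ P∈n → ℕ.<-irrefl ≡.refl (below-≤ P∈n (proj₁ deg)))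
          (below-+ (proj₂ (from i)) (below-neg (proj₂ (from j))))
          λ fᵢ-fⱼ≈0 → i≢j (≡.trans (≡.sym (strictlyInverseˡ i)) (≡.trans
            (to-cong (trans (solve 2 (λ f g → f := (f :- g) :+ g) refl _ _) (trans (+-congʳ fᵢ-fⱼ≈0)
                  (𝔸.+-identityˡ _))))
            (strictlyInverseˡ j)))))
      extend : (∃ λ F → ∀ i → σ (proj₁ (from i)) ≡ Polynomial.eval 𝔸.rawRing F (proj₁ (from i)) [mod P ]) →
        PolynomialModulo P σ
      extend (F , σ≡F) = F , λ x →
        let r , x≡r , r∈n = reduce deg x
            x≡r′ = mod-trans x≡r (mod-reflexive (sym (strictlyInverseʳ (r , r∈n))))
        in mod-trans (σ-pres P ∣-refl x _ x≡r′)
             (mod-trans (σ≡F (to (r , r∈n))) (eval-mod F (mod-sym x≡r′)))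

  -- The square of the gcd of `a` and `b` divides `a * b`, so the gcd is constant.
  squareFree-comaximal : SquareFree (a * b) → Comaximal a b
  squareFree-comaximal {a} {b} (ab≉0 , sq) with gcd@(d , d∣a , d∣b , _) ← bezout a b =
    gcd-unit gcd (unit (sq d (∣-* d∣a d∣b)) (∣-≉0 (∣-trans d∣a (b , *-comm b a)) ab≉0))

  squareFree⇒chen : SquareFree g → Chen g
  squareFree⇒chen {g} sf with n , p ← below-suc-degree g = go n g sf p
    where
    go : ∀ n g → SquareFree g → Below (suc n) g → Chen g
    go′ : ∀ n g → SquareFree g → Below (suc n) g → Dec (Below 1 g) → Chen g
    go n g sf p = go′ n g sf p (below? 1 g)
    go′ n g sf p (yes g∈1) = chen-1 (unit g∈1 (proj₁ sf))
    go′ zero g sf p (no g∉1) = ⊥-elim (g∉1 p)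
    go′ (suc n) g sf p (no g∉1) = [ chen-irreducible , split ]′ (irreducible? g g∉1)
      where
      split : Factored g → Chen g
      split (d , e , d∉1 , e∉1 , de≈g) = chen-resp de≈g
        (chen-* (squareFree-comaximal (squareFree-resp (sym de≈g) sf))
          (go n d (squareFree-∣ (e , trans (*-comm e d) de≈g) sf) (cofactor-below de≈g (proj₁ sf) e∉1 p))
          (go n e (squareFree-∣ (d , de≈g) sf) (cofactor-below (trans (*-comm e d) de≈g) (proj₁ sf) d∉1 p)))

  open import Algebra.Properties.Semiring.Exp 𝔸.semiring using (_^_; ^-homo-*) public

  ^-≉0 : ¬ P ≈ 0# → ∀ k → ¬ P ^ k ≈ 0#
  ^-≉0 P≉0 zero    = 1≉0
  ^-≉0 P≉0 (suc k) = *-≉0 P≉0 (^-≉0 P≉0 k)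

  ^-mono-∣ : ∀ P → m ≤ n → P ^ m ∣ P ^ n
  ^-mono-∣ {m} {n} P m≤n = P ^ (n ℕ.∸ m) ,
    trans (sym (^-homo-* P (n ℕ.∸ m) m)) (𝔸.reflexive (≡.cong (P ^_) (ℕ.m∸n+n≡m m≤n)))

  ^-∣*-≤ : ¬ P ≈ 0# → ¬ P ∣ f → ∀ m n → P ^ m ∣ P ^ n * f → m ≤ n
  ^-∣*-≤ {P} {f} P≉0 P∤f m n Pᵐ∣Pⁿf = ℕ.≮⇒≥ λ n<m → P∤f (∣-cancelʳ (^-≉0 P≉0 n)
    (∣-trans (^-mono-∣ P n<m) (∣-resp refl (*-comm _ f) Pᵐ∣Pⁿf)))

  comaximal-^ : Comaximal a b → ∀ k → Comaximal a (b ^ k)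
  comaximal-^ co zero    = comaximal-1
  comaximal-^ co (suc k) = comaximal-* co (comaximal-^ co k)

  extract : ¬ Below 1 P → ∀ g → ¬ g ≈ 0# → ∃₂ λ k f → g ≈ P ^ k * f × ¬ P ∣ f
  extract {P} P∉1 g g≉0 with n , p ← below-suc-degree g = go n g g≉0 p
    where
    go : ∀ n g → ¬ g ≈ 0# → Below (suc n) g → ∃₂ λ k f → g ≈ P ^ k * f × ¬ P ∣ f
    go n g g≉0 p with P ∣? g
    ... | no P∤g = 0 , g , sym (𝔸.*-identityˡ g) , P∤g
    go zero g g≉0 p | yes P∣g = ⊥-elim (P∉1 (∣-below P∣g g≉0 p))
    go (suc n) g g≉0 p | yes (h , hP≈g)
      with k , f , h≈Pᵏf , P∤f ← go n h (∣-≉0 (P , trans (*-comm P h) hP≈g) g≉0) (cofactor-below hP≈g g≉0 P∉1 p)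
      = suc k , f , trans (sym hP≈g) (trans (*-comm h P) (trans (*-congˡ h≈Pᵏf) (sym (*-assoc P _ f)))) , P∤f

  -- The map sending the multiples of Pᵏ⁺¹ to Pᵏf and everything else to 0 is congruence
  -- preserving modulo Pᵏ⁺¹f, but it violates the second-difference property of polynomials.
  not-chen : Irreducible P → ¬ P ∣ f → ∀ k u v → P ^ suc k ∣ u * v →
    ¬ P ^ suc k ∣ u → ¬ P ^ suc k ∣ v → ¬ P ^ suc k ∣ u + v → ¬ Chen (P ^ suc k * f)
  not-chen {P} {f} irr@(P∉1 , _) P∤f k u v N∣uv N∤u N∤v N∤u+v chen =
    contradict (chen σ preserving)
    where
    N = P ^ suc k
    τ = P ^ k * f
    P≉0 = ¬below⇒≉0 P∉1
    f≉0 : ¬ f ≈ 0#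
    f≉0 f≈0 = P∤f (∣-resp refl (sym f≈0) ∣0)
    choose : ∀ {x} → Dec (N ∣ x) → Poly
    choose (yes _) = τ
    choose (no _)  = 0#
    σ : Poly → Poly
    σ x = choose (N ∣? x)
    choose-no : ∀ {x} → ¬ N ∣ x → (dec : Dec (N ∣ x)) → choose dec ≈ 0#
    choose-no N∤x (yes N∣x) = ⊥-elim (N∤x N∣x)
    choose-no N∤x (no _)    = refl
    choose-0 : (dec : Dec (N ∣ 0#)) → choose dec ≈ τ
    choose-0 (yes _)  = refl
    choose-0 (no N∤0) = ⊥-elim (N∤0 ∣0)
    choose-cong : ∀ {x y} → (N ∣ x → N ∣ y) → (N ∣ y → N ∣ x) →
      (dx : Dec (N ∣ x)) (dy : Dec (N ∣ y)) → choose dx ≈ choose dy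
    choose-cong to from (yes _)   (yes _)   = refl
    choose-cong to from (yes N∣x) (no N∤y)  = ⊥-elim (N∤y (to N∣x))
    choose-cong to from (no N∤x)  (yes N∣y) = ⊥-elim (N∤x (from N∣y))
    choose-cong to from (no _)    (no _)    = refl
    ∣choose : ∀ {x} → h ∣ τ → (dec : Dec (N ∣ x)) → h ∣ choose dec
    ∣choose h∣τ (yes _) = h∣τ
    ∣choose h∣τ (no _)  = ∣0
    -- By the power of `P` in `h`: if it is full, congruence modulo `h` decides membership in the
    -- multiples of `N`; otherwise `h` divides `τ`, and both values of `σ` vanish modulo `h`.
    dichotomy : ∀ h → h ∣ N * f → N ∣ h ⊎ h ∣ τ
    dichotomy h h∣Nf with j , h′ , h≈Pʲh′ , P∤h′ ← extract P∉1 h (∣-≉0 h∣Nf (*-≉0 (^-≉0 P≉0 (suc k)) f≉0))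
      with suc k ℕ.≤? j
    ... | yes k<j = inj₁ (∣-trans (^-mono-∣ P k<j) (h′ , trans (*-comm h′ _) (sym h≈Pʲh′)))
    ... | no k≮j = inj₂ (∣-resp (sym h≈Pʲh′) refl (∣-* (^-mono-∣ P (ℕ.≤-pred (ℕ.≰⇒> k≮j)))
            (comaximal-∣* (comaximal-^ (comaximal-sym (irreducible-comaximal irr P∤h′)) (suc k))
              (∣-trans (P ^ j , sym h≈Pʲh′) h∣Nf))))
    preserving : Preserving (N * f) σ
    preserving h h∣Nf x y x≡y =
      [ (λ N∣h → mod-reflexive (choose-cong (mod-∣-resp N∣h x≡y) (mod-∣-resp N∣h (mod-sym x≡y)) (N ∣? x) (N ∣? y)))
      , (λ h∣τ → ∣+ (∣choose h∣τ (N ∣? x)) (∣- (∣choose h∣τ (N ∣? y)))) ]′ (dichotomy h h∣Nf)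
    contradict : PolynomialModulo (N * f) σ → ⊥
    -- `F` vanishes modulo `N` at u, v and u + v, so the second difference makes `N` divide its
    -- value at 0, which is congruent to `τ`. Cancelling `P ^ k` leaves `P` dividing `f`.
    contradict (F , σ≡F) = P∤f (∣-cancelʳ (^-≉0 P≉0 k) (∣-resp refl (*-comm _ f)
      (mod-∣-resp ∣-refl (mod-trans (N∣Nf (mod-sym (σ≡F 0#))) (mod-reflexive (choose-0 (N ∣? 0#)))) N∣F0)))
      where
      module F = Polynomial 𝔸.rawRing
      N∣Nf : ∀ {x} → N * f ∣ x → N ∣ x
      N∣Nf = ∣-trans (f , *-comm f N)
      N∣F : ∀ x → ¬ N ∣ x → N ∣ F.eval F x
      N∣F x N∤x = mod0⇒∣ (mod-trans (N∣Nf (mod-sym (σ≡F x))) (mod-reflexive (choose-no N∤x (N ∣? x))))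
      N∣F0 : N ∣ F.eval F 0#
      N∣F0 = ∣-resp refl
        (solve 4 (λ s a b z → (s :- a :- b :+ z) :- s :+ a :+ b := z) refl
          (F.eval F (u + v)) (F.eval F u) (F.eval F v) (F.eval F 0#))
        (∣+ (∣+ (∣+ (∣-trans N∣uv (second-difference F u v)) (∣- (N∣F (u + v) N∤u+v))) (N∣F u N∤u)) (N∣F v N∤v))

  -- If Pᵏ is the exact power in `g`, take u = Pᵏ⁻¹ and v = b u. Since k ≥ 2, the exponent 2k - 2 of
  -- u v reaches k, while u, v and u + v = (1 + b) u keep the exponent k - 1.
  square⇒¬chen : Irreducible P → ¬ g ≈ 0# → P * P ∣ g → ∀ b → ¬ P ∣ b → ¬ P ∣ 1# + b → ¬ Chen g
  square⇒¬chen {P} {g} irr@(P∉1 , _) g≉0 P²∣g b P∤b P∤1+b chen =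
    let k , f , g≈Pᵏf , P∤f = extract P∉1 g g≉0
        e , 2+e≡k = ℕ.≤⇒≤″ (^-∣*-≤ (¬below⇒≉0 P∉1) P∤f 2 k
          (∣-resp (*-congˡ (sym (𝔸.*-identityʳ P))) g≈Pᵏf P²∣g))
    in obstruction irr P∤f e b P∤b P∤1+b
         (chen-resp (trans g≈Pᵏf (*-congʳ (𝔸.reflexive (≡.cong (P ^_) (≡.sym 2+e≡k))))) chen)
    where
    obstruction : ∀ {P f} → Irreducible P → ¬ P ∣ f → ∀ e b → ¬ P ∣ b → ¬ P ∣ 1# + b → ¬ Chen (P ^ (2 ℕ.+ e) * f)
    obstruction {P} irr@(P∉1 , _) P∤f e b P∤b P∤1+b =
      not-chen irr P∤f (suc e) U (U * b)
        (∣-resp refl (trans (*-congʳ (^-homo-* P (suc e) (suc e))) (*-assoc U U b))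
          (∣*ʳ b (^-mono-∣ P (s≤s (ℕ.m≤n+m (suc e) e)))))
        (λ N∣U → no-power (irreducible-∤1 irr) (∣-resp refl (sym (𝔸.*-identityʳ U)) N∣U))
        (no-power P∤b)
        (λ N∣s → no-power P∤1+b (∣-resp refl (solve 2 (λ u b → u :+ u :* b := u :* (con ℤ.1ℤ :+ b)) refl U b) N∣s))
      where
      U = P ^ suc e
      no-power : ∀ {w} → ¬ P ∣ w → ¬ P ^ suc (suc e) ∣ U * w
      no-power P∤w N∣Uw = ℕ.<-irrefl ≡.refl (^-∣*-≤ (¬below⇒≉0 P∉1) P∤w (suc (suc e)) (suc e) N∣Uw)

  -- The substitute when no suitable `b` exists. With Pᵏ the exact power, take u = Pᵏ⁻² and v =
  -- Pᵏ⁻¹: the exponent 2k - 3 of u v reaches k because k ≥ 3, and u + v = u (1 + P) with 1 + P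
  -- prime to P.
  cube⇒¬chen : Irreducible P → ¬ g ≈ 0# → P * (P * P) ∣ g → ¬ Chen g
  cube⇒¬chen {P} {g} irr@(P∉1 , _) g≉0 P³∣g chen =
    let k , f , g≈Pᵏf , P∤f = extract P∉1 g g≉0
        e , 3+e≡k = ℕ.≤⇒≤″ (^-∣*-≤ (¬below⇒≉0 P∉1) P∤f 3 k
          (∣-resp (*-congˡ (*-congˡ (sym (𝔸.*-identityʳ P)))) g≈Pᵏf P³∣g))
    in obstruction irr P∤f e
         (chen-resp (trans g≈Pᵏf (*-congʳ (𝔸.reflexive (≡.cong (P ^_) (≡.sym 3+e≡k))))) chen)
    where
    obstruction : ∀ {P f} → Irreducible P → ¬ P ∣ f → ∀ e → ¬ Chen (P ^ (3 ℕ.+ e) * f)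
    obstruction {P} irr@(P∉1 , _) P∤f e =
      not-chen irr P∤f (suc (suc e)) U (P * U)
        (∣-resp refl (^-homo-* P (suc e) (suc (suc e))) (^-mono-∣ P (s≤s (ℕ.m≤n+m (suc (suc e)) e))))
        (λ N∣U → no-power (irreducible-∤1 irr) (∣-resp refl (sym (𝔸.*-identityʳ U)) N∣U))
        (λ N∣PU → ℕ.<-irrefl ≡.refl (^-∣*-≤ P≉0 (irreducible-∤1 irr) (suc (suc (suc e))) (suc (suc e))
          (∣-resp refl (sym (𝔸.*-identityʳ (P * U))) N∣PU)))
        (λ N∣s → no-power (λ P∣1+P → irreducible-∤1 irr (∣-resp refl (solve 1
              (λ p → con ℤ.1ℤ :+ p :- p := con ℤ.1ℤ) refl P) (∣+ P∣1+P (∣- ∣-refl))))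
          (∣-resp refl (solve 2 (λ u p → u :+ p :* u := u :* (con ℤ.1ℤ :+ p)) refl U P) N∣s))
      where
      U = P ^ suc e
      P≉0 = ¬below⇒≉0 P∉1
      no-power : ∀ {w} → ¬ P ∣ w → ¬ P ^ suc (suc (suc e)) ∣ U * w
      no-power P∤w N∣Uw = ℕ.<-irrefl ≡.refl (ℕ.≤-trans (ℕ.n≤1+n _) (^-∣*-≤ P≉0 P∤w (suc (suc (suc e))) (suc e) N∣Uw))

-- Counting squarefree polynomials.

module Counting {c ℓ} (K : CommutativeRing c ℓ) (isField : IsField K)
  (q : ℕ) (K≅q : HasCardinality (CommutativeRing.setoid K) q) where

  private
    module K = CommutativeRing K
  open FiniteFieldPolynomials K isField q K≅q public

  private variable
    m n : ℕ
    a b d e f g h k s s′ : Poly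

  MonicOf : ℕ → Poly → Set ℓ
  MonicOf n h = coeff h n K.≈ K.1# × Below (suc n) h

  Monic : Poly → Set ℓ
  Monic h = ∃ λ n → MonicOf n h

  K1≉0 : ∀ {x} → x K.≈ K.1# → ¬ x K.≈ K.0#
  K1≉0 x≈1 x≈0 = proj₁ isField (K.trans (K.sym x≈1) x≈0)

  monic-degree : MonicOf n h → Degree h n
  monic-degree (hₙ≈1 , p) = K1≉0 hₙ≈1 , p

  monic≉0 : Monic h → ¬ h ≈ 0#
  monic≉0 (_ , mon) = degree≉0 (monic-degree mon)

  monic-* : Monic g → Monic h → Monic (g * h)
  monic-* {g} {h} (m , gₘ≈1 , p) (n , hₙ≈1 , r) with e , s ← leading m n g h p r =
    m ℕ.+ n , K.trans e (K.trans (K.*-cong gₘ≈1 hₙ≈1) (K.*-identityˡ _)) , s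

  monic-∷ : ∀ {x} → MonicOf n h → MonicOf (suc n) (x ∷ h)
  monic-∷ (hₙ≈1 , p) = hₙ≈1 , below-∷ p

  monic-1 : Monic 1#
  monic-1 = 0 , K.refl , below-1

  normalise : ¬ h ≈ 0# → ∃₂ λ u k → Below 1 u × Monic k × h ≈ u * k
  normalise {h} h≉0 = [ (λ h≈0 → ⊥-elim (h≉0 h≈0)) , scale ]′ (degree? h)
    where
    scale : ∃ (Degree h) → ∃₂ λ u k → Below 1 u × Monic k × h ≈ u * k
    scale (n , hₙ≉0 , p) with x⁻¹ , x⁻¹x≈1 , xx⁻¹≈1 ← proj₂ isField (coeff h n) hₙ≉0 =
      (coeff h n ∷ []) , x⁻¹ ⊡ h , below-∷ below-0 ,
      (n , K.trans (PR.coeff-⊡ x⁻¹ h n) x⁻¹x≈1 , below-· x⁻¹ p) ,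
      sym (trans (*-congˡ (sym (PR.const-⊠ x⁻¹ h))) (trans (sym (*-assoc _ _ h))
        (trans (*-congʳ (trans (PR.const-⊠-const _ x⁻¹) (∷-cong xx⁻¹≈1 refl))) (𝔸.*-identityˡ h))))

  -- The leading coefficient is carried by `s`; keeping `h` monic is what makes the pair unique.
  SquarePart : Poly → Set (c ⊔ ℓ)
  SquarePart g = ∃₂ λ s h → SquareFree s × Monic h × s * (h * h) ≈ g

  opaque
    squarePart : ∀ g → ¬ g ≈ 0# → SquarePart g
    squarePart g g≉0 with n , p ← below-suc-degree g = go n g g≉0 p
      where
      go : ∀ n g → ¬ g ≈ 0# → Below (suc n) g → SquarePart g
      go′ : ∀ n g → ¬ g ≈ 0# → Below (suc n) g → (∃ λ h → ¬ Below 1 h × h * h ∣ g) → SquarePart g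
      go n g g≉0 p = [ trivial , go′ n g g≉0 p ]′ (squareFree? g g≉0)
        where
        trivial : SquareFree g → SquarePart g
        trivial sf = g , 1# , sf , monic-1 ,
          solve 1 (λ g → g :* (con ℤ.1ℤ :* con ℤ.1ℤ) := g) refl g
      go′ zero g g≉0 p (h , h∉1 , h²∣g) = ⊥-elim (h∉1 (square-below g≉0 p h²∣g))
      go′ (suc n) g g≉0 p (h , h∉1 , k , kh²≈g)
        with u , h′ , u∈1 , mon , h≈uh′ ← normalise (¬below⇒≉0 h∉1) = extend (go n g′ g′≉0 g′∈n)
        where
        g′ : Poly
        -- The leading coefficient `u` of `h` moves, squared, into the cofactor, so that the square
        -- split off is that of the monic `h′`.
        g′ = k * u * u
        g′h′²≈g : g′ * (h′ * h′) ≈ g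
        g′h′²≈g = trans (solve 3 (λ k u h → k :* u :* u :* (h :* h) := k :* ((u :* h) :* (u :* h))) refl k u h′)
          (trans (*-congˡ (*-cong (sym h≈uh′) (sym h≈uh′))) kh²≈g)
        g′≉0 : ¬ g′ ≈ 0#
        g′≉0 = ∣-≉0 (h′ * h′ , trans (*-comm (h′ * h′) g′) g′h′²≈g) g≉0
        g′∈n : Below (suc n) g′
        g′∈n = cofactor-below g′h′²≈g g≉0
          (λ h′²∈1 → h∉1 (below-resp (sym h≈uh′) (proj₂ (leading 0 0 u h′ u∈1
            (∣-below (h′ , refl) (*-≉0 (monic≉0 mon) (monic≉0 mon)) h′²∈1)))))
          p
        extend : SquarePart g′ → SquarePart g
        extend (s , h″ , sf , mon″ , eq) = s , h″ * h′ , sf , monic-* mon″ mon ,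
          trans (solve 3 (λ s h k → s :* ((h :* k) :* (h :* k)) := s :* (h :* h) :* (k :* k)) refl s h″ h′)
            (trans (*-congʳ eq) g′h′²≈g)

  monic-associated : Monic g → Monic h → Below 1 a → Below 1 b → ¬ a ≈ 0# → ¬ b ≈ 0# →
    a * g ≈ b * h → g ≈ h
  monic-associated {g} {h} {a} {b} (m , mon-g) (n , mon-h) a∈1 b∈1 a≉0 b≉0 ag≈bh =
    equal (degree-unique (degree-resp ag≈bh (degree-* (const-degree a∈1 a≉0) (monic-degree mon-g)))
             (degree-* (const-degree b∈1 b≉0) (monic-degree mon-h)))
    where
    const-degree : Below 1 f → ¬ f ≈ 0# → Degree f 0
    const-degree f∈1 f≉0 = (λ f₀≈0 → f≉0 (trans (constant f∈1) (trans (∷-cong f₀≈0 refl) 0∷0))) , f∈1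
    top : ∀ {f u k} → MonicOf k f → Below 1 u → coeff (u * f) k K.≈ coeff u 0
    top {f} {u} {k} (fₖ≈1 , p) u∈1 =
      K.trans (proj₁ (leading 0 k u f u∈1 p)) (K.trans (K.*-congˡ fₖ≈1) (K.*-identityʳ _))
    equal : m ≡ n → g ≈ h
    equal ≡.refl = *-cancelʳ a≉0 (trans (*-comm g a) (trans ag≈bh (trans (*-congʳ (sym a≈b)) (*-comm a h))))
      where
      a≈b : a ≈ b
      a≈b = trans (constant a∈1) (trans (∷-cong
        (K.trans (K.sym (top mon-g a∈1)) (K.trans (at ag≈bh m) (top mon-h b∈1))) refl) (sym (constant b∈1)))

  -- Dividing `h` and `k` by their gcd leaves coprime `a` and `b` with a² s = b² s′. Hence a²
  -- divides s′ and b² divides s, so both are constants, and the monic `h` and `k` are associated.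
  squarePart-unique : SquareFree s → SquareFree s′ → Monic h → Monic k →
    s * (h * h) ≈ s′ * (k * k) → s ≈ s′ × h ≈ k
  squarePart-unique {s} {s′} {h} {k} (s≉0 , sq) (s′≉0 , sq′) mon-h mon-k eq
    with d , (a , ad≈h) , (b , bd≈k) , u , v , uv ← bezout h k =
      *-cancelʳ (*-≉0 (monic≉0 mon-h) (monic≉0 mon-h)) (trans eq (*-congˡ (*-cong (sym h≈k) (sym h≈k)))) , h≈k
    where
    d≉0 : ¬ d ≈ 0#
    d≉0 = ∣-≉0 (a , ad≈h) (monic≉0 mon-h)
    co : Comaximal a b
    co = u , v , *-cancelʳ d≉0 (trans (solve 5 (λ u a v b d → (u :* a :+ v :* b) :* d := u :* (a :* d) :+ v :*
          (b :* d)) refl u a v b d)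
      (trans (+-cong (*-congˡ ad≈h) (*-congˡ bd≈k)) (trans uv (sym (𝔸.*-identityˡ d)))))
    co² : Comaximal (a * a) (b * b)
    co² = comaximal-* (comaximal-sym (comaximal-* (comaximal-sym co) (comaximal-sym co)))
                      (comaximal-sym (comaximal-* (comaximal-sym co) (comaximal-sym co)))
    reduced : a * a * s ≈ b * b * s′
    reduced = *-cancelʳ (*-≉0 d≉0 d≉0) (trans
      (solve 3 (λ a s d → a :* a :* s :* (d :* d) := s :* ((a :* d) :* (a :* d))) refl a s d)
      (trans (*-congˡ (*-cong ad≈h ad≈h)) (trans eq (trans (*-congˡ (*-cong (sym bd≈k) (sym bd≈k)))
      (solve 3 (λ b s d → s :* ((b :* d) :* (b :* d)) := b :* b :* s :* (d :* d)) refl b s′ d)))))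
    a∈1 : Below 1 a
    a∈1 = sq′ a (comaximal-∣* co² (∣-resp refl reduced (s , *-comm s (a * a))))
    b∈1 : Below 1 b
    b∈1 = sq b (comaximal-∣* (comaximal-sym co²) (∣-resp refl (sym reduced) (s′ , *-comm s′ (b * b))))
    h≈k : h ≈ k
    h≈k = monic-associated mon-h mon-k b∈1 a∈1
      (∣-≉0 (d , trans (*-comm d b) bd≈k) (monic≉0 mon-k)) (∣-≉0 (d , trans (*-comm d a) ad≈h) (monic≉0 mon-h))
      (trans (*-congˡ (sym ad≈h)) (trans (solve 3 (λ a b d → b :* (a :* d) := a :* (b :* d)) refl a b d)
            (*-congˡ bd≈k)))

  -- The counts are cumulative: `x n` refers to all degrees below `n`.
  Count : ∀ {r} → Pred Poly r → (ℕ → ℕ) → Set _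
  Count X x = ∀ n → Card 𝔸.setoid (Below n ∩ X) (x n)

  count-split : ∀ {r s} {X : Pred Poly r} {Y : Pred Poly s} {x : ℕ → ℕ} →
    (∀ g → Dec (Y g)) → (∀ {f g} → f ≈ g → Y f → Y g) → Count X x →
    ∃₂ λ y z → (∀ n → y n ℕ.+ z n ≡ x n) × Count (X ∩ Y) y × Count (X ∩ (¬_ ∘ Y)) z
  count-split {X = X} {Y} Y? Y-resp X≅x =
    (λ n → proj₁ (split n)) , (λ n → proj₁ (proj₂ (split n))) , (λ n → proj₁ (proj₂ (proj₂ (split n)))) ,
    (λ n → card-⇔ (λ ((p , Xg) , Yg) → p , Xg , Yg) (λ (p , Xg , Yg) → (p , Xg) , Yg) (proj₁ (proj₂ (proj₂
          (proj₂ (split n)))))) ,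
    (λ n → card-⇔ (λ ((p , Xg) , Yg) → p , Xg , Yg) (λ (p , Xg , Yg) → (p , Xg) , Yg) (proj₂ (proj₂ (proj₂
          (proj₂ (split n))))))
    where
    split : ∀ n → _
    split n = card-split Y? Y-resp (X≅x n)

  NonZero : Pred Poly ℓ
  NonZero g = ¬ g ≈ 0#

  count-nonZero : Count NonZero (λ n → q ℕ.^ n ℕ.∸ 1)
  count-nonZero n = derive (card-split zero? (λ f≈g f≈0 → trans (sym f≈g) f≈0) (card-below n))
    where
    derive : (∃₂ λ k l → k ℕ.+ l ≡ q ℕ.^ n × Card 𝔸.setoid (Below n ∩ (_≈ 0#)) k × Card 𝔸.setoid
          (Below n ∩ NonZero) l) →
      Card 𝔸.setoid (Below n ∩ NonZero) (q ℕ.^ n ℕ.∸ 1)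
    derive (k , l , k+l≡qⁿ , Z≅k , NZ≅l) = ≡.subst (Card 𝔸.setoid (Below n ∩ NonZero))
        (≡.trans (≡.sym (ℕ.m+n∸m≡n k l)) (≡.trans (≡.cong (ℕ._∸ k) k+l≡qⁿ) (≡.cong (q ℕ.^ n ℕ.∸_) k≡1))) NZ≅l
      where
      k≡1 : k ≡ 1
      k≡1 = card-unique Z≅k (card-singleton 0# (below-0 , refl) proj₂)

  squareFree-dec : ∀ g → Dec (SquareFree g)
  squareFree-dec g = decide (zero? g)
    where
    decide : Dec (g ≈ 0#) → Dec (SquareFree g)
    decide (yes g≈0) = no λ (g≉0 , _) → g≉0 g≈0
    decide (no g≉0)  = [ yes , (λ (h , h∉1 , h²∣g) → no λ (_ , sq) → h∉1 (sq h h²∣g)) ]′ (squareFree? g g≉0)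

  -- The polynomials with a square factor are the s (c + t h)² for unique s, h and c, where s
  -- is squarefree and h is monic; they correspond to the pairs of s h² and the scalar c.
  card-¬squareFree : ∀ n → Card 𝔸.setoid (Below (suc (suc n)) ∩ (NonZero ∩ (¬_ ∘ SquareFree)))
    ((q ℕ.^ n ℕ.∸ 1) ℕ.* q)
  card-¬squareFree n = card-image (card-× (count-nonZero n) K≅q) φ
    (λ {i} {j} → φ-cong {i} {j}) (λ {i} {j} → φ-inj {i} {j}) φ-Y preimage
    where
    enlarge : K.Carrier → SquarePart g → Poly
    enlarge x (s , h , _) = s * ((x ∷ h) * (x ∷ h))
    φ : Σ Poly (Below n ∩ NonZero) × K.Carrier → Poly
    φ ((g , _ , g≉0) , x) = enlarge x (squarePart g g≉0)
    enlarge-cong : ∀ {x y} → g ≈ h → x K.≈ y → (Sg : SquarePart g) (Sh : SquarePart h) → enlarge x Sg ≈ enlarge y Sh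
    enlarge-cong g≈h x≈y (s , u , sf , mon , e) (s′ , u′ , sf′ , mon′ , e′) =
      let s≈s′ , u≈u′ = squarePart-unique sf sf′ mon mon′ (trans e (trans g≈h (sym e′)))
      in *-cong s≈s′ (*-cong (∷-cong x≈y u≈u′) (∷-cong x≈y u≈u′))
    enlarge-inj : ∀ {x y} (Sg : SquarePart g) (Sh : SquarePart h) → enlarge x Sg ≈ enlarge y Sh → g ≈ h × x K.≈ y
    enlarge-inj (s , u , sf , (_ , mon) , e) (s′ , u′ , sf′ , (_ , mon′) , e′) eq =
      let s≈s′ , xu≈yu′ = squarePart-unique sf sf′ (_ , monic-∷ mon) (_ , monic-∷ mon′) eq
          u≈u′ = coeffwise (at xu≈yu′ ∘ suc)
      in trans (sym e) (trans (*-cong s≈s′ (*-cong u≈u′ u≈u′)) e′) , at xu≈yu′ 0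
    φ-cong : ∀ {i j} → proj₁ (proj₁ i) ≈ proj₁ (proj₁ j) × proj₂ i K.≈ proj₂ j → φ i ≈ φ j
    φ-cong {(g , _ , g≉0) , x} {(h , _ , h≉0) , y} (g≈h , x≈y) = enlarge-cong g≈h x≈y (squarePart g g≉0)
          (squarePart h h≉0)
    φ-inj : ∀ {i j} → φ i ≈ φ j → proj₁ (proj₁ i) ≈ proj₁ (proj₁ j) × proj₂ i K.≈ proj₂ j
    φ-inj {(g , _ , g≉0) , x} {(h , _ , h≉0) , y} eq = enlarge-inj (squarePart g g≉0) (squarePart h h≉0) eq
    -- Passing from h to x + t h raises the degree of the square by exactly two, which is the gap
    -- between `n` and `n + 2` in the statement.
    enlarge-degree : ∀ a b → a ℕ.+ (suc b ℕ.+ suc b) ≡ suc (suc (a ℕ.+ (b ℕ.+ b)))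
    enlarge-degree a b = ≡.trans (ℕ.+-suc a (b ℕ.+ suc b))
      (≡.cong suc (≡.trans (≡.cong (a ℕ.+_) (ℕ.+-suc b b)) (ℕ.+-suc a (b ℕ.+ b))))
    φ-Y : ∀ i → (Below (suc (suc n)) ∩ (NonZero ∩ (¬_ ∘ SquareFree))) (φ i)
    φ-Y ((g , p , g≉0) , x) = enlarge-Y (squarePart g g≉0)
      where
      enlarge-Y : (Sg : SquarePart g) → Below (suc (suc n)) (enlarge x Sg) × NonZero
            (enlarge x Sg) × ¬ SquareFree (enlarge x Sg)
      enlarge-Y (s , h , sf@(s≉0 , _) , (b , mon) , e) =
        [ (λ s≈0 → ⊥-elim (s≉0 s≈0)) , bound ]′ (degree? s)
        , *-≉0 s≉0 (*-≉0 xh≉0 xh≉0)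
        , λ (_ , sq) → monic≉0 (b , mon) (below-zero (below-tail (sq (x ∷ h) (s , refl))))
        where
        xh≉0 = monic≉0 (_ , monic-∷ {x = x} mon)
        bound : ∃ (Degree s) → Below (suc (suc n)) (s * ((x ∷ h) * (x ∷ h)))
        bound (a , deg) = below-mono
          (≡.subst (λ j → suc j ≤ suc (suc n)) (≡.sym (enlarge-degree a b))
            (s≤s (s≤s (below-≤ p (proj₁ (degree-resp e (degree-* deg (degree-* (monic-degree mon)
                  (monic-degree mon)))))))))
          (proj₂ (degree-* deg (degree-* (monic-degree (monic-∷ {x = x} mon)) (monic-degree (monic-∷ {x = x} mon)))))
    preimage : ∀ y → (Below (suc (suc n)) ∩ (NonZero ∩ (¬_ ∘ SquareFree))) y → ∃ λ i → y ≈ φ i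
    preimage y (p , y≉0 , ¬sf) = shrink (squarePart y y≉0)
      where
      shrink : SquarePart y → ∃ λ i → y ≈ φ i
      shrink (s , [] , sf , (_ , mon) , e) = ⊥-elim (monic≉0 (_ , mon) refl)
      -- A square part of degree 0 is a unit, so `y` would be associated to the squarefree `s`. In
      -- the remaining case the tail of the root is again monic.
      shrink (s , x ∷ h , sf , (zero , mon) , e) = ⊥-elim (¬sf (squareFree-∣ y∣s sf))
        where
        y∣s : y ∣ s
        y∣s =
          let k , kxh≈1 = unit (proj₂ mon) (monic≉0 (_ , mon)) in
          k * k , trans (*-congˡ (sym e)) (trans (solve 3 (λ k s h → k :* k :* (s :* (h :* h)) := (k :* h) :*
                (k :* h) :* s) refl k s (x ∷ h))
            (trans (*-congʳ (*-cong kxh≈1 kxh≈1)) (trans (*-congʳ (𝔸.*-identityˡ 1#)) (𝔸.*-identityˡ s))))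
      shrink (s , x ∷ h , sf@(s≉0 , _) , (suc b , hb≈1 , r) , e) =
        ((y′ , [ (λ s≈0 → ⊥-elim (s≉0 s≈0)) , bound ]′ (degree? s) , y′≉0) , x) ,
        trans (sym e) (enlarge-cong refl K.refl (s , h , sf , (b , mon) , refl) (squarePart y′ y′≉0))
        where
        mon : MonicOf b h
        mon = hb≈1 , below-tail r
        y′ = s * (h * h)
        y′≉0 : ¬ y′ ≈ 0#
        y′≉0 = *-≉0 s≉0 (*-≉0 (monic≉0 (b , mon)) (monic≉0 (b , mon)))
        bound : ∃ (Degree s) → Below n y′
        bound (a , deg) = below-mono
          (ℕ.≤-pred (ℕ.≤-pred (≡.subst (λ j → suc j ≤ suc (suc n)) (enlarge-degree a b)
            (below-≤ p (proj₁ (degree-resp e (degree-* deg (degree-* (monic-degree (monic-∷ {x = x} mon))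
                  (monic-degree (monic-∷ {x = x} mon))))))))))
          (proj₂ (degree-* deg (degree-* (monic-degree mon) (monic-degree mon))))

  -- The last clause splits the nonzero polynomials by squarefreeness and amounts to s (n + 2) =
  -- qⁿ⁺² - qⁿ⁺¹ + q - 1. It does not reach the arguments 0 and 1, hence the two initial values.
  SquareFreeCount : Set (c ⊔ ℓ)
  SquareFreeCount = ∃ λ s → Count SquareFree s × s 0 ≡ 0 × s 1 ≡ q ℕ.∸ 1 ×
    ∀ n → (q ℕ.^ n ℕ.∸ 1) ℕ.* q ℕ.+ s (2 ℕ.+ n) ≡ q ℕ.^ (2 ℕ.+ n) ℕ.∸ 1

  count-squareFree : SquareFreeCount
  count-squareFree = derive (count-split squareFree-dec squareFree-resp count-nonZero)
    where
    derive : (∃₂ λ s z → (∀ n → s n ℕ.+ z n ≡ q ℕ.^ n ℕ.∸ 1) ×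
        Count (NonZero ∩ SquareFree) s × Count (NonZero ∩ (¬_ ∘ SquareFree)) z) →
      SquareFreeCount
    derive (s , z , s+z≡x , SF≅s , ¬SF≅z) =
      s , SF≅s′ ,
      card-unique (SF≅s′ 0) (card-∅ λ (p , g≉0 , _) → g≉0 (below-zero p)) ,
      ≡.trans (≡.trans (≡.sym (ℕ.+-identityʳ (s 1))) (≡.trans (≡.cong (s 1 ℕ.+_) (≡.sym z1≡0)) (s+z≡x 1)))
        (≡.cong (ℕ._∸ 1) (ℕ.*-identityʳ q)) ,
      λ n → ≡.trans (≡.trans (ℕ.+-comm _ (s (2 ℕ.+ n))) (≡.cong (s (2 ℕ.+ n) ℕ.+_)
          (card-unique (card-¬squareFree n) (¬SF≅z (2 ℕ.+ n))))) (s+z≡x (2 ℕ.+ n))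
      where
      SF≅s′ : Count SquareFree s
      SF≅s′ n = card-⇔ (λ (p , _ , sf) → p , sf) (λ (p , sf) → p , proj₁ sf , sf) (SF≅s n)
      z1≡0 : z 1 ≡ 0
      z1≡0 = card-unique (¬SF≅z 1) (card-∅ λ (p , g≉0 , ¬sf) → ¬sf (g≉0 , λ h h²∣g → square-below g≉0 p h²∣g))

-- Counting the Chen moduli.

shift : (ℕ → ℕ) → ℕ → ℕ
shift x zero    = 0
shift x (suc n) = x n

-- On generating series `shift` is multiplication by z and `cube` by 1 + z + z². The value 0 that
-- `shift` inserts fits sets of nonzero polynomials, none of which lies below degree 0.
cube : (ℕ → ℕ) → ℕ → ℕ
cube x n = x n ℕ.+ (shift x n ℕ.+ shift (shift x) n)

module ChenCounting {c ℓ} (K : CommutativeRing c ℓ) (isField : IsField K)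
  (q : ℕ) (K≅q : HasCardinality (CommutativeRing.setoid K) q) where

  private
    module K = CommutativeRing K
    module K≅q = Inverse K≅q
  open Counting K isField q K≅q public

  private variable
    r r′ : Level
    X : Pred Poly r
    Y : Pred Poly r′
    x y : ℕ → ℕ
    n : ℕ
    b d e f g h P L : Poly

  count-unique : Count X x → Count X y → ∀ n → x n ≡ y n
  count-unique X≅x X≅y n = card-unique (X≅x n) (X≅y n)

  count-⇔ : (∀ {g} → X g → Y g) → (∀ {g} → Y g → X g) → Count X x → Count Y x
  count-⇔ X⊆Y Y⊆X X≅x n = card-⇔ (λ (p , Xg) → p , X⊆Y Xg) (λ (p , Yg) → p , Y⊆X Yg) (X≅x n)

  count-∪ : (∀ {f g} → X f → Y g → ¬ f ≈ g) → Count X x → Count Y y → Count (X ∪ Y) (λ n → x n ℕ.+ y n)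
  count-∪ disjoint X≅x Y≅y n = card-⇔
    [ (λ (p , Xg) → p , inj₁ Xg) , (λ (p , Yg) → p , inj₂ Yg) ]′
    (λ (p , XYg) → Sum.map (p ,_) (p ,_) XYg)
    (card-∪ (λ (_ , Xf) (_ , Yg) → disjoint Xf Yg) (X≅x n) (Y≅y n))

  Linear : Poly → Set ℓ
  Linear L = Degree L 1

  module _ {L : Poly} (lin : Linear L) where

    linear∉1 : ¬ Below 1 L
    linear∉1 L∈1 = ℕ.<-irrefl ≡.refl (below-≤ L∈1 (proj₁ lin))

    linear≉0 : ¬ L ≈ 0#
    linear≉0 = degree≉0 lin

    linear-irreducible : Irreducible L
    linear-irreducible = linear∉1 , λ d e de≈L → split de≈L (below? 1 e)
      where
      split : ∀ {d e} → d * e ≈ L → Dec (Below 1 e) → Below 1 d ⊎ Below 1 e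
      split de≈L (yes e∈1) = inj₂ e∈1
      split de≈L (no e∉1)  = inj₁ (cofactor-below de≈L linear≉0 e∉1 (proj₂ lin))

    below-linear-* : Below n f → Below (suc n) (L * f)
    below-linear-* {zero}  {f} p = below-resp (sym (trans (*-congˡ (below-zero p)) (𝔸.zeroʳ L))) below-0
    below-linear-* {suc n} {f} p = proj₂ (leading 1 n L f (proj₂ lin) p)

    *-cancelˡ-linear : L * f ≈ L * g → f ≈ g
    *-cancelˡ-linear Lf≈Lg = *-cancelʳ linear≉0 (trans (*-comm _ L) (trans Lf≈Lg (*-comm L _)))

    ∣L* : ∀ f → L ∣ L * f
    ∣L* f = f , *-comm f L

    squareFree-linear-* : SquareFree f → ¬ L ∣ f → SquareFree (L * f)
    squareFree-linear-* {f} (f≉0 , sq) L∤f = *-≉0 linear≉0 f≉0 , λ h h²∣Lf → split h h²∣Lf (L ∣? h)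
      where
      split : ∀ h → h * h ∣ L * f → Dec (L ∣ h) → Below 1 h
      split h h²∣Lf (yes L∣h) = ⊥-elim (L∤f (∣-cancelʳ linear≉0 (∣-resp refl (*-comm L f) (∣-trans
            (∣-* L∣h L∣h) h²∣Lf))))
      split h h²∣Lf (no L∤h)  = sq h (comaximal-∣* (comaximal-sym (comaximal-* co co)) h²∣Lf)
        where co = irreducible-comaximal linear-irreducible L∤h

    squareFree-linear-∤ : SquareFree (L * f) → ¬ L ∣ f
    squareFree-linear-∤ {f} (_ , sq) L∣f = linear∉1 (sq L (∣-resp refl (*-comm f L) (∣-* L∣f ∣-refl)))

    Times : Pred Poly r → Pred Poly (c ⊔ ℓ ⊔ r)
    Times X g = ∃ λ f → X f × g ≈ L * f

    count-times : (∀ {f} → X f → ¬ f ≈ 0#) → Count X x → Count (Times X) (shift x)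
    count-times X≉0 X≅x zero = card-∅ λ (p , f , Xf , g≈Lf) →
      *-≉0 linear≉0 (X≉0 Xf) (trans (sym g≈Lf) (below-zero p))
    count-times X≉0 X≅x (suc n) = card-image (X≅x n) (λ (f , _) → L * f) *-congˡ *-cancelˡ-linear
      (λ (f , p , Xf) → below-linear-* p , f , Xf , refl)
      (λ g (p , f , Xf , g≈Lf) →
        (f , cofactor-below (trans (*-comm f L) (sym g≈Lf)) (≉0-resp (sym g≈Lf) (*-≉0 linear≉0
              (X≉0 Xf))) linear∉1 p , Xf) , g≈Lf)

    -- Under these closure conditions an element of `X` is either prime to `L` or `L` times an
    -- element of `X` prime to `L`. The relation obtained is division by 1 + z of the series of `X`.
    count-¬∣ : (∀ {f g} → f ≈ g → X f → X g) → (∀ {f} → X f → ¬ f ≈ 0#) →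
      (∀ {f} → X (L * f) → X f × ¬ L ∣ f) → (∀ {f} → X f → ¬ L ∣ f → X (L * f)) →
      Count X x → ∃ λ y → Count (X ∩ (¬_ ∘ (L ∣_))) y × ∀ n → y n ℕ.+ shift y n ≡ x n
    count-¬∣ X-resp X≉0 divide multiply X≅x
      with z , y , z+y≡x , ∣≅z , ∤≅y ← count-split (L ∣?_) (λ f≈g → ∣-resp refl f≈g) X≅x
      = y , ∤≅y , λ n → ≡.trans (ℕ.+-comm (y n) _) (≡.trans (≡.cong (ℕ._+ y n)
          (count-unique
            (count-⇔ {X = Times _}
              (λ (f , (Xf , L∤f) , g≈Lf) → X-resp (sym g≈Lf) (multiply Xf L∤f) , ∣-resp refl (sym g≈Lf) (∣L* f))
              (λ { (Xg , f , fL≈g) → let g≈Lf = trans (sym fL≈g) (*-comm f L) in f , divide (X-resp g≈Lf Xg) , g≈Lf })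
              (count-times (X≉0 ∘ proj₁) ∤≅y))
            ∣≅z n)) (z+y≡x n))

    Cube : Pred Poly r → Pred Poly (c ⊔ ℓ ⊔ r)
    Cube X = X ∪ (Times X ∪ Times (Times X))

    count-cube : (∀ {f g} → f ≈ g → X f → X g) → (∀ {f} → X f → ¬ f ≈ 0#) → (∀ {f} → X f → ¬ L ∣ f) →
      Count X x → Count (Cube X) (cube x)
    count-cube X-resp X≉0 X∤ X≅x =
      count-∪ (λ { Xf (inj₁ (h , _ , g≈Lh)) f≈g → X∤ Xf (∣-resp refl (sym (trans f≈g g≈Lh)) (∣L* h))
                 ; Xf (inj₂ (h , _ , g≈Lh)) f≈g → X∤ Xf (∣-resp refl (sym (trans f≈g g≈Lh)) (∣L* h)) })
        X≅x
        (count-∪ (λ (f , Xf , g≈Lf) (h , (k , _ , h≈Lk) , g′≈Lh) g≈g′ → X∤ Xf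
            (∣-resp refl (sym (trans (*-cancelˡ-linear (trans (sym g≈Lf) (trans g≈g′ g′≈Lh))) h≈Lk)) (∣L* k)))
          (count-times X≉0 X≅x)
          (count-times (λ (f , Xf , g≈Lf) → ≉0-resp (sym g≈Lf) (*-≉0 linear≉0 (X≉0 Xf))) (count-times X≉0 X≅x)))

    cube-elim : ∀ {r} {Z : Pred Poly r} → (∀ {f g} → f ≈ g → Z f → Z g) →
      (∀ {f} → X f → Z f) → (∀ {f} → X f → Z (L * f)) → (∀ {f} → X f → Z (L * (L * f))) →
      ∀ {g} → Cube X g → Z g
    cube-elim Z-resp z₀ z₁ z₂ (inj₁ Xg) = z₀ Xg
    cube-elim Z-resp z₀ z₁ z₂ (inj₂ (inj₁ (f , Xf , g≈Lf))) = Z-resp (sym g≈Lf) (z₁ Xf)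
    cube-elim Z-resp z₀ z₁ z₂ (inj₂ (inj₂ (h , (f , Xf , h≈Lf) , g≈Lh))) =
      Z-resp (sym (trans g≈Lh (*-congˡ h≈Lf))) (z₂ Xf)

    cube-resp : (∀ {f g} → f ≈ g → X f → X g) → f ≈ g → Cube X f → Cube X g
    cube-resp X-resp f≈g (inj₁ Xf) = inj₁ (X-resp f≈g Xf)
    cube-resp X-resp f≈g (inj₂ (inj₁ (h , Xh , f≈Lh))) = inj₂ (inj₁ (h , Xh , trans (sym f≈g) f≈Lh))
    cube-resp X-resp f≈g (inj₂ (inj₂ (h , TXh , f≈Lh))) = inj₂ (inj₂ (h , TXh , trans (sym f≈g) f≈Lh))

    -- `B` stands for the refutation. `rest` treats the part of `g` prime to `L`, and `big` an
    -- exponent of `L` that is at least 3.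
    cube-or-∣ : {B : Set r′} → (∀ {f g} → f ≈ g → X f → X g) → ∀ g → ¬ g ≈ 0# →
      (∀ f → f ∣ g → ¬ f ≈ 0# → ¬ L ∣ f → X f ⊎ B) → (L * (L * L) ∣ g → B) → Cube X g ⊎ B
    cube-or-∣ X-resp g g≉0 rest big with extract linear∉1 g g≉0
    ... | k , f , g≈Lᵏf , L∤f = by-exponent k g≈Lᵏf
      where
      f≉0 : ¬ f ≈ 0#
      f≉0 f≈0 = L∤f (∣-resp refl (sym f≈0) ∣0)
      by-exponent : ∀ k → g ≈ L ^ k * f → _
      by-exponent 0 e = Sum.map₁ (λ Xf → inj₁ (X-resp (sym (trans e (𝔸.*-identityˡ f))) Xf))
        (rest f (1# , sym e) f≉0 L∤f)
      by-exponent 1 e = Sum.map₁ (λ Xf → inj₂ (inj₁ (f , Xf , trans e (*-congʳ (𝔸.*-identityʳ L)))))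
        (rest f (L ^ 1 , sym e) f≉0 L∤f)
      by-exponent 2 e = Sum.map₁ (λ Xf → inj₂ (inj₂ (L * f , (f , Xf , refl) ,
          trans e (trans (*-congʳ (*-congˡ (𝔸.*-identityʳ L))) (*-assoc L L f)))))
        (rest f (L ^ 2 , sym e) f≉0 L∤f)
      by-exponent (suc (suc (suc k))) e = inj₂ (big (∣-resp
        (*-congˡ (*-congˡ (𝔸.*-identityʳ L))) (sym e) (∣*ʳ f (^-mono-∣ {3} {suc (suc (suc k))} L (s≤s (s≤s
              (s≤s z≤n)))))))

  ChenCount : (ℕ → ℕ) → Set _
  ChenCount x = Count (λ g → ¬ g ≈ 0# × Chen g) x

  -- A constant other than 0 and -1 makes squares of irreducibles an obstruction.
  chenCount-2< : ∀ {s} → 2 < q → Count SquareFree s → ChenCount s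
  chenCount-2< {s} 2<q = count-⇔ (λ sf → proj₁ sf , squareFree⇒chen sf)
    (λ (g≉0 , chen) → [ id , (λ (h , h∉1 , h²∣g) → ⊥-elim (square-factor g≉0 h∉1 h²∣g chen)) ]′ (squareFree? _ g≉0))
    where
    Bad : K.Carrier → Set ℓ
    Bad x = ¬ x K.≈ K.0# × ¬ K.1# K.+ x K.≈ K.0#
    bad? : ∀ x → Dec (Bad x)
    bad? x = ¬? (x ≟ K.0#) ×-dec ¬? ((K.1# K.+ x) ≟ K.0#)
    -- An element that is not `Bad` is 0 or -1, so two such elements of the same class coincide. If
    -- no element were `Bad`, more than two elements would fall injectively into two classes.
    class : ∀ {x} → Dec (x K.≈ K.0#) → Fin 2
    class (yes _) = zero
    class (no _)  = suc zero
    from-injective : ∀ {i j} → K≅q.from i K.≈ K≅q.from j → i ≡ j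
    from-injective {i} {j} e = ≡.trans (≡.sym (K≅q.strictlyInverseˡ i)) (≡.trans (K≅q.to-cong e)
          (K≅q.strictlyInverseˡ j))
    collide : ∀ {x y} → ¬ Bad x → ¬ Bad y → (dx : Dec (x K.≈ K.0#)) (dy : Dec
          (y K.≈ K.0#)) → class dx ≡ class dy → x K.≈ y
    collide ¬bx ¬by (yes x≈0) (yes y≈0) _ = K.trans x≈0 (K.sym y≈0)
    collide {x} {y} ¬bx ¬by (no x≉0) (no y≉0) _ = K.trans (-1≈ x x≉0 ¬bx) (K.sym (-1≈ y y≉0 ¬by))
      where
      -1≈ : ∀ x → ¬ x K.≈ K.0# → ¬ Bad x → x K.≈ K.- K.1#
      -1≈ x x≉0 ¬bx = inverseʳ-unique K.1# x (Dec.decidable-stable ((K.1# K.+ x) ≟ K.0#) λ 1+x≉0 → ¬bx (x≉0 , 1+x≉0))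
        where open import Algebra.Properties.AbelianGroup K.+-abelianGroup using (inverseʳ-unique)
    bad : ∃ Bad
    bad with Fin.any? (bad? ∘ K≅q.from)
    ... | yes (i , b) = K≅q.from i , b
    ... | no none with i , j , i<j , e ← Fin.pigeonhole 2<q (λ i → class (K≅q.from i ≟ K.0#)) =
      ⊥-elim (Fin.<⇒≢ i<j (from-injective (collide (λ b → none (i , b)) (λ b → none (j , b)) _ _ e)))
    constant-∤ : ∀ {x} → Irreducible P → ¬ x K.≈ K.0# → ¬ P ∣ (x ∷ [])
    constant-∤ (P∉1 , _) x≉0 = ∤-below P∉1 (below-∷ below-0) (λ e → x≉0 (at e 0))
    square-factor : ¬ g ≈ 0# → ¬ Below 1 h → h * h ∣ g → ¬ Chen g
    square-factor {g} {h} g≉0 h∉1 h²∣g with P , irr , P∣h ← irreducible-factor h h∉1 | x , x≉0 , 1+x≉0 ← bad =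
      square⇒¬chen irr g≉0 (∣-trans (∣-* P∣h P∣h) h²∣g) (x ∷ []) (constant-∤ irr x≉0)
        (λ P∣1+x → constant-∤ irr 1+x≉0 (∣-resp refl (trans (PR.∷-⊞ _ _ _ _) (∷-cong K.refl
              (𝔸.+-identityˡ []))) P∣1+x))

  -- Chen moduli over the field with two elements.

  module Binary (q≡2 : q ≡ 2) where

    bit : ∀ x → x K.≈ K.0# ⊎ x K.≈ K.1#
    bit x with x ≟ K.0# | x ≟ K.1#
    ... | yes x≈0 | _       = inj₁ x≈0
    ... | no _    | yes x≈1 = inj₂ x≈1
    ... | no x≉0  | no x≉1  = ⊥-elim (collision (Fin.pigeonhole (≡.subst (_< 3) (≡.sym q≡2) ℕ.≤-refl)
          (K≅q.to ∘ three)))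
      where
      three : Fin 3 → K.Carrier
      three zero             = K.0#
      three (suc zero)       = K.1#
      three (suc (suc zero)) = x
      to-injective : ∀ {y z} → K≅q.to y ≡ K≅q.to z → y K.≈ z
      to-injective {y} {z} e = K.trans (K.sym (K≅q.strictlyInverseʳ y)) (K.trans (K≅q.from-cong e)
            (K≅q.strictlyInverseʳ z))
      distinct : ∀ i j → i Fin.< j → ¬ three i K.≈ three j
      distinct zero       (suc zero)       _ e = proj₁ isField (K.sym e)
      distinct zero       (suc (suc zero)) _ e = x≉0 (K.sym e)
      distinct (suc zero) (suc (suc zero)) _ e = x≉1 (K.sym e)
      distinct (suc zero) (suc zero) (s≤s ()) _
      distinct (suc (suc zero)) (suc zero) (s≤s ()) _
      distinct (suc (suc zero)) (suc (suc zero)) (s≤s (s≤s ())) _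
      collision : (∃₂ λ i j → i Fin.< j × K≅q.to (three i) ≡ K≅q.to (three j)) → ⊥
      collision (i , j , i<j , e) = distinct i j i<j (to-injective e)

    t t+1 : Poly
    t   = K.0# ∷ K.1# ∷ []
    t+1 = K.1# ∷ K.1# ∷ []

    t-linear : Linear t
    t-linear = proj₁ isField , below-∷ (below-∷ below-0)

    t+1-linear : Linear t+1
    t+1-linear = proj₁ isField , below-∷ (below-∷ below-0)

    1+t≈t+1 : 1# + t ≈ t+1
    1+t≈t+1 = trans (PR.∷-⊞ _ _ _ _) (∷-cong (K.+-identityʳ _) (𝔸.+-identityˡ _))

    linear-cases : ∀ P → Below 2 P → ¬ Below 1 P → P ≈ t ⊎ P ≈ t+1
    linear-cases []          _ P∉1 = ⊥-elim (P∉1 below-0)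
    linear-cases (x ∷ [])    _ P∉1 = ⊥-elim (P∉1 (below-∷ below-0))
    linear-cases (x ∷ y ∷ f) p P∉1 with bit x | bit y
    ... | _        | inj₁ y≈0 = ⊥-elim (P∉1 (below-∷ (below-resp (sym (trans (∷-cong y≈0 f≈0) 0∷0)) below-0)))
      where f≈0 = below-zero (below-tail (below-tail p))
    ... | inj₁ x≈0 | inj₂ y≈1 = inj₁ (∷-cong x≈0 (∷-cong y≈1 (below-zero (below-tail (below-tail p)))))
    ... | inj₂ x≈1 | inj₂ y≈1 = inj₂ (∷-cong x≈1 (∷-cong y≈1 (below-zero (below-tail (below-tail p)))))

    -- A remainder modulo `L` is a constant, hence 0 or 1: this is the hypothesis of `chen-square`.
    linear-residues : Linear L → ∀ x → x ≡ 0# [mod L ] ⊎ x ≡ 1# [mod L ]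
    linear-residues lin x =
      let r , x≡r , r∈1 = reduce lin x
      in Sum.map
           (λ r₀≈0 → mod-trans x≡r (mod-reflexive (trans (constant r∈1) (trans (∷-cong r₀≈0 refl) 0∷0))))
           (λ r₀≈1 → mod-trans x≡r (mod-reflexive (trans (constant r∈1) (∷-cong r₀≈1 refl))))
           (bit (coeff r 0))

    chen-linear-* : Linear L → ¬ L ∣ f → Chen f → Chen (L * f)
    chen-linear-* lin L∤f = chen-* (irreducible-comaximal (linear-irreducible lin) L∤f)
      (chen-irreducible (linear-irreducible lin))

    chen-linear²-* : Linear L → ¬ L ∣ f → Chen f → Chen (L * (L * f))
    chen-linear²-* {L} {f} lin L∤f chen = chen-resp (*-assoc L L f)
      (chen-* (comaximal-sym (comaximal-* co co)) (chen-square L (linear-residues lin)) chen)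
      where co = comaximal-sym (irreducible-comaximal (linear-irreducible lin) L∤f)

    t∣t+1*⇒t∣ : t ∣ t+1 * f → t ∣ f
    t∣t+1*⇒t∣ = comaximal-∣* (irreducible-comaximal (linear-irreducible t-linear)
      λ t∣t+1 → irreducible-∤1 (linear-irreducible t-linear)
        (∣-resp refl (trans (+-congʳ (sym 1+t≈t+1)) (solve 1 (λ t → con ℤ.1ℤ :+ t :- t := con ℤ.1ℤ) refl t))
          (∣+ t∣t+1 (∣- ∣-refl))))

    -- V and U are the squarefree polynomials prime to t and to t (t + 1); by unique
    -- factorisation, the Chen moduli are tⁱ (t + 1)ʲ f with i, j ≤ 2 and f in U.
    V U W Good : Pred Poly (c ⊔ ℓ)
    V = SquareFree ∩ (¬_ ∘ (t ∣_))
    U = V ∩ (¬_ ∘ (t+1 ∣_))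
    W = Cube t+1-linear U
    Good = Cube t-linear W

    ∤-resp : f ≈ g → ¬ L ∣ f → ¬ L ∣ g
    ∤-resp f≈g L∤f L∣g = L∤f (∣-resp refl (sym f≈g) L∣g)

    V-resp : f ≈ g → V f → V g
    V-resp f≈g (sf , t∤f) = squareFree-resp f≈g sf , ∤-resp f≈g t∤f

    U-resp : f ≈ g → U f → U g
    U-resp f≈g (Vf , ∤f) = V-resp f≈g Vf , ∤-resp f≈g ∤f

    W-resp : f ≈ g → W f → W g
    W-resp = cube-resp t+1-linear {X = U} U-resp

    W≉0×t∤ : W f → ¬ f ≈ 0# × ¬ t ∣ f
    W≉0×t∤ = cube-elim t+1-linear {X = U} {Z = λ f → ¬ f ≈ 0# × ¬ t ∣ f} (λ f≈g
          (f≉0 , t∤f) → ≉0-resp f≈g f≉0 , ∤-resp f≈g t∤f)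
      (λ (((f≉0 , _) , t∤f) , _) → f≉0 , t∤f)
      (λ (((f≉0 , _) , t∤f) , _) → *-≉0 (linear≉0 t+1-linear) f≉0 , t∤f ∘ t∣t+1*⇒t∣)
      (λ (((f≉0 , _) , t∤f) , _) → *-≉0 (linear≉0 t+1-linear) (*-≉0 (linear≉0 t+1-linear) f≉0) ,
        t∤f ∘ t∣t+1*⇒t∣ ∘ t∣t+1*⇒t∣)

    W-chen : W f → Chen f
    W-chen = cube-elim t+1-linear {X = U} {Z = Chen} chen-resp
      (λ ((sf , _) , _) → squareFree⇒chen sf)
      (λ ((sf , _) , ∤f) → chen-linear-* t+1-linear ∤f (squareFree⇒chen sf))
      (λ ((sf , _) , ∤f) → chen-linear²-* t+1-linear ∤f (squareFree⇒chen sf))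

    good-chen : Good g → ¬ g ≈ 0# × Chen g
    good-chen = cube-elim t-linear {X = W} {Z = λ f → ¬ f ≈ 0# × Chen f} (λ f≈g
          (f≉0 , chen) → ≉0-resp f≈g f≉0 , chen-resp f≈g chen)
      (λ Wf → proj₁ (W≉0×t∤ Wf) , W-chen Wf)
      (λ Wf → *-≉0 (linear≉0 t-linear) (proj₁ (W≉0×t∤ Wf)) , chen-linear-* t-linear (proj₂ (W≉0×t∤ Wf)) (W-chen Wf))
      (λ Wf → *-≉0 (linear≉0 t-linear) (*-≉0 (linear≉0 t-linear) (proj₁ (W≉0×t∤ Wf))) ,
        chen-linear²-* t-linear (proj₂ (W≉0×t∤ Wf)) (W-chen Wf))

    -- A repeated irreducible factor P other than t and t + 1 has degree at least 2, so it divides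
    -- neither of them, and b = t meets the requirement that b and 1 + b be prime to P.
    squareFree-or-¬chen : ¬ g ≈ 0# → f ∣ g → ¬ f ≈ 0# → ¬ t ∣ f → ¬ t+1 ∣ f → SquareFree f ⊎ ¬ Chen g
    squareFree-or-¬chen {g} {f} g≉0 f∣g f≉0 t∤f t+1∤f = Sum.map₂ obstruct (squareFree? f f≉0)
      where
      obstruct : (∃ λ h → ¬ Below 1 h × h * h ∣ f) → ¬ Chen g
      obstruct (h , h∉1 , h²∣f) =
        let P , irr , P∣h = irreducible-factor h h∉1
            P²∣f = ∣-trans (∣-* P∣h P∣h) h²∣f
            P∣f = ∣-trans (P , refl) P²∣f
            P∉2 = λ P∈2 → [ (λ P≈t → t∤f (∣-resp P≈t refl P∣f)) , (λ P≈t+1 → t+1∤f (∣-resp P≈t+1 refl P∣f)) ]′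
                    (linear-cases P P∈2 (proj₁ irr))
        in square⇒¬chen irr g≉0 (∣-trans P²∣f f∣g) t
             (∤-below P∉2 (proj₂ t-linear) (linear≉0 t-linear))
             (λ P∣1+t → ∤-below P∉2 (proj₂ t+1-linear) (linear≉0 t+1-linear) (∣-resp refl 1+t≈t+1 P∣1+t))

    -- The powers of t and then of t + 1 are split off. An obstruction is met in a factor of `g`,
    -- but it is always turned into a refutation for `g` itself through transitivity of
    -- divisibility.
    good-or-¬chen : ∀ g → ¬ g ≈ 0# → Good g ⊎ ¬ Chen g
    good-or-¬chen g g≉0 = cube-or-∣ t-linear {X = W} W-resp g g≉0
      (λ f f∣g f≉0 t∤f → cube-or-∣ t+1-linear {X = U} U-resp f f≉0
        (λ k k∣f k≉0 t+1∤k →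
          let t∤k = λ t∣k → t∤f (∣-trans t∣k k∣f)
          in Sum.map₁ (λ sf → (sf , t∤k) , t+1∤k)
               (squareFree-or-¬chen g≉0 (∣-trans k∣f f∣g) k≉0 t∤k t+1∤k))
        (λ cube∣f → cube⇒¬chen (linear-irreducible t+1-linear) g≉0 (∣-trans cube∣f f∣g)))
      (cube⇒¬chen (linear-irreducible t-linear) g≉0)

    CubeCount : (ℕ → ℕ) → Set (c ⊔ ℓ)
    CubeCount s = ∃₂ λ v u → (∀ n → v n ℕ.+ shift v n ≡ s n) × (∀ n → u n ℕ.+ shift u n ≡ v n) ×
      ChenCount (cube (cube u))

    chenCount-2 : ∀ {s} → Count SquareFree s → CubeCount s
    chenCount-2 {s} SF≅s = step₁ (count-¬∣ t-linear squareFree-resp proj₁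
        (λ sf → squareFree-∣ (∣* sf) sf , squareFree-linear-∤ t-linear sf)
        (squareFree-linear-* t-linear) SF≅s)
      where
      ∣* : ∀ {L f} → SquareFree (L * f) → f ∣ L * f
      ∣* {L} _ = L , refl
      step₂ : ∀ {v} → (∀ n → v n ℕ.+ shift v n ≡ s n) →
        (∃ λ u → Count U u × ∀ n → u n ℕ.+ shift u n ≡ v n) → CubeCount s
      step₂ {v} v+v≡s (u , U≅u , u+u≡v) = v , u , v+v≡s , u+u≡v ,
        count-⇔ good-chen
          (λ (g≉0 , chen) → [ id , (λ ¬chen → ⊥-elim (¬chen chen)) ]′ (good-or-¬chen _ g≉0))
          (count-cube t-linear {X = W} W-resp (proj₁ ∘ W≉0×t∤) (proj₂ ∘ W≉0×t∤)
            (count-cube t+1-linear {X = U} U-resp (λ (((f≉0 , _) , _) , _) → f≉0) proj₂ U≅u))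
      step₁ : (∃ λ v → Count V v × ∀ n → v n ℕ.+ shift v n ≡ s n) → CubeCount s
      step₁ (v , V≅v , v+v≡s) = step₂ v+v≡s (count-¬∣ t+1-linear V-resp (proj₁ ∘ proj₁)
        (λ (sf , t∤) → (squareFree-∣ (∣* sf) sf , λ t∣f → t∤ (∣*ˡ t+1 t∣f)) , squareFree-linear-∤ t+1-linear sf)
        (λ (sf , t∤) t+1∤ → squareFree-linear-* t+1-linear sf t+1∤ , t∤ ∘ t∣t+1*⇒t∣)
        V≅v)

-- Passage to the notions of the statement.

module Density {c ℓ} (K : CommutativeRing c ℓ) (isField : IsField K)
  (q : ℕ) (K≅q : HasCardinality (CommutativeRing.setoid K) q) where

  private
    module K = CommutativeRing K
    module 𝒞 = ChenPairs K
    module 𝔸[x] = Polynomial 𝒞.polyRawRing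
    module D = RawMagmaDefinitions (RawRing.*-rawMagma 𝒞.polyRawRing)
  open ChenCounting K isField q K≅q public

  private variable
    r : Level
    m n : ℕ
    f g h x y : Poly

  -- Unfolded, the ring operations are those of the statement, so divisibility transfers by merely
  -- wrapping and unwrapping `_≋_`.
  opaque
    unfolding PR._⊞_

    ∣⇒ : f ∣ g → f D.∣ g
    ∣⇒ (k , e) = k D., at e

    ⇒∣ : f D.∣ g → f ∣ g
    ⇒∣ (k D., e) = k , coeffwise e

    mod⇒ : x ≡ y [mod f ] → x 𝒞.≡ y [mod f ]
    mod⇒ = ∣⇒

    ⇒mod : x 𝒞.≡ y [mod f ] → x ≡ y [mod f ]
    ⇒mod = ⇒∣

    eval≈ : ∀ F x → 𝔸[x].eval F x ≈ Polynomial.eval 𝔸.rawRing F x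
    eval≈ F x = refl

  degree⇒ : Degree g n → 𝒞.HasDegree g n
  degree⇒ (gₙ≉0 , p) = gₙ≉0 , vanish p

  below⇒𝒜 : Degree g n → Below n h → 𝒞.𝒜 g h
  below⇒𝒜 {g} {n} {h} deg p = [ (λ h≈0 → inj₂ (at h≈0))
    , (λ (m , degₕ) → inj₁ (m , n , degree⇒ degₕ , degree⇒ deg , below-≤ p (proj₁ degₕ))) ]′ (degree? h)

  reduce-𝒜 : Degree g n → ∀ x → ∃ λ r → x ≡ r [mod g ] × 𝒞.𝒜 g r
  reduce-𝒜 deg x = let r , x≡r , r∈n = reduce deg x in r , x≡r , below⇒𝒜 deg r∈n

  -- The polynomial is obtained on representatives only. It extends to every `x` because both σ and
  -- evaluation respect reduction modulo `g`.
  chenPair⇒chen : ¬ g ≈ 0# → 𝒞.ChenPair g g → Chen g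
  chenPair⇒chen {g} g≉0 chen σ pres = [ (λ g≈0 → ⊥-elim (g≉0 g≈0)) , (λ (_ , deg) →
      extend deg (chen σ (λ x≡y → mod⇒ (pres g ∣-refl _ _ (⇒mod x≡y)))
        (λ x y _ _ h h∣g x≡y → mod⇒ (pres h (⇒∣ h∣g) x y (⇒mod x≡y))))) ]′ (degree? g)
    where
    extend : Degree g n → 𝒞.IsPolynomialFunction g g σ → PolynomialModulo g σ
    extend deg (F , σ≡F) = F , λ x → let r , x≡r , r∈𝒜 = reduce-𝒜 deg x in
      mod-trans (pres g ∣-refl x r x≡r) (mod-trans (⇒mod (σ≡F r r∈𝒜))
        (mod-trans (mod-reflexive (eval≈ F r)) (eval-mod F (mod-sym x≡r))))

  -- Preservation is given on representatives only. For arbitrary arguments, `residue` moves σ to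
  -- the remainders modulo `g`, hence modulo each divisor `h`.
  chen⇒chenPair : ¬ g ≈ 0# → Chen g → 𝒞.ChenPair g g
  chen⇒chenPair {g} g≉0 chen σ residue pres = [ (λ g≈0 → ⊥-elim (g≉0 g≈0)) , (λ (_ , deg) → restrict (chen σ
        (preserving deg))) ]′ (degree? g)
    where
    restrict : PolynomialModulo g σ → 𝒞.IsPolynomialFunction g g σ
    restrict (F , σ≡F) = F , λ h _ → mod⇒ (mod-trans (σ≡F h) (mod-sym (mod-reflexive (eval≈ F h))))
    residue′ : x ≡ y [mod g ] → σ x ≡ σ y [mod g ]
    residue′ x≡y = ⇒mod (residue (mod⇒ x≡y))
    preserving : Degree g n → Preserving g σ
    preserving deg h h∣g x y x≡y =
      let r , x≡r , r∈𝒜 = reduce-𝒜 deg x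
          s , y≡s , s∈𝒜 = reduce-𝒜 deg y
      in mod-trans (mod-∣ h∣g (residue′ x≡r))
           (mod-trans (⇒mod (pres r s r∈𝒜 s∈𝒜 h (∣⇒ h∣g)
             (mod⇒ (mod-trans (mod-sym (mod-∣ h∣g x≡r)) (mod-trans x≡y (mod-∣ h∣g y≡s))))))
             (mod-sym (mod-∣ h∣g (residue′ y≡s))))

  degreeFrom1To⇒ : 𝒞.DegreeFrom1To m g → Below (suc m) g × ¬ Below 1 g
  degreeFrom1To⇒ (n , (gₙ≉0 , p) , 1≤n , n≤m) = below-mono (s≤s n≤m) (below p) ,
    λ g∈1 → gₙ≉0 (vanish g∈1 n 1≤n)

  ⇒degreeFrom1To : Below (suc m) g → ¬ Below 1 g → 𝒞.DegreeFrom1To m g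
  ⇒degreeFrom1To {g = g} p g∉1 = [ (λ g≈0 → ⊥-elim (¬below⇒≉0 g∉1 g≈0))
    , (λ (n , deg) → n , degree⇒ deg , ℕ.≰⇒> (λ n≤0 → g∉1 (below-mono (s≤s n≤0) (proj₂ deg)))
        , ℕ.≤-pred (below-≤ p (proj₁ deg))) ]′ (degree? g)

  -- Degrees 1 to `m` are those below `m + 1` without the constants, and `y 1` is the number of
  -- constants satisfying `Y`.
  count-nonconstant : ∀ {r} {Y : Pred Poly r} {y} → Count Y y → ∃ λ z →
    (∀ m → Card 𝒞.polySetoid (λ g → 𝒞.DegreeFrom1To m g × Y g) (z m)) × (∀ m → y 1 ℕ.+ z m ≡ y (suc m))
  count-nonconstant {Y = Y} {y} Y≅y = derive (count-split (below? 1) below-resp Y≅y)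
    where
    derive : (∃₂ λ k l → (∀ n → k n ℕ.+ l n ≡ y n) ×
      Count (Y ∩ Below 1) k × Count (Y ∩ (¬_ ∘ Below 1)) l) → _
    derive (k , l , k+l≡y , k≅ , l≅) = l ∘ suc ,
      (λ m → card-image (l≅ (suc m)) proj₁ at coeffwise
        (λ (g , p , Yg , g∉1) → ⇒degreeFrom1To p g∉1 , Yg)
        (λ g (deg , Yg) → let p , g∉1 = degreeFrom1To⇒ deg in (g , p , Yg , g∉1) , λ i → K.refl)) ,
      (λ m → ≡.trans (≡.cong (ℕ._+ l (suc m)) (card-unique (Y≅y 1)
          (card-⇔ (λ (p , Yg , g∈1) → g∈1 , Yg) (λ (g∈1 , Yg) → below-mono (s≤s z≤n) g∈1 , Yg , g∈1) (k≅ (suc m)))))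
        (k+l≡y (suc m)))

  -- The two sequences lose different constants: `x 1` counts nonzero ones, while `total` omits all
  -- `q`, zero included. Taking `Y` to be trivially true makes the same lemma yield `total`.
  chenDensity : ∀ {x ρ} → ChenCount x →
    (∀ (count total : ℕ → ℕ) → (∀ m → x 1 ℕ.+ count m ≡ x (suc m)) →
      (∀ m → q ℕ.+ total m ≡ q ℕ.^ suc m) → RatioTendsTo count total ρ) →
    𝒞.HasNaturalDensity (λ g → 𝒞.ChenPair g g) ρ
  chenDensity {x} {ρ} C≅x limit = derive (count-nonconstant C≅x)
      (count-nonconstant {Y = λ _ → ⊤ {ℓ}} (λ n → card-⇔ (λ p → p , tt) proj₁ (card-below n)))
    where
    derive : (∃ λ z → (∀ m → Card 𝒞.polySetoid (λ g → 𝒞.DegreeFrom1To m g × (¬ g ≈ 0# × Chen g)) (z m)) ×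
               (∀ m → x 1 ℕ.+ z m ≡ x (suc m))) →
      (∃ λ z → (∀ m → Card 𝒞.polySetoid (λ g → 𝒞.DegreeFrom1To m g × ⊤ {ℓ}) (z m)) ×
               (∀ m → q ℕ.^ 1 ℕ.+ z m ≡ q ℕ.^ suc m)) →
      𝒞.HasNaturalDensity (λ g → 𝒞.ChenPair g g) ρ
    derive (count , count≅ , count≡) (total , total≅ , total≡) = count , total ,
      (λ m → card-⇔ (λ (deg , g≉0 , chen) → deg , chen⇒chenPair g≉0 chen)
        (λ (deg , chen) → let g≉0 = ¬below⇒≉0 (proj₂ (degreeFrom1To⇒ deg)) in deg , g≉0 , chenPair⇒chen g≉0 chen)
        (count≅ m)) ,
      (λ m → card-⇔ proj₁ (λ deg → deg , tt) (total≅ m)) ,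
      limit count total count≡ (λ m → ≡.trans (≡.cong (ℕ._+ total m) (≡.sym (ℕ.*-identityʳ q))) (total≡ m))

-- Limits of the counting ratios.

module Limits where

  open import Relation.Binary.PropositionalEquality using (refl; sym; trans; cong; cong₂; subst)

  private
    -- The distance is |b x - a y| / (y b), and a positive ε with denominator d is at least 1 / d,
    -- so it is enough to compare d |b x - a y| with y.
    close : ∀ x y a b d → .{{_ : ℕ.NonZero y}} .{{_ : ℕ.NonZero b}} (ε : ℚ) → ℚ.0ℚ ℚ.< ε → d ≡ ℚ.↧ₙ ε →
      d ℕ.* ℤ.∣ + (b ℕ.* x) ℤ.- + (a ℕ.* y) ∣ < y →
      ℚ.∣ (+ x ℚ./ y) ℚ.- (+ a ℚ./ b) ∣ ℚ.< ε
    close x y@(suc y′) a b@(suc b′) d ε@(mkℚ (+ suc k) d-1 _) 0<ε refl bound =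
      ℚ.toℚᵘ-cancel-< (ℚᵘ.<-respˡ-≃ (ℚᵘ.≃-sym unnormalised) (*<*
        (≡.subst₂ ℤ._<_ (ℤ.pos-* ℤ.∣ + x ℤ.* + b ℤ.+ (ℤ.- + a) ℤ.* + y ∣ d) (ℤ.pos-* (suc k) (y ℕ.* b))
              (ℤ.+<+ cross))))
      where
      unnormalised : toℚᵘ (ℚ.∣ (+ x ℚ./ y) ℚ.- (+ a ℚ./ b) ∣) ℚᵘ.≃ ℚᵘ.∣ mkℚᵘ (+ x) y′ ℚᵘ.- mkℚᵘ (+ a) b′ ∣
      unnormalised = ℚᵘ.≃-trans (ℚ.toℚᵘ-homo-∣-∣ ((+ x ℚ./ y) ℚ.- (+ a ℚ./ b)))
        (ℚᵘ.∣-∣-cong (ℚᵘ.≃-trans (ℚ.toℚᵘ-homo-+ (+ x ℚ./ y) (ℚ.- (+ a ℚ./ b)))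
          (ℚᵘ.+-cong (ℚ.toℚᵘ-fromℚᵘ (mkℚᵘ (+ x) y′))
            (ℚᵘ.≃-trans (ℚ.toℚᵘ-homo‿- (+ a ℚ./ b)) (ℚᵘ.-‿cong (ℚ.toℚᵘ-fromℚᵘ (mkℚᵘ (+ a) b′)))))))
      numerator : + x ℤ.* + b ℤ.+ (ℤ.- + a) ℤ.* + y ≡ + (b ℕ.* x) ℤ.- + (a ℕ.* y)
      numerator = cong₂ ℤ._+_ (trans (ℤ.*-comm (+ x) (+ b)) (sym (ℤ.pos-* b x)))
        (trans (sym (ℤ.neg-distribˡ-* (+ a) (+ y))) (cong ℤ.-_ (sym (ℤ.pos-* a y))))
      cross : ℤ.∣ + x ℤ.* + b ℤ.+ (ℤ.- + a) ℤ.* + y ∣ ℕ.* d < suc k ℕ.* (y ℕ.* b)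
      cross = begin-strict
        ℤ.∣ + x ℤ.* + b ℤ.+ (ℤ.- + a) ℤ.* + y ∣ ℕ.* d     ≡⟨ cong (λ i → ℤ.∣ i ∣ ℕ.* d) numerator ⟩
        ℤ.∣ + (b ℕ.* x) ℤ.- + (a ℕ.* y) ∣ ℕ.* d           ≡⟨ ℕ.*-comm ℤ.∣ + (b ℕ.* x) ℤ.- + (a ℕ.* y) ∣ d ⟩
        d ℕ.* ℤ.∣ + (b ℕ.* x) ℤ.- + (a ℕ.* y) ∣           <⟨ bound ⟩
        y                                                 ≤⟨ ℕ.m≤m*n y b ⟩
        y ℕ.* b                                           ≤⟨ ℕ.m≤n*m (y ℕ.* b) (suc k) ⟩
        suc k ℕ.* (y ℕ.* b)                               ∎
        where open ℕ.≤-Reasoning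
    close x y a b d (mkℚ (+ zero) _ _) (ℚ.*<* (ℤ.+<+ ())) _ _
    close x y a b d (mkℚ -[1+ _ ] _ _) (ℚ.*<* ()) _ _

  Eventually : (ℕ → Set) → Set
  Eventually P = ∃ λ N → ∀ m → N ≤ m → P m

  -- `k` takes the place of the denominator of ε. The strict bound also shows that `y m` is nonzero.
  ratioTendsTo : ∀ (x y : ℕ → ℕ) a b .{{_ : ℕ.NonZero b}} →
    (∀ k → Eventually λ m → k ℕ.* ℤ.∣ + (b ℕ.* x m) ℤ.- + (a ℕ.* y m) ∣ < y m) →
    RatioTendsTo x y (+ a ℚ./ b)
  ratioTendsTo x y a b bound ε 0<ε = let N , small = bound (ℚ.↧ₙ ε) in
    N , λ m N≤m → let y>0 = ℕ.>-nonZero (ℕ.≤-<-trans z≤n (small m N≤m)) in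
      y>0 , close (x m) (y m) a b (ℚ.↧ₙ ε) {{y>0}} ε 0<ε refl (small m N≤m)

  n<q^n : ∀ {q} → 1 < q → ∀ n → n < q ℕ.^ n
  n<q^n 1<q zero    = ℕ.≤-refl
  n<q^n {q} 1<q (suc n) = begin-strict
    suc n                <⟨ ℕ.m<n+m (suc n) ℕ.z<s ⟩
    suc n ℕ.+ suc n      ≡⟨ cong (suc n ℕ.+_) (ℕ.+-identityʳ (suc n)) ⟨
    2 ℕ.* suc n          ≤⟨ ℕ.*-mono-≤ 1<q (n<q^n 1<q n) ⟩
    q ℕ.* q ℕ.^ n        ∎
    where open ℕ.≤-Reasoning

  -- Here count m = (q - 1) qᵐ and total m = qᵐ⁺¹ - q for m ≥ 1, so q count - (q - 1) total is the
  -- constant (q - 1) q.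
  limit-2< : ∀ {q} .{{_ : ℕ.NonZero q}} → 2 < q → ∀ {s : ℕ → ℕ} → s 1 ≡ q ℕ.∸ 1 →
    (∀ n → (q ℕ.^ n ℕ.∸ 1) ℕ.* q ℕ.+ s (2 ℕ.+ n) ≡ q ℕ.^ (2 ℕ.+ n) ℕ.∸ 1) →
    (count total : ℕ → ℕ) → (∀ m → s 1 ℕ.+ count m ≡ s (suc m)) →
    (∀ m → q ℕ.+ total m ≡ q ℕ.^ suc m) → RatioTendsTo count total (+ (q ℕ.∸ 1) ℚ./ q)
  limit-2< {suc r} 2<q {s} s1≡r s≡ count total count≡ total≡ = ratioTendsTo count total r q λ k →
    -- From m < qᵐ, this threshold gives qᵐ⁺¹ ≥ q (k r + 2); after the q constants are removed, k r
    -- q + q remains, which exceeds k r q.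
    suc (suc (k ℕ.* r)) , λ { m@(suc n) N≤m → subst (λ e → k ℕ.* e < total m) (sym (error n)) (small k m N≤m) }
    where
    open ℕ.≤-Reasoning
    q = suc r
    count-exact : ∀ n → count (suc n) ≡ r ℕ.* q ℕ.^ suc n
    count-exact n = ℕ.+-cancelʳ-≡ T (count (suc n)) (r ℕ.* T) (begin-equality
      count (suc n) ℕ.+ T                                  ≡⟨ cong (λ Q → count (suc n) ℕ.+ q ℕ.* Q) (sym Q≡) ⟩
      count (suc n) ℕ.+ q ℕ.* suc p                        ≡⟨ solve 3 (λ c r p → c :+ (con 1 :+ r) :*
            (con 1 :+ p) := con 1 :+ (p :* (con 1 :+ r) :+ (r :+ c))) refl (count (suc n)) r p ⟩
      suc (p ℕ.* q ℕ.+ (r ℕ.+ count (suc n)))              ≡⟨ cong (λ z → suc (p ℕ.* q ℕ.+ z)) (trans (cong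
            (ℕ._+ count (suc n)) (sym s1≡r)) (count≡ (suc n))) ⟩
      suc (p ℕ.* q ℕ.+ s (2 ℕ.+ n))                        ≡⟨ cong suc (s≡ n) ⟩
      suc (q ℕ.^ (2 ℕ.+ n) ℕ.∸ 1)                          ≡⟨ ℕ.suc-pred (q ℕ.^ (2 ℕ.+ n)) {{ℕ.m^n≢0 q (2 ℕ.+ n)}} ⟩
      T ℕ.+ r ℕ.* T                                        ≡⟨ ℕ.+-comm T (r ℕ.* T) ⟩
      r ℕ.* T ℕ.+ T                                        ∎)
      where
      open ℕSolver.+-*-Solver
      T = q ℕ.^ suc n
      p = q ℕ.^ n ℕ.∸ 1
      Q≡ : suc p ≡ q ℕ.^ n
      Q≡ = ℕ.suc-pred (q ℕ.^ n) {{ℕ.m^n≢0 q n}}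
    balance : ∀ n → q ℕ.* count (suc n) ≡ r ℕ.* q ℕ.+ r ℕ.* total (suc n)
    balance n = begin-equality
      q ℕ.* count (suc n)                 ≡⟨ cong (q ℕ.*_) (count-exact n) ⟩
      q ℕ.* (r ℕ.* q ℕ.^ suc n)           ≡⟨ solve 3 (λ q r T → q :* (r :* T) := r :* (q :* T)) refl q r
            (q ℕ.^ suc n) ⟩
      r ℕ.* q ℕ.^ (2 ℕ.+ n)               ≡⟨ cong (r ℕ.*_) (total≡ (suc n)) ⟨
      r ℕ.* (q ℕ.+ total (suc n))         ≡⟨ ℕ.*-distribˡ-+ r q (total (suc n)) ⟩
      r ℕ.* q ℕ.+ r ℕ.* total (suc n)     ∎
      where open ℕSolver.+-*-Solver
    error : ∀ n → ℤ.∣ + (q ℕ.* count (suc n)) ℤ.- + (r ℕ.* total (suc n)) ∣ ≡ r ℕ.* q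
    error n = cong ℤ.∣_∣ (trans (cong (λ z → + z ℤ.- + (r ℕ.* total (suc n))) (balance n))
      (solve 2 (λ a b → a :+ b :- b := a) refl (+ (r ℕ.* q)) (+ (r ℕ.* total (suc n)))))
      where open ℤSolver.+-*-Solver
    small : ∀ k m → suc (suc (k ℕ.* r)) ≤ m → k ℕ.* (r ℕ.* q) < total m
    small k m N≤m = ℕ.+-cancelˡ-≤ q _ _ (begin
      q ℕ.+ suc (k ℕ.* (r ℕ.* q))         ≡⟨ solve 3 (λ q k r → q :+ (con 1 :+ k :* (r :* q)) := con 1 :+
            (q :+ q :* (k :* r))) refl q k r ⟩
      suc (q ℕ.+ q ℕ.* (k ℕ.* r))         ≤⟨ ℕ.+-monoˡ-≤ _ (s≤s (z≤n {r})) ⟩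
      q ℕ.+ (q ℕ.+ q ℕ.* (k ℕ.* r))       ≡⟨ solve 2 (λ q z → q :+ (q :+ q :* z) := q :* (con 2 :+ z)) refl q
            (k ℕ.* r) ⟩
      q ℕ.* suc (suc (k ℕ.* r))           ≤⟨ ℕ.*-monoʳ-≤ q (ℕ.≤-trans N≤m (ℕ.<⇒≤ (n<q^n (ℕ.<⇒≤ 2<q) m))) ⟩
      q ℕ.^ suc m                         ≡⟨ total≡ m ⟨
      q ℕ.+ total m                       ∎)
      where open ℕSolver.+-*-Solver

  -- The constant 4 is attained at n = 4. From there on (n + 1)³ ≤ 2 n³ carries the induction; the
  -- smaller cases are checked.
  cube≤4*2^n : ∀ n → n ℕ.* (n ℕ.* n) ≤ 4 ℕ.* 2 ℕ.^ n
  cube≤4*2^n 0 = z≤n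
  cube≤4*2^n 1 = s≤s z≤n
  cube≤4*2^n 2 = ℕ.m≤m+n 8 8
  cube≤4*2^n 3 = ℕ.m≤m+n 27 5
  cube≤4*2^n (suc (suc (suc (suc k)))) = from-4 k
    where
    open ℕ.≤-Reasoning
    open ℕSolver.+-*-Solver
    from-4 : ∀ k → (4 ℕ.+ k) ℕ.* ((4 ℕ.+ k) ℕ.* (4 ℕ.+ k)) ≤ 4 ℕ.* 2 ℕ.^ (4 ℕ.+ k)
    from-4 zero    = ℕ.≤-refl
    from-4 (suc k) = begin
      (5 ℕ.+ k) ℕ.* ((5 ℕ.+ k) ℕ.* (5 ℕ.+ k))
        -- The added term is the slack 2 (4 + k)³ - (5 + k)³.
        ≤⟨ ℕ.m≤m+n _ (k ℕ.* (k ℕ.* k) ℕ.+ 9 ℕ.* (k ℕ.* k) ℕ.+ 21 ℕ.* k ℕ.+ 3) ⟩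
      (5 ℕ.+ k) ℕ.* ((5 ℕ.+ k) ℕ.* (5 ℕ.+ k)) ℕ.+ (k ℕ.* (k ℕ.* k) ℕ.+ 9 ℕ.* (k ℕ.* k) ℕ.+ 21 ℕ.* k ℕ.+ 3)
        ≡⟨ solve 1 (λ k → (con 5 :+ k) :* ((con 5 :+ k) :* (con 5 :+ k)) :+ (k :* (k :* k) :+ con 9 :*
              (k :* k) :+ con 21 :* k :+ con 3)
             := con 2 :* ((con 4 :+ k) :* ((con 4 :+ k) :* (con 4 :+ k)))) refl k ⟩
      2 ℕ.* ((4 ℕ.+ k) ℕ.* ((4 ℕ.+ k) ℕ.* (4 ℕ.+ k)))
        ≤⟨ ℕ.*-monoʳ-≤ 2 (from-4 k) ⟩
      2 ℕ.* (4 ℕ.* 2 ℕ.^ (4 ℕ.+ k))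
        ≡⟨ solve 1 (λ z → con 2 :* (con 4 :* z) := con 4 :* (con 2 :* z)) refl (2 ℕ.^ (4 ℕ.+ k)) ⟩
      4 ℕ.* 2 ℕ.^ (5 ℕ.+ k) ∎

  square-negligible : ∀ C (y : ℕ → ℕ) → (∀ m → 2 ℕ.+ y m ≡ 2 ℕ.^ suc m) →
    ∀ k → Eventually λ m → k ℕ.* (C ℕ.* (suc (suc m)) ℕ.^ 2) < y m
  -- With M = m + 2 ≥ 8 D, the product 8 D M² is at most M³, hence at most 4 · 2ᴹ = 8 · 2ᵐ⁺¹. The 3
  -- inside `D` absorbs the two constants missing from `y` and the strictness of the inequality.
  square-negligible C y y≡ k = 8 ℕ.* D , λ m N≤m → ℕ.+-cancelˡ-≤ 2 _ _ (begin
    2 ℕ.+ suc (k ℕ.* (C ℕ.* (suc (suc m)) ℕ.^ 2))   ≤⟨ bound (suc m) ⟩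
    D ℕ.* (suc (suc m) ℕ.* suc (suc m))             ≤⟨ ℕ.*-cancelˡ-≤ 8 (scaled m (ℕ.≤-trans N≤m (ℕ.≤-trans
          (ℕ.n≤1+n m) (ℕ.n≤1+n (suc m))))) ⟩
    2 ℕ.^ suc m                                     ≡⟨ y≡ m ⟨
    2 ℕ.+ y m                                       ∎)
    where
    open ℕ.≤-Reasoning
    open ℕSolver.+-*-Solver
    D = k ℕ.* C ℕ.+ 3
    bound : ∀ n → 2 ℕ.+ suc (k ℕ.* (C ℕ.* suc n ℕ.^ 2)) ≤ D ℕ.* (suc n ℕ.* suc n)
    bound n = begin
      3 ℕ.+ k ℕ.* (C ℕ.* suc n ℕ.^ 2)
        ≤⟨ ℕ.m≤m+n _ (3 ℕ.* (n ℕ.* n ℕ.+ 2 ℕ.* n)) ⟩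
      3 ℕ.+ k ℕ.* (C ℕ.* suc n ℕ.^ 2) ℕ.+ 3 ℕ.* (n ℕ.* n ℕ.+ 2 ℕ.* n)
        ≡⟨ solve 3 (λ k C n → con 3 :+ k :* (C :* ((con 1 :+ n) :* ((con 1 :+ n) :* con 1))) :+ con 3 :*
              (n :* n :+ con 2 :* n)
             := (k :* C :+ con 3) :* ((con 1 :+ n) :* (con 1 :+ n))) refl k C n ⟩
      D ℕ.* (suc n ℕ.* suc n) ∎
    scaled : ∀ m → 8 ℕ.* D ≤ suc (suc m) → 8 ℕ.* (D ℕ.* (suc (suc m) ℕ.* suc (suc m))) ≤ 8 ℕ.* 2 ℕ.^ suc m
    scaled m N≤ = begin
      8 ℕ.* (D ℕ.* (suc (suc m) ℕ.* suc (suc m)))             ≡⟨ ℕ.*-assoc 8 D _ ⟨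
      8 ℕ.* D ℕ.* (suc (suc m) ℕ.* suc (suc m))               ≤⟨ ℕ.*-monoˡ-≤ (suc (suc m) ℕ.* suc (suc m)) N≤ ⟩
      suc (suc m) ℕ.* (suc (suc m) ℕ.* suc (suc m))           ≤⟨ cube≤4*2^n (suc (suc m)) ⟩
      4 ℕ.* (2 ℕ.* 2 ℕ.^ suc m)                               ≡⟨ ℕ.*-assoc 4 2 (2 ℕ.^ suc m) ⟨
      8 ℕ.* 2 ℕ.^ suc m                                       ∎

  -- The scale 72 makes every constant below integral.
  defect : (ℕ → ℕ) → ℕ → ℕ → ℤ
  defect x a n = + (72 ℕ.* x n) ℤ.- + (a ℕ.* 2 ℕ.^ n)

  -- That is, x n = (a / 72) 2ⁿ + O((n + 1)ᵈ).
  Asymptotic : ℕ → (ℕ → ℕ) → ℕ → Set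
  Asymptotic d x a = ∃ λ C → ∀ n → ℤ.∣ defect x a n ∣ ≤ C ℕ.* suc n ℕ.^ d

  asymptotic-+ : ∀ {d x y a b} → Asymptotic d x a → Asymptotic d y b →
    Asymptotic d (λ n → x n ℕ.+ y n) (a ℕ.+ b)
  asymptotic-+ {d} {x} {y} {a} {b} (C , p) (C′ , p′) = C ℕ.+ C′ , λ n → begin
    ℤ.∣ defect (λ n → x n ℕ.+ y n) (a ℕ.+ b) n ∣         ≡⟨ cong ℤ.∣_∣ (split n) ⟩
    ℤ.∣ defect x a n ℤ.+ defect y b n ∣                  ≤⟨ ℤ.∣i+j∣≤∣i∣+∣j∣ (defect x a n) (defect y b n) ⟩
    ℤ.∣ defect x a n ∣ ℕ.+ ℤ.∣ defect y b n ∣            ≤⟨ ℕ.+-mono-≤ (p n) (p′ n) ⟩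
    C ℕ.* suc n ℕ.^ d ℕ.+ C′ ℕ.* suc n ℕ.^ d             ≡⟨ ℕ.*-distribʳ-+ (suc n ℕ.^ d) C C′ ⟨
    (C ℕ.+ C′) ℕ.* suc n ℕ.^ d                           ∎
    where
    open ℕ.≤-Reasoning
    split : ∀ n → defect (λ n → x n ℕ.+ y n) (a ℕ.+ b) n ≡ defect x a n ℤ.+ defect y b n
    split n = trans (cong₂ (λ u v → + u ℤ.- + v) (ℕ.*-distribˡ-+ 72 (x n) (y n)) (ℕ.*-distribʳ-+ (2 ℕ.^ n) a b))
      (solve 4 (λ x y u v → (x :+ y) :- (u :+ v) := (x :- u) :+ (y :- v)) refl
        (+ (72 ℕ.* x n)) (+ (72 ℕ.* y n)) (+ (a ℕ.* 2 ℕ.^ n)) (+ (b ℕ.* 2 ℕ.^ n)))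
      where open ℤSolver.+-*-Solver

  -- Shifting halves the leading coefficient, and the defect at n + 1 is the old one at n. The
  -- inserted value at 0 has defect -a, which the added `a` covers.
  asymptotic-shift : ∀ {d x} a → Asymptotic d x (a ℕ.* 2) → Asymptotic d (shift x) a
  asymptotic-shift {d} {x} a (C , p) = C ℕ.+ a , bound
    where
    open ℕ.≤-Reasoning
    bound : ∀ n → ℤ.∣ defect (shift x) a n ∣ ≤ (C ℕ.+ a) ℕ.* suc n ℕ.^ d
    bound zero = begin
      ℤ.∣ + 0 ℤ.- + (a ℕ.* 1) ∣       ≡⟨ cong ℤ.∣_∣ (ℤ.+-identityˡ (ℤ.- + (a ℕ.* 1))) ⟩
      ℤ.∣ ℤ.- + (a ℕ.* 1) ∣           ≡⟨ ℤ.∣-i∣≡∣i∣ (+ (a ℕ.* 1)) ⟩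
      a ℕ.* 1                         ≡⟨ ℕ.*-identityʳ a ⟩
      a                               ≤⟨ ℕ.m≤n+m a C ⟩
      C ℕ.+ a                         ≡⟨ ℕ.*-identityʳ _ ⟨
      (C ℕ.+ a) ℕ.* 1                 ≡⟨ cong ((C ℕ.+ a) ℕ.*_) (ℕ.^-zeroˡ d) ⟨
      (C ℕ.+ a) ℕ.* 1 ℕ.^ d           ∎
    bound (suc n) = begin
      ℤ.∣ + (72 ℕ.* x n) ℤ.- + (a ℕ.* (2 ℕ.* 2 ℕ.^ n)) ∣  ≡⟨ cong (λ z → ℤ.∣ + (72 ℕ.* x n) ℤ.- + z ∣) (sym
            (ℕ.*-assoc a 2 (2 ℕ.^ n))) ⟩
      ℤ.∣ defect x (a ℕ.* 2) n ∣                          ≤⟨ p n ⟩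
      C ℕ.* suc n ℕ.^ d                                   ≤⟨ ℕ.*-mono-≤ (ℕ.m≤m+n C a) (ℕ.^-monoˡ-≤ d (ℕ.n≤1+n
            (suc n))) ⟩
      (C ℕ.+ a) ℕ.* suc (suc n) ℕ.^ d                     ∎

  -- The leading coefficient satisfies y + y / 2 = x, whence the factor 2/3. The defects obey the
  -- same recurrence y n = x n - y (n - 1), so their sizes accumulate: the bound closes by (n + 2)ᵈ
  -- + (n + 1) (n + 2)ᵈ = (n + 2)ᵈ⁺¹. At 0 there is no previous term, which costs `b`.
  asymptotic-unshift : ∀ {d x y} b → (∀ n → y n ℕ.+ shift y n ≡ x n) →
    Asymptotic d x (b ℕ.* 3) → Asymptotic (suc d) y (b ℕ.* 2)
  asymptotic-unshift {d} {x} {y} b y+y≡x (C , p) = C ℕ.+ b , bound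
    where
    open ℕ.≤-Reasoning
    bound : ∀ n → ℤ.∣ defect y (b ℕ.* 2) n ∣ ≤ (C ℕ.+ b) ℕ.* suc n ℕ.^ suc d
    bound zero = begin
      ℤ.∣ defect y (b ℕ.* 2) 0 ∣                   ≡⟨ cong ℤ.∣_∣ initial ⟩
      ℤ.∣ defect x (b ℕ.* 3) 0 ℤ.+ + b ∣           ≤⟨ ℤ.∣i+j∣≤∣i∣+∣j∣ (defect x (b ℕ.* 3) 0) (+ b) ⟩
      ℤ.∣ defect x (b ℕ.* 3) 0 ∣ ℕ.+ b             ≤⟨ ℕ.+-monoˡ-≤ b (p 0) ⟩
      C ℕ.* 1 ℕ.^ d ℕ.+ b                          ≡⟨ cong (λ z → C ℕ.* z ℕ.+ b) (ℕ.^-zeroˡ d) ⟩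
      C ℕ.* 1 ℕ.+ b                                ≡⟨ cong (ℕ._+ b) (ℕ.*-identityʳ C) ⟩
      C ℕ.+ b                                      ≡⟨ ℕ.*-identityʳ _ ⟨
      (C ℕ.+ b) ℕ.* 1                              ≡⟨ cong ((C ℕ.+ b) ℕ.*_) (ℕ.^-zeroˡ (suc d)) ⟨
      (C ℕ.+ b) ℕ.* 1 ℕ.^ suc d                    ∎
      where
      initial : defect y (b ℕ.* 2) 0 ≡ defect x (b ℕ.* 3) 0 ℤ.+ + b
      initial = trans (cong (λ u → + (72 ℕ.* u) ℤ.- + (b ℕ.* 2 ℕ.* 1)) (trans (sym (ℕ.+-identityʳ (y 0))) (y+y≡x 0)))
        (trans (cong (λ z → + (72 ℕ.* x 0) ℤ.- z) (trans (cong +_ (ℕ.*-identityʳ (b ℕ.* 2))) (ℤ.pos-* b 2)))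
        (trans (solve 2 (λ x b → x :- b :* con (+ 2) := (x :- b :* con (+ 3)) :+ b) refl (+ (72 ℕ.* x 0)) (+ b))
        (cong (λ z → (+ (72 ℕ.* x 0) ℤ.- z) ℤ.+ + b) (sym (trans (cong +_ (ℕ.*-identityʳ (b ℕ.* 3)))
              (ℤ.pos-* b 3))))))
        where open ℤSolver.+-*-Solver
    bound (suc n) = begin
      ℤ.∣ defect y (b ℕ.* 2) (suc n) ∣
        ≡⟨ cong ℤ.∣_∣ step ⟩
      ℤ.∣ defect x (b ℕ.* 3) (suc n) ℤ.- defect y (b ℕ.* 2) n ∣
        ≤⟨ ℤ.∣i-j∣≤∣i∣+∣j∣ (defect x (b ℕ.* 3) (suc n)) (defect y (b ℕ.* 2) n) ⟩
      ℤ.∣ defect x (b ℕ.* 3) (suc n) ∣ ℕ.+ ℤ.∣ defect y (b ℕ.* 2) n ∣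
        ≤⟨ ℕ.+-mono-≤ (p (suc n)) (bound n) ⟩
      C ℕ.* suc (suc n) ℕ.^ d ℕ.+ (C ℕ.+ b) ℕ.* (suc n ℕ.* suc n ℕ.^ d)
        ≤⟨ ℕ.+-mono-≤ (ℕ.*-monoˡ-≤ (suc (suc n) ℕ.^ d) (ℕ.m≤m+n C b))
             (ℕ.*-monoʳ-≤ (C ℕ.+ b) (ℕ.*-monoʳ-≤ (suc n) (ℕ.^-monoˡ-≤ d (ℕ.n≤1+n (suc n))))) ⟩
      (C ℕ.+ b) ℕ.* suc (suc n) ℕ.^ d ℕ.+ (C ℕ.+ b) ℕ.* (suc n ℕ.* suc (suc n) ℕ.^ d)
        ≡⟨ ℕ.*-distribˡ-+ (C ℕ.+ b) (suc (suc n) ℕ.^ d) _ ⟨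
      (C ℕ.+ b) ℕ.* suc (suc n) ℕ.^ suc d ∎
      where
      open ℤSolver.+-*-Solver
      pow : ∀ i → + (b ℕ.* i ℕ.* (2 ℕ.* 2 ℕ.^ n)) ≡ + b ℤ.* + i ℤ.* (+ 2 ℤ.* + (2 ℕ.^ n))
      pow i = trans (ℤ.pos-* (b ℕ.* i) _) (cong₂ ℤ._*_ (ℤ.pos-* b i) (ℤ.pos-* 2 (2 ℕ.^ n)))
      step : defect y (b ℕ.* 2) (suc n) ≡ defect x (b ℕ.* 3) (suc n) ℤ.- defect y (b ℕ.* 2) n
      step = trans (cong (λ z → + (72 ℕ.* y (suc n)) ℤ.- z) (pow 2))
        (trans (solve 4 (λ y y′ b z → y′ :- b :* con (+ 2) :* (con (+ 2) :* z)
             := ((y′ :+ y) :- b :* con (+ 3) :* (con (+ 2) :* z)) :- (y :- b :* con (+ 2) :* z)) refl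
             (+ (72 ℕ.* y n)) (+ (72 ℕ.* y (suc n))) (+ b) (+ (2 ℕ.^ n)))
        (cong₂ ℤ._-_
          (cong₂ ℤ._-_ (cong +_ (trans (sym (ℕ.*-distribˡ-+ 72 (y (suc n)) (y n))) (cong (72 ℕ.*_) (y+y≡x
                (suc n))))) (sym (pow 3)))
          (cong (λ z → + (72 ℕ.* y n) ℤ.- z) (sym (trans (ℤ.pos-* (b ℕ.* 2) _) (cong (ℤ._* + (2 ℕ.^ n))
                (ℤ.pos-* b 2)))))))

  -- For n ≥ 2 the recurrence gives s n = 1 + 2ⁿ⁻¹, whose defect is exactly 72; at 0 and 1 the
  -- defects are -36 and 0.
  asymptotic-squareFree : ∀ {s : ℕ → ℕ} → s 0 ≡ 0 → s 1 ≡ 1 →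
    (∀ n → (2 ℕ.^ n ℕ.∸ 1) ℕ.* 2 ℕ.+ s (2 ℕ.+ n) ≡ 2 ℕ.^ (2 ℕ.+ n) ℕ.∸ 1) → Asymptotic 0 s 36
  asymptotic-squareFree {s} s0≡0 s1≡1 s≡ = 72 , bound
    where
    open ℕ.≤-Reasoning
    exact : ∀ n → 72 ℕ.* s (2 ℕ.+ n) ≡ 72 ℕ.+ 36 ℕ.* 2 ℕ.^ (2 ℕ.+ n)
    exact n = trans (cong (72 ℕ.*_) s-exact) (trans
        (solve 1 (λ Q → con 72 :* (con 1 :+ con 2 :* Q) := con 72 :+ con 36 :* (con 2 :* (con 2 :* Q))) refl
              (2 ℕ.^ n)) refl)
      where
      open ℕSolver.+-*-Solver
      p = 2 ℕ.^ n ℕ.∸ 1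
      Q≡ : suc p ≡ 2 ℕ.^ n
      Q≡ = ℕ.suc-pred (2 ℕ.^ n) {{ℕ.m^n≢0 2 n}}
      s-exact : s (2 ℕ.+ n) ≡ 1 ℕ.+ 2 ℕ.* 2 ℕ.^ n
      s-exact = ℕ.+-cancelˡ-≡ (suc (p ℕ.* 2)) _ _ (begin-equality
        suc (p ℕ.* 2 ℕ.+ s (2 ℕ.+ n))             ≡⟨ cong suc (s≡ n) ⟩
        suc (2 ℕ.^ (2 ℕ.+ n) ℕ.∸ 1)               ≡⟨ ℕ.suc-pred (2 ℕ.^ (2 ℕ.+ n)) {{ℕ.m^n≢0 2 (2 ℕ.+ n)}} ⟩
        2 ℕ.* (2 ℕ.* 2 ℕ.^ n)                     ≡⟨ cong (λ Q → 2 ℕ.* (2 ℕ.* Q)) Q≡ ⟨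
        2 ℕ.* (2 ℕ.* suc p)                       ≡⟨ solve 1 (λ p → con 2 :* (con 2 :*
              (con 1 :+ p)) := con 1 :+ p :* con 2 :+ (con 1 :+ con 2 :* (con 1 :+ p))) refl p ⟩
        suc (p ℕ.* 2) ℕ.+ (1 ℕ.+ 2 ℕ.* suc p)     ≡⟨ cong (λ Q → suc (p ℕ.* 2) ℕ.+ (1 ℕ.+ 2 ℕ.* Q)) Q≡ ⟩
        suc (p ℕ.* 2) ℕ.+ (1 ℕ.+ 2 ℕ.* 2 ℕ.^ n)   ∎)
    bound : ∀ n → ℤ.∣ defect s 36 n ∣ ≤ 72
    bound 0 = subst (λ z → ℤ.∣ + (72 ℕ.* z) ℤ.- + 36 ∣ ≤ 72) (sym s0≡0) (ℕ.m≤m+n 36 36)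
    bound 1 = subst (λ z → ℤ.∣ + (72 ℕ.* z) ℤ.- + 72 ∣ ≤ 72) (sym s1≡1) z≤n
    bound (suc (suc n)) = ℕ.≤-reflexive (cong ℤ.∣_∣ (trans
        (cong (λ z → + z ℤ.- + (36 ℕ.* 2 ℕ.^ (2 ℕ.+ n))) (exact n))
        (solve 2 (λ a b → a :+ b :- b := a) refl (+ 72) (+ (36 ℕ.* 2 ℕ.^ (2 ℕ.+ n))))))
      where open ℤSolver.+-*-Solver

  -- The leading coefficient is multiplied by 1 + 1/2 + 1/4 = 7/4; the factor 4 keeps both halvings
  -- integral.
  asymptotic-cube : ∀ {d x} a → Asymptotic d x (a ℕ.* 2 ℕ.* 2) →
    Asymptotic d (cube x) (a ℕ.* 2 ℕ.* 2 ℕ.+ (a ℕ.* 2 ℕ.+ a))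
  asymptotic-cube {d} {x} a p = asymptotic-+ {d} {x} {_} {a ℕ.* 2 ℕ.* 2} p
    (asymptotic-+ {d} {shift x} {_} {a ℕ.* 2} (asymptotic-shift {d} {x} (a ℕ.* 2) p)
      (asymptotic-shift {d} {shift x} a (asymptotic-shift {d} {x} (a ℕ.* 2) p)))

  limit-2 : ∀ {c : ℕ → ℕ} → Asymptotic 2 c 49 →
    (count total : ℕ → ℕ) → (∀ m → c 1 ℕ.+ count m ≡ c (suc m)) →
    (∀ m → 2 ℕ.+ total m ≡ 2 ℕ.^ suc m) → RatioTendsTo count total (+ 49 ℚ./ 72)
  limit-2 {c} (C , p) count total count≡ total≡ = ratioTendsTo count total 49 72 λ k →
    let N , small = square-negligible (C ℕ.+ E) total total≡ k in
    N , λ m N≤m → ℕ.≤-<-trans (ℕ.*-monoʳ-≤ k (bound m)) (small m N≤m)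
    where
    open ℕ.≤-Reasoning
    -- The constants excluded from both counts: 98 is 49 times the two constant polynomials, against
    -- 72 times the `c 1` constants that are counted by `c`.
    E = ℤ.∣ + 98 ℤ.- + (72 ℕ.* c 1) ∣
    split : ∀ m → + (72 ℕ.* count m) ℤ.- + (49 ℕ.* total m) ≡ defect c 49 (suc m) ℤ.+ (+ 98 ℤ.- + (72 ℕ.* c 1))
    split m = trans
      (solve 4 (λ x t k n → x :- t := ((k :+ x) :- (n :+ t)) :+ (n :- k)) refl
        (+ (72 ℕ.* count m)) (+ (49 ℕ.* total m)) (+ (72 ℕ.* c 1)) (+ 98))
      (cong (ℤ._+ (+ 98 ℤ.- + (72 ℕ.* c 1))) (cong₂ (λ u v → + u ℤ.- + v)
        (trans (sym (ℕ.*-distribˡ-+ 72 (c 1) (count m))) (cong (72 ℕ.*_) (count≡ m)))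
        (trans (sym (ℕ.*-distribˡ-+ 49 2 (total m))) (cong (49 ℕ.*_) (total≡ m)))))
      where open ℤSolver.+-*-Solver
    bound : ∀ m → ℤ.∣ + (72 ℕ.* count m) ℤ.- + (49 ℕ.* total m) ∣ ≤ (C ℕ.+ E) ℕ.* suc (suc m) ℕ.^ 2
    bound m = begin
      ℤ.∣ + (72 ℕ.* count m) ℤ.- + (49 ℕ.* total m) ∣                  ≡⟨ cong ℤ.∣_∣ (split m) ⟩
      ℤ.∣ defect c 49 (suc m) ℤ.+ (+ 98 ℤ.- + (72 ℕ.* c 1)) ∣          ≤⟨ ℤ.∣i+j∣≤∣i∣+∣j∣ (defect c 49 (suc m)) _ ⟩
      ℤ.∣ defect c 49 (suc m) ∣ ℕ.+ E                                  ≤⟨ ℕ.+-mono-≤ (p (suc m)) (ℕ.m≤m*n E (suc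
            (suc m) ℕ.^ 2) {{ℕ.m^n≢0 (suc (suc m)) 2}}) ⟩
      C ℕ.* suc (suc m) ℕ.^ 2 ℕ.+ E ℕ.* suc (suc m) ℕ.^ 2              ≡⟨ ℕ.*-distribʳ-+ (suc (suc m) ℕ.^ 2) C E ⟨
      (C ℕ.+ E) ℕ.* suc (suc m) ℕ.^ 2                                  ∎

theorem1p10 : ∀ {c ℓ : Level} (q : ℕ) → PrimePower q →
    (𝔽q : CommutativeRing c ℓ) → IsField 𝔽q →
    HasCardinality (CommutativeRing.setoid 𝔽q) q →
    let open ChenPairs 𝔽q in
    (q ≡ 2 → HasNaturalDensity (λ g → ChenPair g g) (+ 49 / 72)) ×
    ((2<q : 2 < q) →
    HasNaturalDensity (λ g → ChenPair g g)
    (_/_ (+ (q ∸ 1)) q {{>-nonZero (<-trans z<s 2<q)}}))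
theorem1p10 q _ 𝔽q isField 𝔽q≅q = binary , general
  where
  open Density 𝔽q isField q 𝔽q≅q
  open Limits
  Result : ℚ → Set _
  Result = ChenPairs.HasNaturalDensity 𝔽q (λ g → ChenPairs.ChenPair 𝔽q g g)

  binary : q ≡ 2 → Result (+ 49 / 72)
  binary ≡.refl = by-squareFree count-squareFree
    where
    by-squareFree : SquareFreeCount → Result (+ 49 / 72)
    by-squareFree (s , SF≅s , s0≡0 , s1≡1 , s≡) = by-chen (Binary.chenCount-2 ≡.refl SF≅s)
      where
      by-chen : Binary.CubeCount ≡.refl s → Result (+ 49 / 72)
      by-chen (v , u , v+v≡s , u+u≡v , C≅c) = chenDensity {ρ = + 49 / 72} C≅c (limit-2 {cube w}
            (asymptotic-cube {2} {w} 7 w~))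
        where
        -- Over 72 the leading coefficients run 36 = 12 · 3, 24 = 8 · 3, 16 = 4 · 4, 28 = 7 · 4 and
        -- 49; the error exponent rises from 0 to 2 in the two divisions and then stays.
        v~ = asymptotic-unshift {0} {s} {v} 12 v+v≡s (asymptotic-squareFree {s} s0≡0 s1≡1 s≡)
        u~ = asymptotic-unshift {1} {v} {u} 8 u+u≡v v~
        w = cube u
        w~ = asymptotic-cube {2} {u} 4 u~

  general : (2<q : 2 < q) → Result (_/_ (+ (q ∸ 1)) q {{>-nonZero (<-trans z<s 2<q)}})
  general 2<q = by-squareFree count-squareFree
    where
    by-squareFree : SquareFreeCount → Result (_/_ (+ (q ∸ 1)) q {{>-nonZero (<-trans z<s 2<q)}})
    by-squareFree (s , SF≅s , _ , s1≡q-1 , s≡) =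
      chenDensity {ρ = _/_ (+ (q ∸ 1)) q {{>-nonZero (<-trans z<s 2<q)}}} (chenCount-2< 2<q SF≅s)
            (limit-2< {{>-nonZero (<-trans z<s 2<q)}} 2<q {s} s1≡q-1 s≡)
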